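{- The graphs $G_{E_8}$ and $\overline{\Gamma}_1$ (the complement of $\Gamma_1$) are quantum isomorphic, non-isomorphic strongly regular graphs.
   Context: The $E_8$ root system $\Psi_{E_8}\subset\mathbb{R}^8$ consists of the 240 vectors $\pm e_i\pm e_j$ ($1\le i<j\le 8$) and all $x\in\{\pm1\}^8$ with $\prod_i x_i=1$. $G_{E_8}$ is the graph with vertices $v_x$, $x\in\Psi_{E_8}$, where $v_x=v_{ -x}$ (120 vertices), and $v_x\sim v_y$ iff $\langle x,y\rangle=0$. The folded halved 8-cube graph has as vertices the pairs $\{x,\mathbf{1}+x\}$ for $x\in\mathbb{F}_2^8$ with $\sum_ix_i=0$ ($\mathbf{1}$ the all-ones vector), two vertices $\{x,\mathbf{1}+x\},\{y,\mathbf{1}+y\}$ being adjacent iff $x+y$ or $x+y+\mathbf{1}$ has exactly two nonzero coordinates. The graph $\Gamma_1$ (Brouwer–Ivanov–Klin) has as vertices one orbit of the independent sets of size 8 of the folded halved 8-cube graph under the group $\mathbb{Z}_2^6\times A_8$ (generated by translations by even-weight vectors and even permutations of the 8 coordinates), namely the orbit of size 120 considered by Brouwer, Ivanov and Klin; two vertices are adjacent iff the corresponding independent sets have exactly two points in common. A graph is strongly regular with parameters $(n,k,\lambda,\mu)$ if it has $n$ vertices, is $k$-regular, adjacent vertices have $\lambda$ common neighbours and distinct non-adjacent vertices have $\mu$ common neighbours. A quantum permutation matrix over a unital $C^*$-algebra $\mathcal{A}$ is $u=(u_{ij})\in M_n(\mathcal{A})$ with $u_{ij}=u_{ij}^*=u_{ij}^2$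 and $\sum_ku_{ik}=1=\sum_ku_{ki}$ for all $i$. Graphs $G_1,G_2$ on $n$ vertices are quantum isomorphic if there is a unital $C^*$-algebra $\mathcal{A}$ and a quantum permutation matrix $u\in M_n(\mathcal{A})$ with $A_{G_1}u=uA_{G_2}$, where $A_G$ denotes the adjacency matrix. -}

module Defs where

open import Algebra.Bundles using (Ring; CommutativeRing)
open import Algebra.Structures using (IsRing)
open import Algebra.Module.Structures using (IsLeftModule)
import Algebra.Properties.CommutativeMonoid.Sum as CMSum
open import Data.Bool.Base using (Bool; if_then_else_; _∧_; T)
import Data.Bool.Properties as Bool
open import Data.Fin.Base as Fin using (Fin; zero; suc)
import Data.Fin.Properties as Fin
open import Data.Fin.Patterns using (0F; 1F; 2F; 3F; 4F; 5F; 6F; 7F)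
open import Data.Fin.Permutation using (Permutation′; _⟨$⟩ʳ_; _⟨$⟩ˡ_; flip; ↔⇒≡)
open import Data.Integer.Base as ℤ using (ℤ; 0ℤ; 1ℤ; -1ℤ; _◃_)
import Data.Integer.Properties as ℤ
open import Data.Nat.Base as ℕ using (ℕ; zero; suc; _⊔_)
open import Data.Nat.Divisibility using (_∣_)
import Data.Nat.Properties as ℕ
open import Data.Parity.Base as ℙ using (Parity; 0ℙ; 1ℙ)
import Data.Parity.Properties as ℙ
open import Data.Product.Base using (Σ; ∃-syntax; Σ-syntax; _×_; _,_; proj₁; proj₂)
open import Data.Rational.Base as ℚ using (ℚ; 0ℚ; 1ℚ; ½)
import Data.Rational.Properties as ℚ
import Data.Rational.Solver as ℚSolver
open import Data.Sign.Base using (Sign)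
import Data.Sign.Base as Sign
open import Data.Sum.Base using (_⊎_; inj₁; inj₂)
open import Data.Vec.Base as Vec using (Vec; []; _∷_; lookup; tabulate; zipWith; replicate; count)
import Data.Vec.Properties as Vec
open import Data.Vec.Relation.Unary.All using (All; []; _∷_)
open import Function.Base using (_∘_; case_of_)
open import Function.Bundles using (Inverse; _⇔_)
open import Function.Construct.Composition using () renaming (inverse to _⟨∘⟩_)
open import Function.Construct.Symmetry using () renaming (inverse to inverse-sym)
open import Level using (0ℓ)
open import Relation.Binary.Bundles using (Setoid)
open import Relation.Binary.Core using (Rel)
open import Relation.Binary.Definitions using (Symmetric; Irreflexive; _Respects₂_)
import Relation.Binary.Construct.On as On
open import Relation.Binary.PropositionalEquality as ≡ using (_≡_; _≢_; refl; cong; cong₂)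
open import Relation.Nullary using (¬_; Dec; does; map′; ¬?; _→-dec_; _×-dec_; _⊎-dec_)
open import Relation.Nullary.Decidable using (from-yes)

IsCauchySeq : (ℕ → ℚ) → Set
IsCauchySeq x = ∀ ε → 0ℚ ℚ.< ε →
  ∃[ N ] ∀ m n → N ℕ.≤ m → N ℕ.≤ n → ℚ.∣ x m ℚ.- x n ∣ ℚ.≤ ε

record ℝ : Set where
  constructor mkℝ
  field
    seq    : ℕ → ℚ
    cauchy : IsCauchySeq seq

open ℝ public

infix 4 _≃ℝ_ _≤ℝ_

_≃ℝ_ : Rel ℝ 0ℓ
x ≃ℝ y = ∀ ε → 0ℚ ℚ.< ε → ∃[ N ] ∀ n → N ℕ.≤ n → ℚ.∣ seq x n ℚ.- seq y n ∣ ℚ.≤ ε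

_≤ℝ_ : Rel ℝ 0ℓ
x ≤ℝ y = ∀ ε → 0ℚ ℚ.< ε → ∃[ N ] ∀ n → N ℕ.≤ n → seq x n ℚ.≤ seq y n ℚ.+ ε

private
  module ℚS = ℚSolver.+-*-Solver

  abstract
    half-pos : ∀ {ε} → 0ℚ ℚ.< ε → 0ℚ ℚ.< ½ ℚ.* ε
    half-pos {ε} ε>0 = ≡.subst (ℚ._< ½ ℚ.* ε) (ℚ.*-zeroʳ ½) (ℚ.*-monoʳ-<-pos ½ ε>0)

    halves : ∀ ε → ½ ℚ.* ε ℚ.+ ½ ℚ.* ε ≡ ε
    halves ε = ≡.trans (≡.sym (ℚ.*-distribʳ-+ ε ½ ½)) (ℚ.*-identityˡ ε)

    ∣p-p∣≡0 : ∀ p → ℚ.∣ p ℚ.- p ∣ ≡ 0ℚ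
    ∣p-p∣≡0 p = cong ℚ.∣_∣ (ℚ.+-inverseʳ p)

    ∣p-q∣≡∣q-p∣ : ∀ p q → ℚ.∣ p ℚ.- q ∣ ≡ ℚ.∣ q ℚ.- p ∣
    ∣p-q∣≡∣q-p∣ p q = ≡.trans
      (cong ℚ.∣_∣ (solve 2 (λ p q → p :- q := :- (q :- p)) refl p q))
      (ℚ.∣-p∣≡∣p∣ (q ℚ.- p))
      where open ℚS

    neg-close : ∀ a b → ℚ.∣ a ℚ.- b ∣ ≡ ℚ.∣ (ℚ.- a) ℚ.- (ℚ.- b) ∣
    neg-close a b = ≡.trans (∣p-q∣≡∣q-p∣ a b)
      (cong ℚ.∣_∣ (solve 2 (λ a b → b :- a := (:- a) :- (:- b)) refl a b))
      where open ℚS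

    add-close : ∀ a a′ b b′ {δ ε} → ℚ.∣ a ℚ.- a′ ∣ ℚ.≤ δ → ℚ.∣ b ℚ.- b′ ∣ ℚ.≤ ε →
                ℚ.∣ (a ℚ.+ b) ℚ.- (a′ ℚ.+ b′) ∣ ℚ.≤ δ ℚ.+ ε
    add-close a a′ b b′ {δ} {ε} p q = begin
      ℚ.∣ (a ℚ.+ b) ℚ.- (a′ ℚ.+ b′) ∣
        ≡⟨ cong ℚ.∣_∣ (solve 4 (λ a a′ b b′ → (a :+ b) :- (a′ :+ b′) := (a :- a′) :+ (b :- b′)) refl a a′ b b′) ⟩
      ℚ.∣ (a ℚ.- a′) ℚ.+ (b ℚ.- b′) ∣
        ≤⟨ ℚ.∣p+q∣≤∣p∣+∣q∣ (a ℚ.- a′) (b ℚ.- b′) ⟩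
      ℚ.∣ a ℚ.- a′ ∣ ℚ.+ ℚ.∣ b ℚ.- b′ ∣
        ≤⟨ ℚ.+-mono-≤ p q ⟩
      δ ℚ.+ ε ∎
      where open ℚS
            open ℚ.≤-Reasoning

    trans-close : ∀ a b c {δ ε} → ℚ.∣ a ℚ.- b ∣ ℚ.≤ δ → ℚ.∣ b ℚ.- c ∣ ℚ.≤ ε →
                  ℚ.∣ a ℚ.- c ∣ ℚ.≤ δ ℚ.+ ε
    trans-close a b c {δ} {ε} p q = begin
      ℚ.∣ a ℚ.- c ∣
        ≡⟨ cong ℚ.∣_∣ (solve 3 (λ a b c → a :- c := (a :- b) :+ (b :- c)) refl a b c) ⟩
      ℚ.∣ (a ℚ.- b) ℚ.+ (b ℚ.- c) ∣
        ≤⟨ ℚ.∣p+q∣≤∣p∣+∣q∣ (a ℚ.- b) (b ℚ.- c) ⟩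
      ℚ.∣ a ℚ.- b ∣ ℚ.+ ℚ.∣ b ℚ.- c ∣
        ≤⟨ ℚ.+-mono-≤ p q ⟩
      δ ℚ.+ ε ∎
      where open ℚS
            open ℚ.≤-Reasoning

    abs-mul-≤ : ∀ p q {A B} → ℚ.∣ p ∣ ℚ.≤ A → ℚ.∣ q ∣ ℚ.≤ B → ℚ.∣ p ℚ.* q ∣ ℚ.≤ A ℚ.* B
    abs-mul-≤ p q {A} {B} p≤A q≤B = begin
      ℚ.∣ p ℚ.* q ∣          ≡⟨ ℚ.∣p*q∣≡∣p∣*∣q∣ p q ⟩
      ℚ.∣ p ∣ ℚ.* ℚ.∣ q ∣    ≤⟨ ℚ.*-monoʳ-≤-nonNeg ℚ.∣ q ∣ {{ℚ.nonNegative (ℚ.0≤∣p∣ q)}} p≤A ⟩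
      A ℚ.* ℚ.∣ q ∣          ≤⟨ ℚ.*-monoˡ-≤-nonNeg A {{ℚ.nonNegative (ℚ.≤-trans (ℚ.0≤∣p∣ p) p≤A)}} q≤B ⟩
      A ℚ.* B                ∎
      where open ℚ.≤-Reasoning

    mul-close : ∀ a a′ b b′ {A B δ ε} → ℚ.∣ a ∣ ℚ.≤ A → ℚ.∣ b′ ∣ ℚ.≤ B →
                ℚ.∣ a ℚ.- a′ ∣ ℚ.≤ δ → ℚ.∣ b ℚ.- b′ ∣ ℚ.≤ ε →
                ℚ.∣ a ℚ.* b ℚ.- a′ ℚ.* b′ ∣ ℚ.≤ A ℚ.* ε ℚ.+ δ ℚ.* B
    mul-close a a′ b b′ {A} {B} {δ} {ε} a≤A b≤B p q = begin
      ℚ.∣ a ℚ.* b ℚ.- a′ ℚ.* b′ ∣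
        ≡⟨ cong ℚ.∣_∣ (solve 4 (λ a a′ b b′ → a :* b :- a′ :* b′ := a :* (b :- b′) :+ (a :- a′) :* b′) refl a a′ b b′) ⟩
      ℚ.∣ a ℚ.* (b ℚ.- b′) ℚ.+ (a ℚ.- a′) ℚ.* b′ ∣
        ≤⟨ ℚ.∣p+q∣≤∣p∣+∣q∣ (a ℚ.* (b ℚ.- b′)) ((a ℚ.- a′) ℚ.* b′) ⟩
      ℚ.∣ a ℚ.* (b ℚ.- b′) ∣ ℚ.+ ℚ.∣ (a ℚ.- a′) ℚ.* b′ ∣
        ≤⟨ ℚ.+-mono-≤ (abs-mul-≤ a (b ℚ.- b′) a≤A q) (abs-mul-≤ (a ℚ.- a′) b′ p b≤B) ⟩
      A ℚ.* ε ℚ.+ δ ℚ.* B ∎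
      where open ℚS
            open ℚ.≤-Reasoning

    bounded : ∀ x → ∃[ B ] 0ℚ ℚ.< B × ∃[ N ] ∀ n → N ℕ.≤ n → ℚ.∣ seq x n ∣ ℚ.≤ B
    bounded x with cauchy x 1ℚ (ℚ.positive⁻¹ 1ℚ)
    ... | N , close = 1ℚ ℚ.+ ℚ.∣ seq x N ∣ , pos , N , λ n N≤n → begin
      ℚ.∣ seq x n ∣
        ≡⟨ cong ℚ.∣_∣ (solve 2 (λ a b → a := (a :- b) :+ b) refl (seq x n) (seq x N)) ⟩
      ℚ.∣ (seq x n ℚ.- seq x N) ℚ.+ seq x N ∣
        ≤⟨ ℚ.∣p+q∣≤∣p∣+∣q∣ (seq x n ℚ.- seq x N) (seq x N) ⟩
      ℚ.∣ seq x n ℚ.- seq x N ∣ ℚ.+ ℚ.∣ seq x N ∣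
        ≤⟨ ℚ.+-monoˡ-≤ ℚ.∣ seq x N ∣ (close n N N≤n ℕ.≤-refl) ⟩
      1ℚ ℚ.+ ℚ.∣ seq x N ∣ ∎
      where
      open ℚS
      open ℚ.≤-Reasoning
      pos : 0ℚ ℚ.< 1ℚ ℚ.+ ℚ.∣ seq x N ∣
      pos = ℚ.+-mono-<-≤ (ℚ.positive⁻¹ 1ℚ) (ℚ.0≤∣p∣ (seq x N))

    scale : ∀ {B ε} → 0ℚ ℚ.< B → 0ℚ ℚ.< ε → ∃[ δ ] 0ℚ ℚ.< δ × B ℚ.* δ ≡ ½ ℚ.* ε
    scale {B} {ε} B>0 ε>0 = δ , δ>0 , eq
      where
      instance
        B-pos : ℚ.Positive B
        B-pos = ℚ.positive B>0
        B-nz : ℚ.NonZero B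
        B-nz = ℚ.pos⇒nonZero B
        i-pos : ℚ.Positive (ℚ.1/ B)
        i-pos = ℚ.1/pos⇒pos B
      δ : ℚ
      δ = (ℚ.1/ B) ℚ.* (½ ℚ.* ε)
      δ>0 : 0ℚ ℚ.< δ
      δ>0 = ≡.subst (ℚ._< δ) (ℚ.*-zeroʳ (ℚ.1/ B)) (ℚ.*-monoʳ-<-pos (ℚ.1/ B) (half-pos ε>0))
      eq : B ℚ.* δ ≡ ½ ℚ.* ε
      eq = ≡.trans (≡.sym (ℚ.*-assoc B (ℚ.1/ B) (½ ℚ.* ε)))
             (≡.trans (cong (ℚ._* (½ ℚ.* ε)) (ℚ.*-inverseʳ B)) (ℚ.*-identityˡ _))

    ≤-halves : ∀ {p} ε → p ℚ.≤ ½ ℚ.* ε ℚ.+ ½ ℚ.* ε → p ℚ.≤ ε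
    ≤-halves {p} ε = ≡.subst (p ℚ.≤_) (halves ε)

    mul-close-ε : ∀ a a′ b b′ {A B δ η} ε → A ℚ.* δ ≡ ½ ℚ.* ε → B ℚ.* η ≡ ½ ℚ.* ε →
                  ℚ.∣ a ∣ ℚ.≤ A → ℚ.∣ b′ ∣ ℚ.≤ B →
                  ℚ.∣ a ℚ.- a′ ∣ ℚ.≤ η → ℚ.∣ b ℚ.- b′ ∣ ℚ.≤ δ →
                  ℚ.∣ a ℚ.* b ℚ.- a′ ℚ.* b′ ∣ ℚ.≤ ε
    mul-close-ε a a′ b b′ {A} {B} {δ} {η} ε Aδ Bη a≤A b≤B p q = ≤-halves ε
      (≡.subst (ℚ.∣ a ℚ.* b ℚ.- a′ ℚ.* b′ ∣ ℚ.≤_)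
        (cong₂ ℚ._+_ Aδ (≡.trans (ℚ.*-comm η B) Bη))
        (mul-close a a′ b b′ a≤A b≤B p q))

    ⊔₁ : ∀ m n {k} → m ⊔ n ℕ.≤ k → m ℕ.≤ k
    ⊔₁ m n = ℕ.≤-trans (ℕ.m≤m⊔n m n)

    ⊔₂ : ∀ m n {k} → m ⊔ n ℕ.≤ k → n ℕ.≤ k
    ⊔₂ m n = ℕ.≤-trans (ℕ.m≤n⊔m m n)

    const-cauchy : ∀ q → IsCauchySeq (λ _ → q)
    const-cauchy q ε ε>0 = 0 , λ _ _ _ _ →
      ℚ.≤-trans (ℚ.≤-reflexive (∣p-p∣≡0 q)) (ℚ.<⇒≤ ε>0)

    +-cauchy : ∀ x y → IsCauchySeq (λ n → seq x n ℚ.+ seq y n)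
    +-cauchy x y ε ε>0 with cauchy x (½ ℚ.* ε) (half-pos ε>0) | cauchy y (½ ℚ.* ε) (half-pos ε>0)
    ... | M , p | N , q = M ⊔ N , λ m n m≥ n≥ → ≤-halves ε
      (add-close (seq x m) (seq x n) (seq y m) (seq y n)
        (p m n (⊔₁ M N m≥) (⊔₁ M N n≥)) (q m n (⊔₂ M N m≥) (⊔₂ M N n≥)))

    neg-cauchy : ∀ x → IsCauchySeq (λ n → ℚ.- seq x n)
    neg-cauchy x ε ε>0 =
      let N , p = cauchy x ε ε>0 in N , λ m n m≥ n≥ →
        ≡.subst (ℚ._≤ ε) (neg-close (seq x m) (seq x n)) (p m n m≥ n≥)

    *-cauchy : ∀ x y → IsCauchySeq (λ n → seq x n ℚ.* seq y n)
    *-cauchy x y ε ε>0 =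
      let A , A>0 , K , x≤A = bounded x
          B , B>0 , L , y≤B = bounded y
          δ , δ>0 , Aδ = scale A>0 ε>0
          η , η>0 , Bη = scale B>0 ε>0
          M , p = cauchy x η η>0
          N , q = cauchy y δ δ>0
      in (K ⊔ L) ⊔ (M ⊔ N) , λ m n m≥ n≥ →
      mul-close-ε (seq x m) (seq x n) (seq y m) (seq y n) ε Aδ Bη
        (x≤A m (⊔₁ K L (⊔₁ (K ⊔ L) (M ⊔ N) m≥)))
        (y≤B n (⊔₂ K L (⊔₁ (K ⊔ L) (M ⊔ N) n≥)))
        (p m n (⊔₁ M N (⊔₂ (K ⊔ L) (M ⊔ N) m≥)) (⊔₁ M N (⊔₂ (K ⊔ L) (M ⊔ N) n≥)))
        (q m n (⊔₂ M N (⊔₂ (K ⊔ L) (M ⊔ N) m≥)) (⊔₂ M N (⊔₂ (K ⊔ L) (M ⊔ N) n≥)))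

fromℚ : ℚ → ℝ
fromℚ q = mkℝ (λ _ → q) (const-cauchy q)

0ℝ 1ℝ : ℝ
0ℝ = fromℚ 0ℚ
1ℝ = fromℚ 1ℚ

infixl 6 _+ℝ_
infixl 7 _*ℝ_
infix  8 -ℝ_

_+ℝ_ : ℝ → ℝ → ℝ
x +ℝ y = mkℝ (λ n → seq x n ℚ.+ seq y n) (+-cauchy x y)

-ℝ_ : ℝ → ℝ
-ℝ x = mkℝ (λ n → ℚ.- seq x n) (neg-cauchy x)

_*ℝ_ : ℝ → ℝ → ℝ
x *ℝ y = mkℝ (λ n → seq x n ℚ.* seq y n) (*-cauchy x y)

private
  abstract
    pointwise : ∀ {x y} → (∀ n → seq x n ≡ seq y n) → x ≃ℝ y
    pointwise {x} {y} eq ε ε>0 = 0 , λ n _ → ≡.subst (λ q → ℚ.∣ seq x n ℚ.- q ∣ ℚ.≤ ε) (eq n)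
      (ℚ.≤-trans (ℚ.≤-reflexive (∣p-p∣≡0 (seq x n))) (ℚ.<⇒≤ ε>0))

    ≃-sym : ∀ {x y} → x ≃ℝ y → y ≃ℝ x
    ≃-sym {x} {y} p ε ε>0 with p ε ε>0
    ... | N , c = N , λ n n≥ → ≡.subst (ℚ._≤ ε) (∣p-q∣≡∣q-p∣ (seq x n) (seq y n)) (c n n≥)

    ≃-trans : ∀ {x y z} → x ≃ℝ y → y ≃ℝ z → x ≃ℝ z
    ≃-trans {x} {y} {z} p q ε ε>0 with p (½ ℚ.* ε) (half-pos ε>0) | q (½ ℚ.* ε) (half-pos ε>0)
    ... | M , c | N , d = M ⊔ N , λ n n≥ → ≤-halves ε
      (trans-close (seq x n) (seq y n) (seq z n) (c n (⊔₁ M N n≥)) (d n (⊔₂ M N n≥)))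

    +ℝ-cong : ∀ {x x′ y y′} → x ≃ℝ x′ → y ≃ℝ y′ → x +ℝ y ≃ℝ x′ +ℝ y′
    +ℝ-cong {x} {x′} {y} {y′} p q ε ε>0 with p (½ ℚ.* ε) (half-pos ε>0) | q (½ ℚ.* ε) (half-pos ε>0)
    ... | M , c | N , d = M ⊔ N , λ n n≥ → ≤-halves ε
      (add-close (seq x n) (seq x′ n) (seq y n) (seq y′ n) (c n (⊔₁ M N n≥)) (d n (⊔₂ M N n≥)))

    -ℝ-cong : ∀ {x y} → x ≃ℝ y → -ℝ x ≃ℝ -ℝ y
    -ℝ-cong {x} {y} p ε ε>0 with p ε ε>0
    ... | N , c = N , λ n n≥ → ≡.subst (ℚ._≤ ε)
      (neg-close (seq x n) (seq y n)) (c n n≥)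

    *ℝ-cong : ∀ {x x′ y y′} → x ≃ℝ x′ → y ≃ℝ y′ → x *ℝ y ≃ℝ x′ *ℝ y′
    *ℝ-cong {x} {x′} {y} {y′} p q ε ε>0 =
      let A , A>0 , K , x≤A = bounded x
          B , B>0 , L , y≤B = bounded y′
          δ , δ>0 , Aδ = scale A>0 ε>0
          η , η>0 , Bη = scale B>0 ε>0
          M , c = p η η>0
          N , d = q δ δ>0
      in (K ⊔ L) ⊔ (M ⊔ N) , λ n n≥ →
      mul-close-ε (seq x n) (seq x′ n) (seq y n) (seq y′ n) ε Aδ Bη
        (x≤A n (⊔₁ K L (⊔₁ (K ⊔ L) (M ⊔ N) n≥)))
        (y≤B n (⊔₂ K L (⊔₁ (K ⊔ L) (M ⊔ N) n≥)))
        (c n (⊔₁ M N (⊔₂ (K ⊔ L) (M ⊔ N) n≥)))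
        (d n (⊔₂ M N (⊔₂ (K ⊔ L) (M ⊔ N) n≥)))

ℝ-commutativeRing : CommutativeRing 0ℓ 0ℓ
ℝ-commutativeRing = record
  { Carrier = ℝ ; _≈_ = _≃ℝ_ ; _+_ = _+ℝ_ ; _*_ = _*ℝ_ ; -_ = -ℝ_ ; 0# = 0ℝ ; 1# = 1ℝ
  ; isCommutativeRing = record
    { isRing = record
      { +-isAbelianGroup = record
        { isGroup = record
          { isMonoid = record
            { isSemigroup = record
              { isMagma = record
                { isEquivalence = record
                  { refl  = λ {x} → pointwise {x} {x} (λ _ → refl)
                  ; sym   = λ {x} {y} → ≃-sym {x} {y}
                  ; trans = λ {x} {y} {z} → ≃-trans {x} {y} {z} }
                ; ∙-cong = λ {x} {x′} {y} {y′} → +ℝ-cong {x} {x′} {y} {y′} }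
              ; assoc = λ x y z → pointwise {(x +ℝ y) +ℝ z} {x +ℝ (y +ℝ z)}
                  (λ n → ℚ.+-assoc (seq x n) (seq y n) (seq z n)) }
            ; identity = (λ x → pointwise {0ℝ +ℝ x} {x} (λ n → ℚ.+-identityˡ (seq x n)))
                       , (λ x → pointwise {x +ℝ 0ℝ} {x} (λ n → ℚ.+-identityʳ (seq x n))) }
          ; inverse = (λ x → pointwise {(-ℝ x) +ℝ x} {0ℝ} (λ n → ℚ.+-inverseˡ (seq x n)))
                    , (λ x → pointwise {x +ℝ (-ℝ x)} {0ℝ} (λ n → ℚ.+-inverseʳ (seq x n)))
          ; ⁻¹-cong = λ {x} {y} → -ℝ-cong {x} {y} }
        ; comm = λ x y → pointwise {x +ℝ y} {y +ℝ x} (λ n → ℚ.+-comm (seq x n) (seq y n)) }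
      ; *-cong = λ {x} {x′} {y} {y′} → *ℝ-cong {x} {x′} {y} {y′}
      ; *-assoc = λ x y z → pointwise {(x *ℝ y) *ℝ z} {x *ℝ (y *ℝ z)}
          (λ n → ℚ.*-assoc (seq x n) (seq y n) (seq z n))
      ; *-identity = (λ x → pointwise {1ℝ *ℝ x} {x} (λ n → ℚ.*-identityˡ (seq x n)))
                   , (λ x → pointwise {x *ℝ 1ℝ} {x} (λ n → ℚ.*-identityʳ (seq x n)))
      ; distrib = (λ x y z → pointwise {x *ℝ (y +ℝ z)} {x *ℝ y +ℝ x *ℝ z}
                    (λ n → ℚ.*-distribˡ-+ (seq x n) (seq y n) (seq z n)))
                , (λ x y z → pointwise {(y +ℝ z) *ℝ x} {y *ℝ x +ℝ z *ℝ x}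
                    (λ n → ℚ.*-distribʳ-+ (seq x n) (seq y n) (seq z n))) }
    ; *-comm = λ x y → pointwise {x *ℝ y} {y *ℝ x} (λ n → ℚ.*-comm (seq x n) (seq y n)) } }

infix 5 _+i_

record ℂ : Set where
  constructor _+i_
  field
    re im : ℝ

open ℂ public

infix  4 _≃ℂ_
infixl 6 _+ℂ_
infixl 7 _*ℂ_
infix  8 -ℂ_

_≃ℂ_ : Rel ℂ 0ℓ
z ≃ℂ w = re z ≃ℝ re w × im z ≃ℝ im w

0ℂ 1ℂ : ℂ
0ℂ = 0ℝ +i 0ℝ
1ℂ = 1ℝ +i 0ℝ

_+ℂ_ _*ℂ_ : ℂ → ℂ → ℂ
(a +i b) +ℂ (c +i d) = (a +ℝ c) +i (b +ℝ d)
(a +i b) *ℂ (c +i d) = (a *ℝ c +ℝ -ℝ (b *ℝ d)) +i (a *ℝ d +ℝ b *ℝ c)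

-ℂ_ conj : ℂ → ℂ
-ℂ (a +i b) = (-ℝ a) +i (-ℝ b)
conj (a +i b) = a +i (-ℝ b)

∣_∣² : ℂ → ℝ
∣ a +i b ∣² = a *ℝ a +ℝ b *ℝ b

private
  module R = CommutativeRing ℝ-commutativeRing

  abstract
    pointwiseℂ : ∀ z w → (∀ n → seq (re z) n ≡ seq (re w) n) → (∀ n → seq (im z) n ≡ seq (im w) n) → z ≃ℂ w
    pointwiseℂ z w p q = pointwise {re z} {re w} p , pointwise {im z} {im w} q

    ≃ℂ-trans : ∀ {x y z} → x ≃ℂ y → y ≃ℂ z → x ≃ℂ z
    ≃ℂ-trans {x} {y} {z} (p , q) (p′ , q′) =
      ≃-trans {re x} {re y} {re z} p p′ , ≃-trans {im x} {im y} {im z} q q′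

    +ℂ-cong : ∀ {x x′ y y′} → x ≃ℂ x′ → y ≃ℂ y′ → x +ℂ y ≃ℂ x′ +ℂ y′
    +ℂ-cong {x} {x′} {y} {y′} (p , q) (p′ , q′) =
      +ℝ-cong {re x} {re x′} {re y} {re y′} p p′ , +ℝ-cong {im x} {im x′} {im y} {im y′} q q′

    *ℂ-cong : ∀ {x x′ y y′} → x ≃ℂ x′ → y ≃ℂ y′ → x *ℂ y ≃ℂ x′ *ℂ y′
    *ℂ-cong {a +i b} {a′ +i b′} {c +i d} {c′ +i d′} (p , q) (p′ , q′) =
      +ℝ-cong {a *ℝ c} {a′ *ℝ c′} { -ℝ (b *ℝ d)} { -ℝ (b′ *ℝ d′)}
        (*ℝ-cong {a} {a′} {c} {c′} p p′)
        (-ℝ-cong {b *ℝ d} {b′ *ℝ d′} (*ℝ-cong {b} {b′} {d} {d′} q q′)) ,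
      +ℝ-cong {a *ℝ d} {a′ *ℝ d′} {b *ℝ c} {b′ *ℝ c′}
        (*ℝ-cong {a} {a′} {d} {d′} p q′) (*ℝ-cong {b} {b′} {c} {c′} q p′)

    *ℂ-comm : ∀ x y → x *ℂ y ≃ℂ y *ℂ x
    *ℂ-comm x@(a +i b) y@(c +i d) = pointwiseℂ (x *ℂ y) (y *ℂ x)
      (λ n → solve 4 (λ a b c d → a :* c :+ :- (b :* d) := c :* a :+ :- (d :* b)) refl
               (seq a n) (seq b n) (seq c n) (seq d n))
      (λ n → solve 4 (λ a b c d → a :* d :+ b :* c := c :* b :+ d :* a) refl
               (seq a n) (seq b n) (seq c n) (seq d n))
      where open ℚS

    *ℂ-assoc : ∀ x y z → (x *ℂ y) *ℂ z ≃ℂ x *ℂ (y *ℂ z)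
    *ℂ-assoc x@(a +i b) y@(c +i d) z@(e +i f) = pointwiseℂ ((x *ℂ y) *ℂ z) (x *ℂ (y *ℂ z))
      (λ n → solve 6 (λ a b c d e f →
                 (a :* c :+ :- (b :* d)) :* e :+ :- ((a :* d :+ b :* c) :* f)
              := a :* (c :* e :+ :- (d :* f)) :+ :- (b :* (c :* f :+ d :* e))) refl
               (seq a n) (seq b n) (seq c n) (seq d n) (seq e n) (seq f n))
      (λ n → solve 6 (λ a b c d e f →
                 (a :* c :+ :- (b :* d)) :* f :+ (a :* d :+ b :* c) :* e
              := a :* (c :* f :+ d :* e) :+ b :* (c :* e :+ :- (d :* f))) refl
               (seq a n) (seq b n) (seq c n) (seq d n) (seq e n) (seq f n))
      where open ℚS

    *ℂ-distribˡ : ∀ x y z → x *ℂ (y +ℂ z) ≃ℂ x *ℂ y +ℂ x *ℂ z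
    *ℂ-distribˡ x@(a +i b) y@(c +i d) z@(e +i f) = pointwiseℂ (x *ℂ (y +ℂ z)) (x *ℂ y +ℂ x *ℂ z)
      (λ n → solve 6 (λ a b c d e f →
                 a :* (c :+ e) :+ :- (b :* (d :+ f))
              := (a :* c :+ :- (b :* d)) :+ (a :* e :+ :- (b :* f))) refl
               (seq a n) (seq b n) (seq c n) (seq d n) (seq e n) (seq f n))
      (λ n → solve 6 (λ a b c d e f →
                 a :* (d :+ f) :+ b :* (c :+ e)
              := (a :* d :+ b :* c) :+ (a :* f :+ b :* e)) refl
               (seq a n) (seq b n) (seq c n) (seq d n) (seq e n) (seq f n))
      where open ℚS

    *ℂ-identityˡ : ∀ x → 1ℂ *ℂ x ≃ℂ x
    *ℂ-identityˡ x@(a +i b) = pointwiseℂ (1ℂ *ℂ x) x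
      (λ n → ≡.trans (cong₂ (λ p q → p ℚ.+ ℚ.- q) (ℚ.*-identityˡ (seq a n)) (ℚ.*-zeroˡ (seq b n)))
                     (ℚ.+-identityʳ (seq a n)))
      (λ n → ≡.trans (cong₂ ℚ._+_ (ℚ.*-identityˡ (seq b n)) (ℚ.*-zeroˡ (seq a n)))
                     (ℚ.+-identityʳ (seq b n)))

ℂ-commutativeRing : CommutativeRing 0ℓ 0ℓ
ℂ-commutativeRing = record
  { Carrier = ℂ ; _≈_ = _≃ℂ_ ; _+_ = _+ℂ_ ; _*_ = _*ℂ_ ; -_ = -ℂ_ ; 0# = 0ℂ ; 1# = 1ℂ
  ; isCommutativeRing = record
    { isRing = record
      { +-isAbelianGroup = record
        { isGroup = record
          { isMonoid = record
            { isSemigroup = record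
              { isMagma = record
                { isEquivalence = record
                  { refl  = λ {z} → R.refl {re z} , R.refl {im z}
                  ; sym   = λ {z} {w} (p , q) → ≃-sym {re z} {re w} p , ≃-sym {im z} {im w} q
                  ; trans = λ {x} {y} {z} → ≃ℂ-trans {x} {y} {z} }
                ; ∙-cong = λ {x} {x′} {y} {y′} → +ℂ-cong {x} {x′} {y} {y′} }
              ; assoc = λ (a +i b) (c +i d) (e +i f) → R.+-assoc a c e , R.+-assoc b d f }
            ; identity = (λ (a +i b) → R.+-identityˡ a , R.+-identityˡ b)
                       , (λ (a +i b) → R.+-identityʳ a , R.+-identityʳ b) }
          ; inverse = (λ (a +i b) → R.-‿inverseˡ a , R.-‿inverseˡ b)
                    , (λ (a +i b) → R.-‿inverseʳ a , R.-‿inverseʳ b)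
          ; ⁻¹-cong = λ {z} {w} (p , q) → -ℝ-cong {re z} {re w} p , -ℝ-cong {im z} {im w} q }
        ; comm = λ (a +i b) (c +i d) → R.+-comm a c , R.+-comm b d }
      ; *-cong = λ {x} {x′} {y} {y′} → *ℂ-cong {x} {x′} {y} {y′}
      ; *-assoc = *ℂ-assoc
      ; *-identity = *ℂ-identityˡ
                   , λ x → ≃ℂ-trans {x *ℂ 1ℂ} {1ℂ *ℂ x} {x} (*ℂ-comm x 1ℂ) (*ℂ-identityˡ x)
      ; distrib = *ℂ-distribˡ
                , λ x y z → ≃ℂ-trans {(y +ℂ z) *ℂ x} {x *ℂ (y +ℂ z)} {y *ℂ x +ℂ z *ℂ x} (*ℂ-comm (y +ℂ z) x)
                    (≃ℂ-trans {x *ℂ (y +ℂ z)} {x *ℂ y +ℂ x *ℂ z} {y *ℂ x +ℂ z *ℂ x} (*ℂ-distribˡ x y z)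
                      (+ℂ-cong {x *ℂ y} {y *ℂ x} {x *ℂ z} {z *ℂ x} (*ℂ-comm x y) (*ℂ-comm x z))) }
    ; *-comm = *ℂ-comm } }

record UnitalC*Algebra : Set₁ where
  infix  4 _≈_
  infixl 6 _+_ _-_
  infixl 7 _*_
  infixr 7 _•_
  infix  8 -_
  infix  9 _⋆
  field
    Carrier : Set
    _≈_     : Rel Carrier 0ℓ
    _+_ _*_ : Carrier → Carrier → Carrier
    -_      : Carrier → Carrier
    0# 1#   : Carrier
    isRing  : IsRing _≈_ _+_ _*_ -_ 0# 1#
    -- The zero algebra is excluded: over it every square matrix would be a
    -- quantum permutation matrix.
    1≉0     : ¬ (1# ≈ 0#)

    _•_          : ℂ → Carrier → Carrier
    isLeftModule : IsLeftModule (CommutativeRing.ring ℂ-commutativeRing) _≈_ _+_ 0# -_ _•_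
    •-*-assocˡ   : ∀ z a b → (z • a) * b ≈ z • (a * b)
    •-*-assocʳ   : ∀ z a b → a * (z • b) ≈ z • (a * b)

    _⋆           : Carrier → Carrier
    ⋆-cong       : ∀ {a b} → a ≈ b → a ⋆ ≈ b ⋆
    ⋆-involutive : ∀ a → (a ⋆) ⋆ ≈ a
    ⋆-+          : ∀ a b → (a + b) ⋆ ≈ a ⋆ + b ⋆
    ⋆-*          : ∀ a b → (a * b) ⋆ ≈ b ⋆ * a ⋆
    ⋆-•          : ∀ z a → (z • a) ⋆ ≈ conj z • a ⋆

  _-_ : Carrier → Carrier → Carrier
  a - b = a + (- b)

  field
    ‖_‖           : Carrier → ℝ
    ‖‖-cong       : ∀ {a b} → a ≈ b → ‖ a ‖ ≃ℝ ‖ b ‖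
    ‖‖-nonNeg     : ∀ a → 0ℝ ≤ℝ ‖ a ‖
    ‖‖-definite   : ∀ a → ‖ a ‖ ≃ℝ 0ℝ → a ≈ 0#
    ‖‖-triangle   : ∀ a b → ‖ a + b ‖ ≤ℝ ‖ a ‖ +ℝ ‖ b ‖
    -- ‖ z a ‖ = |z| ‖ a ‖, squared to avoid square roots.
    ‖‖-homogen    : ∀ z a → ‖ z • a ‖ *ℝ ‖ z • a ‖ ≃ℝ ∣ z ∣² *ℝ (‖ a ‖ *ℝ ‖ a ‖)
    ‖‖-submult    : ∀ a b → ‖ a * b ‖ ≤ℝ ‖ a ‖ *ℝ ‖ b ‖
    C*-identity   : ∀ a → ‖ a ⋆ * a ‖ ≃ℝ ‖ a ‖ *ℝ ‖ a ‖

  IsCauchy : (ℕ → Carrier) → Set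
  IsCauchy a = ∀ ε → 0ℚ ℚ.< ε →
    ∃[ N ] ∀ m n → N ℕ.≤ m → N ℕ.≤ n → ‖ a m - a n ‖ ≤ℝ fromℚ ε

  ConvergesTo : (ℕ → Carrier) → Carrier → Set
  ConvergesTo a b = ∀ ε → 0ℚ ℚ.< ε →
    ∃[ N ] ∀ n → N ℕ.≤ n → ‖ a n - b ‖ ≤ℝ fromℚ ε

  field
    complete : ∀ a → IsCauchy a → ∃[ b ] ConvergesTo a b

  ring : Ring 0ℓ 0ℓ
  ring = record { isRing = isRing }

  open CMSum (Ring.+-commutativeMonoid ring) public using (sum)

  Matrix : ℕ → Set
  Matrix n = Fin n → Fin n → Carrier

  infixl 7 _⊗_

  _⊗_ : ∀ {n} → Matrix n → Matrix n → Matrix n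
  (M ⊗ N) i j = sum (λ k → M i k * N k j)

  record IsQuantumPermutationMatrix {n : ℕ} (u : Matrix n) : Set where
    field
      selfAdjoint : ∀ i j → u i j ≈ (u i j) ⋆
      idempotent  : ∀ i j → u i j ≈ u i j * u i j
      rowSum      : ∀ i → sum (λ k → u i k) ≈ 1#
      colSum      : ∀ i → sum (λ k → u k i) ≈ 1#

HasSize : Setoid 0ℓ 0ℓ → ℕ → Set
HasSize S n = Inverse (≡.setoid (Fin n)) S

Sub : (S : Setoid 0ℓ 0ℓ) → (Setoid.Carrier S → Set) → Setoid 0ℓ 0ℓ
Sub S P = On.setoid {B = Σ (Setoid.Carrier S) P} S proj₁

record Graph : Set₁ where
  infix 4 _~_
  field
    vertices : Setoid 0ℓ 0ℓ

  open Setoid vertices public using (_≈_) renaming (Carrier to Vertex)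

  field
    _~_      : Rel Vertex 0ℓ
    ~-resp   : _~_ Respects₂ _≈_
    ~-sym    : Symmetric _~_
    ~-irrefl : Irreflexive _≈_ _~_

complement : Graph → Graph
complement G = record
  { vertices = vertices
  ; _~_      = λ x y → ¬ (x ≈ y) × ¬ (x ~ y)
  ; ~-resp   = (λ y≈y′ (x≉y , x≁y) → (λ x≈y′ → x≉y (S.trans x≈y′ (S.sym y≈y′)))
                                    , (λ x~y′ → x≁y (proj₁ ~-resp (S.sym y≈y′) x~y′)))
             , (λ x≈x′ (x≉y , x≁y) → (λ x′≈y → x≉y (S.trans x≈x′ x′≈y))
                                    , (λ x′~y → x≁y (proj₂ ~-resp (S.sym x≈x′) x′~y)))
  ; ~-sym    = λ (x≉y , x≁y) → (λ y≈x → x≉y (S.sym y≈x)) , (λ y~x → x≁y (~-sym y~x))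
  ; ~-irrefl = λ x≈y (x≉y , _) → x≉y x≈y
  }
  where
  open Graph G
  module S = Setoid vertices

record IsStronglyRegularWith (G : Graph) (n k l m : ℕ) : Set where
  open Graph G
  field
    order       : HasSize vertices n
    regular     : ∀ x → HasSize (Sub vertices (λ z → x ~ z)) k
    adjacent    : ∀ x y → x ~ y → HasSize (Sub vertices (λ z → x ~ z × y ~ z)) l
    nonadjacent : ∀ x y → ¬ (x ≈ y) → ¬ (x ~ y) → HasSize (Sub vertices (λ z → x ~ z × y ~ z)) m

IsStronglyRegular : Graph → Set
IsStronglyRegular G = ∃[ n ] ∃[ k ] ∃[ l ] ∃[ m ] IsStronglyRegularWith G n k l m

record Isomorphic (G H : Graph) : Set where
  private
    module G = Graph G
    module H = Graph H
  field
    bijection : Inverse G.vertices H.vertices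
  open Inverse bijection
  field
    preserves : ∀ x y → (x G.~ y) ⇔ (to x H.~ to y)

IsAdjacencyMatrix : (𝒜 : UnitalC*Algebra) (G : Graph) {n : ℕ} → HasSize (Graph.vertices G) n →
                    UnitalC*Algebra.Matrix 𝒜 n → Set
IsAdjacencyMatrix 𝒜 G v A = ∀ i j →
  (to i ~ to j → A i j ≈ 1#) × (¬ (to i ~ to j) → A i j ≈ 0#)
  where
  open UnitalC*Algebra 𝒜
  open Graph G using (_~_)
  open Inverse v using (to)

record QuantumIsomorphic (G H : Graph) : Set₁ where
  field
    {n}         : ℕ
    numberingG  : HasSize (Graph.vertices G) n
    numberingH  : HasSize (Graph.vertices H) n
    algebra     : UnitalC*Algebra
  open UnitalC*Algebra algebra
  field
    A-G A-H     : Matrix n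
    A-G-correct : IsAdjacencyMatrix algebra G numberingG A-G
    A-H-correct : IsAdjacencyMatrix algebra H numberingH A-H
    u           : Matrix n
    u-isQPM     : IsQuantumPermutationMatrix u
    intertwines : ∀ i j → (A-G ⊗ u) i j ≈ (u ⊗ A-H) i j

record IndependentSet (G : Graph) (k : ℕ) : Set where
  open Graph G
  field
    member      : Vertex → Bool
    member-resp : ∀ {x y} → x ≈ y → member x ≡ member y
    size        : HasSize (Sub vertices (λ x → T (member x))) k
    independent : ∀ x y → T (member x) → T (member y) → ¬ (x ~ y)

open IndependentSet public

open CMSum ℤ.+-0-commutativeMonoid using () renaming (sum to sumℤ; sum-cong-≗ to sumℤ-cong)

ℤ⁸ : Set
ℤ⁸ = Vec ℤ 8

⟨_,_⟩ : ℤ⁸ → ℤ⁸ → ℤ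
⟨ x , y ⟩ = sumℤ (λ i → lookup x i ℤ.* lookup y i)

neg : ℤ⁸ → ℤ⁸
neg = Vec.map (λ z → ℤ.- z)

±e : Sign → Fin 8 → ℤ⁸
±e s i = replicate 8 0ℤ Vec.[ i ]≔ (s ◃ 1)

data IsRoot : ℤ⁸ → Set where
  pair : ∀ {i j} → i Fin.< j → ∀ s t → IsRoot (zipWith ℤ._+_ (±e s i) (±e t j))
  full : ∀ {x} → All (λ z → z ≡ 1ℤ ⊎ z ≡ -1ℤ) x → Vec.foldr _ ℤ._*_ 1ℤ x ≡ 1ℤ → IsRoot x

Root : Set
Root = Σ ℤ⁸ IsRoot

private
  sumℤ-neg : ∀ {n} (f : Fin n → ℤ) → sumℤ (λ i → ℤ.- f i) ≡ ℤ.- sumℤ f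
  sumℤ-neg {zero}  f = refl
  sumℤ-neg {suc n} f = ≡.trans (cong (ℤ._+_ (ℤ.- f zero)) (sumℤ-neg (f ∘ suc)))
    (≡.sym (ℤ.neg-distrib-+ (f zero) (sumℤ (f ∘ suc))))

  ⟨⟩-comm : ∀ x y → ⟨ x , y ⟩ ≡ ⟨ y , x ⟩
  ⟨⟩-comm x y = sumℤ-cong (λ i → ℤ.*-comm (lookup x i) (lookup y i))

  ⟨⟩-negˡ : ∀ x y → ⟨ neg x , y ⟩ ≡ ℤ.- ⟨ x , y ⟩
  ⟨⟩-negˡ x y = ≡.trans
    (sumℤ-cong (λ i → ≡.trans (cong (ℤ._* lookup y i) (Vec.lookup-map i (λ z → ℤ.- z) x))
                              (≡.sym (ℤ.neg-distribˡ-* (lookup x i) (lookup y i)))))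
    (sumℤ-neg (λ i → lookup x i ℤ.* lookup y i))

  neg-involutive : ∀ {n} (x : Vec ℤ n) → Vec.map (λ z → ℤ.- z) (Vec.map (λ z → ℤ.- z) x) ≡ x
  neg-involutive []      = refl
  neg-involutive (z ∷ x) = cong₂ _∷_ (ℤ.neg-involutive z) (neg-involutive x)

  norm² : Sign → Sign → Fin 8 → Fin 8 → ℤ
  norm² s t i j = let x = zipWith ℤ._+_ (±e s i) (±e t j) in ⟨ x , x ⟩

  norm²≢0? : ∀ s t → Dec (∀ i j → i ≢ j → norm² s t i j ≢ 0ℤ)
  norm²≢0? s t = Fin.all? λ i → Fin.all? λ j → ¬? (i Fin.≟ j) →-dec ¬? (norm² s t i j ℤ.≟ 0ℤ)

  pair-norm : ∀ s t i j → i ≢ j → norm² s t i j ≢ 0ℤ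
  pair-norm Sign.+ Sign.+ = from-yes (norm²≢0? Sign.+ Sign.+)
  pair-norm Sign.+ Sign.- = from-yes (norm²≢0? Sign.+ Sign.-)
  pair-norm Sign.- Sign.+ = from-yes (norm²≢0? Sign.- Sign.+)
  pair-norm Sign.- Sign.- = from-yes (norm²≢0? Sign.- Sign.-)

  full-norm : ∀ {n} {x : Vec ℤ n} → All (λ z → z ≡ 1ℤ ⊎ z ≡ -1ℤ) x →
              sumℤ (λ i → lookup x i ℤ.* lookup x i) ≡ ℤ.+ n
  full-norm []                = refl
  full-norm (inj₁ refl ∷ ps)  = cong (ℤ._+_ 1ℤ) (full-norm ps)
  full-norm (inj₂ refl ∷ ps)  = cong (ℤ._+_ 1ℤ) (full-norm ps)

  root-norm : ∀ {x} → IsRoot x → ⟨ x , x ⟩ ≢ 0ℤ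
  root-norm (pair {i} {j} i<j s t) = pair-norm s t i j (Fin.<⇒≢ i<j)
  root-norm (full ps _) eq = case ≡.trans (≡.sym (full-norm ps)) eq of λ ()

  swap± : ∀ {x y} → x ≡ y ⊎ x ≡ neg y → y ≡ x ⊎ y ≡ neg x
  swap±         (inj₁ refl) = inj₁ refl
  swap± {y = y} (inj₂ refl) = inj₂ (≡.sym (neg-involutive y))

  trans± : ∀ {x y z} → x ≡ y ⊎ x ≡ neg y → y ≡ z ⊎ y ≡ neg z → x ≡ z ⊎ x ≡ neg z
  trans±         (inj₁ refl) q           = q
  trans±         (inj₂ refl) (inj₁ refl) = inj₂ refl
  trans± {z = z} (inj₂ refl) (inj₂ refl) = inj₁ (neg-involutive z)

  ⊥-respˡ : ∀ {x x′} y → x ≡ x′ ⊎ x ≡ neg x′ → ⟨ x , y ⟩ ≡ 0ℤ → ⟨ x′ , y ⟩ ≡ 0ℤ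
  ⊥-respˡ      y (inj₁ refl) p = p
  ⊥-respˡ {x′ = x′} y (inj₂ refl) p = ℤ.neg-injective (≡.trans (≡.sym (⟨⟩-negˡ x′ y)) p)

G-E₈ : Graph
G-E₈ = record
  { vertices = record
    { Carrier = Root
    ; _≈_ = λ (x , _) (y , _) → x ≡ y ⊎ x ≡ neg y
    ; isEquivalence = record { refl = inj₁ refl ; sym = swap± ; trans = trans± } }
  ; _~_ = λ (x , _) (y , _) → ⟨ x , y ⟩ ≡ 0ℤ
  ; ~-resp = (λ {(x , _)} {(y , _)} {(y′ , _)} y≈y′ p →
                ≡.trans (⟨⟩-comm x y′) (⊥-respˡ x y≈y′ (≡.trans (⟨⟩-comm y x) p)))
           , (λ {(y , _)} x≈x′ p → ⊥-respˡ y x≈x′ p)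
  ; ~-sym = λ {(x , _)} {(y , _)} p → ≡.trans (⟨⟩-comm y x) p
  ; ~-irrefl = λ {(x , _)} {(y , r)} x≈y p → root-norm r (⊥-respˡ y x≈y p)
  }

open CMSum ℙ.+-0-commutativeMonoid using () renaming (sum to sumℙ; sum-permute to sumℙ-permute; sum-cong-≗ to sumℙ-cong; ∑-distrib-+ to sumℙ-+)

-- Parity serves as the field 𝔽₂.
𝔽₂⁸ : Set
𝔽₂⁸ = Vec Parity 8

infixl 6 _⊕_

_⊕_ : 𝔽₂⁸ → 𝔽₂⁸ → 𝔽₂⁸
_⊕_ = zipWith ℙ._+_

𝟏 : 𝔽₂⁸
𝟏 = replicate 8 1ℙ

weight : 𝔽₂⁸ → ℕ
weight = count (ℙ._≟ 1ℙ)

SumZero : 𝔽₂⁸ → Set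
SumZero x = sumℙ (lookup x) ≡ 0ℙ

Point : Set
Point = Σ 𝔽₂⁸ SumZero

infix 4 _≈ᶠ_ _~ᶠ_

_≈ᶠ_ _~ᶠ_ : Rel 𝔽₂⁸ 0ℓ
x ≈ᶠ y = x ≡ y ⊎ x ≡ 𝟏 ⊕ y
x ~ᶠ y = weight (x ⊕ y) ≡ 2 ⊎ weight (x ⊕ y ⊕ 𝟏) ≡ 2

private
  allVec? : ∀ {n} {P : Vec Parity n → Set} → (∀ x → Dec (P x)) → Dec (∀ x → P x)
  allVec? {zero}  P? = map′ (λ { p [] → p }) (λ f → f []) (P? [])
  allVec? {suc n} P? = map′ (λ { (p , q) (0ℙ ∷ x) → p x ; (p , q) (1ℙ ∷ x) → q x })
                            (λ f → (λ x → f (0ℙ ∷ x)) , (λ x → f (1ℙ ∷ x)))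
                            (allVec? (λ x → P? (0ℙ ∷ x)) ×-dec allVec? (λ x → P? (1ℙ ∷ x)))

  ⊕-comm : ∀ x y → x ⊕ y ≡ y ⊕ x
  ⊕-comm = Vec.zipWith-comm ℙ.+-comm

  ⊕-assoc : ∀ x y z → x ⊕ y ⊕ z ≡ x ⊕ (y ⊕ z)
  ⊕-assoc = Vec.zipWith-assoc ℙ.+-assoc

  _≟ᵛ_ : ∀ {n} (x y : Vec Parity n) → Dec (x ≡ y)
  _≟ᵛ_ = Vec.≡-dec ℙ._≟_

  𝟏⊕𝟏⊕ : ∀ x → 𝟏 ⊕ (𝟏 ⊕ x) ≡ x
  𝟏⊕𝟏⊕ = from-yes (allVec? λ x → (𝟏 ⊕ (𝟏 ⊕ x)) ≟ᵛ x)

  ≈ᶠ-sym : ∀ {x y} → x ≈ᶠ y → y ≈ᶠ x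
  ≈ᶠ-sym         (inj₁ refl) = inj₁ refl
  ≈ᶠ-sym {y = y} (inj₂ refl) = inj₂ (≡.sym (𝟏⊕𝟏⊕ y))

  ≈ᶠ-trans : ∀ {x y z} → x ≈ᶠ y → y ≈ᶠ z → x ≈ᶠ z
  ≈ᶠ-trans         (inj₁ refl) q           = q
  ≈ᶠ-trans         (inj₂ refl) (inj₁ refl) = inj₂ refl
  ≈ᶠ-trans {z = z} (inj₂ refl) (inj₂ refl) = inj₁ (𝟏⊕𝟏⊕ z)

  ~ᶠ-sym : ∀ {x y} → x ~ᶠ y → y ~ᶠ x
  ~ᶠ-sym {x} {y} = ≡.subst (λ z → weight z ≡ 2 ⊎ weight (z ⊕ 𝟏) ≡ 2) (⊕-comm x y)

  ~ᶠ-respˡ : ∀ {x x′} y → x ≈ᶠ x′ → x ~ᶠ y → x′ ~ᶠ y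
  ~ᶠ-respˡ           y (inj₁ refl) p = p
  ~ᶠ-respˡ {x′ = x′} y (inj₂ refl) (inj₁ p) = inj₂ (≡.trans (cong weight
    (≡.trans (⊕-comm (x′ ⊕ y) 𝟏) (≡.sym (⊕-assoc 𝟏 x′ y)))) p)
  ~ᶠ-respˡ {x′ = x′} y (inj₂ refl) (inj₂ p) = inj₁ (≡.trans (cong weight (≡.sym
    (≡.trans (⊕-comm (𝟏 ⊕ x′ ⊕ y) 𝟏) (≡.trans (cong (𝟏 ⊕_) (⊕-assoc 𝟏 x′ y)) (𝟏⊕𝟏⊕ (x′ ⊕ y)))))) p)

  ~ᶠ-respʳ : ∀ x {y y′} → y ≈ᶠ y′ → x ~ᶠ y → x ~ᶠ y′
  ~ᶠ-respʳ x {y} {y′} y≈y′ p = ~ᶠ-sym {y′} {x} (~ᶠ-respˡ x y≈y′ (~ᶠ-sym {x} {y} p))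

  _~ᶠ?_ : ∀ x y → Dec (x ~ᶠ y)
  x ~ᶠ? y = (weight (x ⊕ y) ℕ.≟ 2) ⊎-dec (weight (x ⊕ y ⊕ 𝟏) ℕ.≟ 2)

  ≁ᶠ-self : ∀ x → ¬ (x ~ᶠ x)
  ≁ᶠ-self = from-yes (allVec? λ x → ¬? (x ~ᶠ? x))

foldedHalved8Cube : Graph
foldedHalved8Cube = record
  { vertices = record
    { Carrier = Point
    ; _≈_ = λ (x , _) (y , _) → x ≈ᶠ y
    ; isEquivalence = record { refl = inj₁ refl ; sym = ≈ᶠ-sym ; trans = ≈ᶠ-trans } }
  ; _~_ = λ (x , _) (y , _) → x ~ᶠ y
  ; ~-resp = (λ {(x , _)} → ~ᶠ-respʳ x) , (λ {(y , _)} → ~ᶠ-respˡ y)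
  ; ~-sym = λ {(x , _)} {(y , _)} → ~ᶠ-sym {x} {y}
  ; ~-irrefl = λ {(x , _)} {(y , _)} x≈y p → ≁ᶠ-self y (~ᶠ-respˡ y x≈y p)
  }

open CMSum ℕ.+-0-commutativeMonoid using () renaming (sum to sumℕ)

inversions : ∀ {n} → Permutation′ n → ℕ
inversions π = sumℕ λ i → sumℕ λ j →
  if does (i Fin.<? j) ∧ does ((π ⟨$⟩ʳ j) Fin.<? (π ⟨$⟩ʳ i)) then 1 else 0

IsEven : ∀ {n} → Permutation′ n → Set
IsEven π = 2 ∣ inversions π

permute : Permutation′ 8 → 𝔽₂⁸ → 𝔽₂⁸
permute π x = tabulate (λ i → lookup x (π ⟨$⟩ˡ i))

private
  permute-sumZero : ∀ π x → SumZero x → SumZero (permute π x)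
  permute-sumZero π x p = ≡.trans (sumℙ-cong (Vec.lookup∘tabulate (λ i → lookup x (π ⟨$⟩ˡ i))))
    (≡.trans (≡.sym (sumℙ-permute (lookup x) (flip π))) p)

  ⊕-sumZero : ∀ x y → SumZero x → SumZero y → SumZero (x ⊕ y)
  ⊕-sumZero x y p q = ≡.trans (sumℙ-cong (λ i → Vec.lookup-zipWith ℙ._+_ i x y))
    (≡.trans (sumℙ-+ (lookup x) (lookup y)) (cong₂ ℙ._+_ p q))

-- Every element of the group generated by the translations by even-weight
-- vectors and the even coordinate permutations has the form x ↦ t + π x.
act : Permutation′ 8 → Point → Point → Point
act π (t , t-even) (x , x-even) =
  t ⊕ permute π x , ⊕-sumZero t (permute π x) t-even (permute-sumZero π x x-even)

Coclique₈ : Set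
Coclique₈ = IndependentSet foldedHalved8Cube 8

InOrbitOf : Coclique₈ → Coclique₈ → Set
InOrbitOf C S = Σ[ π ∈ Permutation′ 8 ] IsEven π × Σ[ t ∈ Point ]
  (∀ x → member S (act π t x) ≡ member C x)

Common : Coclique₈ → Coclique₈ → Setoid 0ℓ 0ℓ
Common S S′ = Sub (Graph.vertices foldedHalved8Cube) (λ x → T (member S x) × T (member S′ x))

private
  common-map : ∀ {S S′ R R′ : Coclique₈} →
    (∀ {x} → T (member S x) × T (member S′ x) → T (member R x) × T (member R′ x)) →
    (∀ {x} → T (member R x) × T (member R′ x) → T (member S x) × T (member S′ x)) →
    Inverse (Common S S′) (Common R R′)
  common-map f g = record
    { to = λ (x , p) → x , f p
    ; from = λ (x , p) → x , g p
    ; to-cong = λ p → p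
    ; from-cong = λ p → p
    ; inverse = (λ p → p) , (λ p → p) }

  respˡ : ∀ {S S′ : Coclique₈} → (∀ x → member S x ≡ member S′ x) → ∀ {x} → T (member S x) → T (member S′ x)
  respˡ eq {x} = ≡.subst T (eq x)

orbitGraph : Coclique₈ → Graph
orbitGraph C = record
  { vertices = record
    { Carrier = Σ Coclique₈ (InOrbitOf C)
    ; _≈_ = λ (S , _) (S′ , _) → ∀ x → member S x ≡ member S′ x
    ; isEquivalence = record
      { refl = λ _ → refl
      ; sym = λ p x → ≡.sym (p x)
      ; trans = λ p q x → ≡.trans (p x) (q x) } }
  ; _~_ = λ (S , _) (S′ , _) → HasSize (Common S S′) 2
  ; ~-resp = (λ {(R , _)} {(S , _)} {(S′ , _)} eq p → p ⟨∘⟩ common-map {R} {S} {R} {S′}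
                 (λ (a , b) → a , respˡ {S} {S′} eq b)
                 (λ (a , b) → a , respˡ {S′} {S} (λ x → ≡.sym (eq x)) b))
           , (λ {(R , _)} {(S , _)} {(S′ , _)} eq p → p ⟨∘⟩ common-map {S} {R} {S′} {R}
                 (λ (a , b) → respˡ {S} {S′} eq a , b)
                 (λ (a , b) → respˡ {S′} {S} (λ x → ≡.sym (eq x)) a , b))
  ; ~-sym = λ {(S , _)} {(S′ , _)} p → p ⟨∘⟩ common-map {S} {S′} {S′} {S}
                 (λ (a , b) → b , a) (λ (a , b) → b , a)
  ; ~-irrefl = λ {(S , _)} {(S′ , _)} eq p → irrefl S S′ eq p
  }
  where
  irrefl : ∀ S S′ → (∀ x → member S x ≡ member S′ x) → ¬ HasSize (Common S S′) 2
  irrefl S S′ eq p = case ↔⇒≡ (size S ⟨∘⟩ (drop ⟨∘⟩ inverse-sym p)) of λ ()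
    where
    drop : Inverse (Sub (Graph.vertices foldedHalved8Cube) (λ x → T (member S x))) (Common S S′)
    drop = record
      { to = λ (x , p) → x , p , respˡ {S} {S′} eq p
      ; from = λ (x , p , _) → x , p
      ; to-cong = λ p → p
      ; from-cong = λ p → p
      ; inverse = (λ p → p) , (λ p → p) }

-- The extended binary Hamming code [8,4,4], given by its parity checks (the
-- remaining check, 11111111, is the defining condition of Point).
inHammingCode : 𝔽₂⁸ → Bool
inHammingCode x = check (0ℙ ∷ 0ℙ ∷ 0ℙ ∷ 0ℙ ∷ 1ℙ ∷ 1ℙ ∷ 1ℙ ∷ 1ℙ ∷ [])
                ∧ check (0ℙ ∷ 0ℙ ∷ 1ℙ ∷ 1ℙ ∷ 0ℙ ∷ 0ℙ ∷ 1ℙ ∷ 1ℙ ∷ [])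
                ∧ check (0ℙ ∷ 1ℙ ∷ 0ℙ ∷ 1ℙ ∷ 0ℙ ∷ 1ℙ ∷ 0ℙ ∷ 1ℙ ∷ [])
  where
  check : 𝔽₂⁸ → Bool
  check r = does (sumℙ (λ i → lookup r i ℙ.* lookup x i) ℙ.≟ 0ℙ)

private
  word : Fin 8 → 𝔽₂⁸
  word 0F = 0ℙ ∷ 0ℙ ∷ 0ℙ ∷ 0ℙ ∷ 0ℙ ∷ 0ℙ ∷ 0ℙ ∷ 0ℙ ∷ []
  word 1F = 0ℙ ∷ 1ℙ ∷ 0ℙ ∷ 1ℙ ∷ 0ℙ ∷ 1ℙ ∷ 0ℙ ∷ 1ℙ ∷ []
  word 2F = 0ℙ ∷ 0ℙ ∷ 1ℙ ∷ 1ℙ ∷ 0ℙ ∷ 0ℙ ∷ 1ℙ ∷ 1ℙ ∷ []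
  word 3F = 0ℙ ∷ 1ℙ ∷ 1ℙ ∷ 0ℙ ∷ 0ℙ ∷ 1ℙ ∷ 1ℙ ∷ 0ℙ ∷ []
  word 4F = 0ℙ ∷ 0ℙ ∷ 0ℙ ∷ 0ℙ ∷ 1ℙ ∷ 1ℙ ∷ 1ℙ ∷ 1ℙ ∷ []
  word 5F = 0ℙ ∷ 1ℙ ∷ 0ℙ ∷ 1ℙ ∷ 1ℙ ∷ 0ℙ ∷ 1ℙ ∷ 0ℙ ∷ []
  word 6F = 0ℙ ∷ 0ℙ ∷ 1ℙ ∷ 1ℙ ∷ 1ℙ ∷ 1ℙ ∷ 0ℙ ∷ 0ℙ ∷ []
  word 7F = 0ℙ ∷ 1ℙ ∷ 1ℙ ∷ 0ℙ ∷ 1ℙ ∷ 0ℙ ∷ 0ℙ ∷ 1ℙ ∷ []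

  bits : Parity → Parity → Parity → Fin 8
  bits 0ℙ 0ℙ 0ℙ = 0F
  bits 0ℙ 0ℙ 1ℙ = 1F
  bits 0ℙ 1ℙ 0ℙ = 2F
  bits 0ℙ 1ℙ 1ℙ = 3F
  bits 1ℙ 0ℙ 0ℙ = 4F
  bits 1ℙ 0ℙ 1ℙ = 5F
  bits 1ℙ 1ℙ 0ℙ = 6F
  bits 1ℙ 1ℙ 1ℙ = 7F

  index : 𝔽₂⁸ → Fin 8
  index x = bits (at 4F) (at 2F) (at 1F)
    where at = λ i → lookup x 0F ℙ.+ lookup x i

  word-sumZero : ∀ i → SumZero (word i)
  word-sumZero = from-yes (Fin.all? λ i → sumℙ (lookup (word i)) ℙ.≟ 0ℙ)

  word-inCode : ∀ i → T (inHammingCode (word i))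
  word-inCode = from-yes (Fin.all? λ i → Bool.T? (inHammingCode (word i)))

  inCode-𝟏 : ∀ x → inHammingCode (𝟏 ⊕ x) ≡ inHammingCode x
  inCode-𝟏 = from-yes (allVec? λ x → inHammingCode (𝟏 ⊕ x) Bool.≟ inHammingCode x)

  inCode-resp : ∀ {x y} → x ≈ᶠ y → inHammingCode x ≡ inHammingCode y
  inCode-resp         (inj₁ refl) = refl
  inCode-resp {y = y} (inj₂ refl) = inCode-𝟏 y

  index-𝟏 : ∀ x → index (𝟏 ⊕ x) ≡ index x
  index-𝟏 = from-yes (allVec? λ x → index (𝟏 ⊕ x) Fin.≟ index x)

  index-cong : ∀ {x y} → x ≈ᶠ y → index x ≡ index y
  index-cong         (inj₁ refl) = refl
  index-cong {y = y} (inj₂ refl) = index-𝟏 y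

  index-word : ∀ i → index (word i) ≡ i
  index-word = from-yes (Fin.all? λ i → index (word i) Fin.≟ i)

  word-index : ∀ x → SumZero x → T (inHammingCode x) → word (index x) ≈ᶠ x
  word-index = from-yes (allVec? λ x → (sumℙ (lookup x) ℙ.≟ 0ℙ) →-dec (Bool.T? (inHammingCode x) →-dec
    ((word (index x) ≟ᵛ x) ⊎-dec (word (index x) ≟ᵛ (𝟏 ⊕ x)))))

  words-independent : ∀ i j → ¬ (word i ~ᶠ word j)
  words-independent = from-yes (Fin.all? λ i → Fin.all? λ j → ¬? (word i ~ᶠ? word j))

hammingCoclique : Coclique₈
hammingCoclique = record
  { member = λ (x , _) → inHammingCode x
  ; member-resp = inCode-resp
  ; size = record
    { to = λ i → (word i , word-sumZero i) , word-inCode i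
    ; from = λ ((x , _) , _) → index x
    ; to-cong = λ { refl → inj₁ refl }
    ; from-cong = index-cong
    ; inverse = (λ { {(x , p) , q} refl → word-index x p q })
              , (λ {i} {((y , _) , _)} eq → ≡.trans (index-cong eq) (index-word i)) }
  ; independent = λ (x , p) (y , q) x∈ y∈ x~y → words-independent (index x) (index y)
      (~ᶠ-respˡ (word (index y)) (≈ᶠ-sym (word-index x p x∈))
        (~ᶠ-respʳ x (≈ᶠ-sym (word-index y q y∈)) x~y))
  }

-- The 8-cocliques of the folded halved 8-cube are the cosets of the 30 extended
-- Hamming codes.  They form two orbits of size 120, which the odd coordinate
-- permutations interchange, so both orbits give isomorphic graphs.
Γ₁ : Graph
Γ₁ = orbitGraph hammingCoclique

{-# OPTIONS --safe #-}
-- Even words of length 8 modulo 𝟏 label the Pauli operators on three qubits: e₀ + eᵥ acts on ℝ⁸ as the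
-- v-th octonion unit.  These operators permute the 120 lines spanned by the roots of E₈; the
-- stabiliser of a line is one of the 15 extended Hamming codes H_c in an orbit of the alternating
-- group, and the 8 lines with stabiliser H_c form an orthogonal frame.  So both graphs are unions of
-- 15 cliques of size 8: the frames, respectively the sets of cosets of a code.  Let the entry of u at
-- a line r and a coset x + H_c be the projection onto the line x r if r belongs to the frame c, and 0
-- otherwise.  In the block of two codes c ≠ d, both sides of A u = u A′ are the same spectral
-- projection of the Pauli operator labelled by the common words of weight 4 of H_c and H_d.
--
-- The C*-algebra M₈(ℂ) arises as the completion of the operators on ℚ(i)⁸.  Gaussian elimination
-- decides whether a rational number bounds a rational operator, so the norm is a constructive real.
--
-- Two nonorthogonal lines of G-E₈ span a plane containing a third one, which is orthogonal to
-- everything orthogonal to both; a nonadjacent pair in the complement of Γ₁ has no such third vertex.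
-- Hence the graphs are not isomorphic.
module Submission where

open import Defs
open import Algebra.Bundles using (CommutativeRing; Ring)
open import Algebra.Module.Structures using (IsLeftModule)
import Algebra.Properties.CommutativeMonoid.Sum as CMSum
import Algebra.Properties.Semiring.Sum as SemiringSum
open import Algebra.Structures using (IsRing)
open import Data.Bool.Base using (Bool; true; false; if_then_else_; _∧_; _xor_; not; T)
import Data.Bool.Properties as Bool
open import Data.Bool.Solver using (module xor-∧-Solver)
open import Data.Fin.Base as Fin using (Fin; zero; suc)
open import Data.Fin.Patterns using (0F; 1F; 2F; 3F; 4F; 5F; 6F; 7F; 8F)
open import Data.Fin.Permutation as Perm using (Permutation′; permutation; transpose; flip; _∘ₚ_; _⟨$⟩ʳ_; _⟨$⟩ˡ_; ↔⇒≡)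
open import Data.Fin.Permutation.Transposition.List using (TranspositionList; decompose; eval-decompose) renaming (eval to evalₜ)
import Data.Fin.Properties as Fin
open import Data.Integer.Base as ℤ using (ℤ; 0ℤ; 1ℤ; -1ℤ; _◃_)
import Data.Integer.Properties as ℤ
open import Data.List.Base as List using (List; []; _∷_)
import Data.List.Membership.DecPropositional as DecMembership
open import Data.List.Membership.Propositional using (_∈_)
open import Data.List.Membership.Propositional.Properties using (∈-++⁻; ∈-map⁻)
open import Data.List.Relation.Unary.Any using (here)
open import Data.Nat.Base as ℕ using (ℕ; zero; suc; _⊔_; parity)
import Data.Nat.Coprimality as Coprimality
open import Data.Nat.Divisibility using (divides; _∣?_)
import Data.Nat.Properties as ℕ
open import Data.Parity.Base as ℙ using (Parity; 0ℙ; 1ℙ)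
import Data.Parity.Properties as ℙ
open import Data.Product.Base using (∃-syntax; _×_; _,_; proj₁; proj₂; uncurry)
open import Data.Rational.Base as ℚ using (ℚ; mkℚ; 0ℚ; 1ℚ; ½)
import Data.Rational.Properties as ℚ
import Data.Rational.Solver as ℚSolver
import Data.Rational.Unnormalised.Base as ℚᵘ
import Data.Rational.Unnormalised.Properties as ℚᵘ
open import Data.Sign.Base as Sign using (Sign)
open import Data.Sum.Base using (_⊎_; inj₁; inj₂; [_,_]′)
open import Data.Vec.Base as Vec using (Vec; []; _∷_; _++_; lookup; zipWith; replicate; tabulate; _[_]≔_)
import Data.Vec.Properties as Vec
open import Data.Vec.Relation.Unary.All as All using (All; []; _∷_)
import Data.Vec.Relation.Unary.All.Properties as All
open import Function.Base using (_∘_; case_of_)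
open import Function.Bundles using (Inverse; Equivalence; _⇔_; mk⇔)
open import Function.Construct.Composition using () renaming (inverse to _⟨∘⟩_)
open import Function.Construct.Symmetry using () renaming (inverse to inverse-sym)
open import Level using (0ℓ)
open import Relation.Binary.Bundles using (Setoid)
open import Relation.Binary.Definitions using (_Respects_; tri<; tri≈; tri>)
open import Relation.Binary.PropositionalEquality as ≡ using (_≡_; _≢_; refl; cong; cong₂)
open import Relation.Nullary using (¬_; Dec; yes; no; does; contradiction; map′; ¬?; _→-dec_; _×-dec_; _⊎-dec_)
open import Relation.Nullary.Decidable using (from-yes; from-no; dec-true; dec-false)

open ℚSolver.+-*-Solver using (solve; con; _:=_; _:+_; _:*_; :-_; _:-_)
open CMSum ℕ.+-0-commutativeMonoid using () renaming (sum to sumℕ)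
open CMSum ℤ.+-0-commutativeMonoid using () renaming (sum to sumℤ; sum-cong-≗ to sumℤ-cong)
open CMSum ℙ.+-0-commutativeMonoid using () renaming (sum to sumℙ; sum-permute to sumℙ-permute; sum-cong-≗ to sumℙ-cong; ∑-distrib-+ to sumℙ-+; ∑-comm to sumℙ-comm)
open CMSum ℚ.+-0-commutativeMonoid using () renaming (sum to sumℚ; sum-cong-≗ to sumℚ-cong; ∑-comm to sumℚ-comm; ∑-distrib-+ to sumℚ-+)
open SemiringSum (Ring.semiring ℚ.+-*-ring) using () renaming (*-distribˡ-sum to *-distribˡ-sumℚ; *-distribʳ-sum to *-distribʳ-sumℚ)

-- The matrix identity needs no spectral theory. In one block both sides are partial sums of two
-- resolutions of the identity, and such partial sums agree as soon as two projections are
-- orthogonal whenever exactly one of them is selected. For the projections onto root lines this is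
-- a statement about bits of the two adjacency tables, which evaluation settles.
--
-- The orbit defining Γ₁ is what evaluation cannot reach directly, since it ranges over all even
-- permutations of eight coordinates. The parity of the number of inversions is shown to be additive
-- under composition; then only the transpositions (0 j) have to be examined. These are odd, so the
-- other orbit of 15 codes must be carried along although it contains no vertex of Γ₁.
--
-- The large tables are opaque and are handed to the decision procedures as arguments: each is
-- computed once, and proofs that only use the resulting facts never unfold it.

-- Rational inequalities

-- An inequality p ≤ q is proved by a certificate: q - p is rewritten, by the ring solver, as
-- an expression which is visibly nonnegative.
≤-by : ∀ {p q r} → 0ℚ ℚ.≤ r → q ℚ.- p ≡ r → p ℚ.≤ q
≤-by {p} {q} 0≤r eq = ≡.subst₂ ℚ._≤_ (ℚ.+-identityˡ p)
  (solve 2 (λ p q → (q :- p) :+ p := q) refl p q)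
  (ℚ.+-monoˡ-≤ p (≡.subst (0ℚ ℚ.≤_) (≡.sym eq) 0≤r))

<-by : ∀ {p q r} → 0ℚ ℚ.< r → q ℚ.- p ≡ r → p ℚ.< q
<-by {p} {q} 0<r eq = ≡.subst₂ ℚ._<_ (ℚ.+-identityˡ p)
  (solve 2 (λ p q → (q :- p) :+ p := q) refl p q)
  (ℚ.+-monoˡ-< p (≡.subst (0ℚ ℚ.<_) (≡.sym eq) 0<r))

0≤gap : ∀ {p q} → p ℚ.≤ q → 0ℚ ℚ.≤ q ℚ.- p
0≤gap {p} {q} p≤q = ≡.subst (ℚ._≤ q ℚ.- p) (ℚ.+-inverseʳ p) (ℚ.+-monoˡ-≤ (ℚ.- p) p≤q)

0≤+ : ∀ {p q} → 0ℚ ℚ.≤ p → 0ℚ ℚ.≤ q → 0ℚ ℚ.≤ p ℚ.+ q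
0≤+ = ℚ.+-mono-≤

0<+ : ∀ {p q} → 0ℚ ℚ.< p → 0ℚ ℚ.≤ q → 0ℚ ℚ.< p ℚ.+ q
0<+ = ℚ.+-mono-<-≤

0≤* : ∀ {p q} → 0ℚ ℚ.≤ p → 0ℚ ℚ.≤ q → 0ℚ ℚ.≤ p ℚ.* q
0≤* {p} {q} 0≤p 0≤q = ≡.subst (ℚ._≤ p ℚ.* q) (ℚ.*-zeroʳ p)
  (ℚ.*-monoˡ-≤-nonNeg p {{ℚ.nonNegative 0≤p}} 0≤q)

0<* : ∀ {p q} → 0ℚ ℚ.< p → 0ℚ ℚ.< q → 0ℚ ℚ.< p ℚ.* q
0<* {p} {q} 0<p 0<q = ≡.subst (ℚ._< p ℚ.* q) (ℚ.*-zeroʳ p)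
  (ℚ.*-monoʳ-<-pos p {{ℚ.positive 0<p}} 0<q)

0≤p² : ∀ p → 0ℚ ℚ.≤ p ℚ.* p
0≤p² p with ℚ.≤-total 0ℚ p
... | inj₁ 0≤p = 0≤* 0≤p 0≤p
... | inj₂ p≤0 = ≡.subst (0ℚ ℚ.≤_) (solve 1 (λ p → (:- p) :* (:- p) := p :* p) refl p)
                   (0≤* (ℚ.neg-antimono-≤ p≤0) (ℚ.neg-antimono-≤ p≤0))

cancel-≤ : ∀ {c p q} → 0ℚ ℚ.< c → c ℚ.* p ℚ.≤ c ℚ.* q → p ℚ.≤ q
cancel-≤ {c} 0<c = ℚ.*-cancelˡ-≤-pos c {{ℚ.positive 0<c}}

0<½ : 0ℚ ℚ.< ½
0<½ = ℚ.positive⁻¹ ½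

0<1 : 0ℚ ℚ.< 1ℚ
0<1 = ℚ.positive⁻¹ 1ℚ

p≤∣p∣ : ∀ p → p ℚ.≤ ℚ.∣ p ∣
p≤∣p∣ p with ℚ.≤-total 0ℚ p
... | inj₁ 0≤p = ℚ.≤-reflexive (≡.sym (ℚ.0≤p⇒∣p∣≡p 0≤p))
... | inj₂ p≤0 = ℚ.≤-trans p≤0 (ℚ.0≤∣p∣ p)

<⇒≱ : ∀ {p q} → p ℚ.< q → ¬ (q ℚ.≤ p)
<⇒≱ p<q q≤p = ℚ.<-irrefl refl (ℚ.<-≤-trans p<q q≤p)

-- Inner products

infixl 6 _⊞_
infixr 7 _⊡_

_⊞_ : ∀ {n} → Vec ℚ n → Vec ℚ n → Vec ℚ n
_⊞_ = zipWith ℚ._+_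

_⊡_ : ∀ {n} → ℚ → Vec ℚ n → Vec ℚ n
c ⊡ x = Vec.map (c ℚ.*_) x

dot : ∀ {n} → Vec ℚ n → Vec ℚ n → ℚ
dot []      []      = 0ℚ
dot (a ∷ x) (b ∷ y) = a ℚ.* b ℚ.+ dot x y

dot-comm : ∀ {n} (x y : Vec ℚ n) → dot x y ≡ dot y x
dot-comm []      []      = refl
dot-comm (a ∷ x) (b ∷ y) = cong₂ ℚ._+_ (ℚ.*-comm a b) (dot-comm x y)

dot-⊞ : ∀ {n} (x y z : Vec ℚ n) → dot (x ⊞ y) z ≡ dot x z ℚ.+ dot y z
dot-⊞ []      []      []      = refl
dot-⊞ (a ∷ x) (b ∷ y) (c ∷ z) = ≡.trans (cong ((a ℚ.+ b) ℚ.* c ℚ.+_) (dot-⊞ x y z))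
  (solve 5 (λ a b c d e → (a :+ b) :* c :+ (d :+ e) := (a :* c :+ d) :+ (b :* c :+ e)) refl
    a b c (dot x z) (dot y z))

dot-⊡ : ∀ {n} c (x y : Vec ℚ n) → dot (c ⊡ x) y ≡ c ℚ.* dot x y
dot-⊡ c []      []      = ≡.sym (ℚ.*-zeroʳ c)
dot-⊡ c (a ∷ x) (b ∷ y) = ≡.trans (cong (c ℚ.* a ℚ.* b ℚ.+_) (dot-⊡ c x y))
  (solve 4 (λ a b c d → c :* a :* b :+ c :* d := c :* (a :* b :+ d)) refl a b c (dot x y))

dot-0 : ∀ {n} (y : Vec ℚ n) → dot (replicate n 0ℚ) y ≡ 0ℚ
dot-0 []      = refl
dot-0 (b ∷ y) = ≡.trans (cong₂ ℚ._+_ (ℚ.*-zeroˡ b) (dot-0 y)) refl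

0≤dot : ∀ {n} (x : Vec ℚ n) → 0ℚ ℚ.≤ dot x x
0≤dot []      = ℚ.≤-refl
0≤dot (a ∷ x) = 0≤+ (0≤p² a) (0≤dot x)

-- The gap grows by the squared norm of b x - a y, as in Lagrange's identity.
cauchy-schwarz : ∀ {n} (x y : Vec ℚ n) → dot x y ℚ.* dot x y ℚ.≤ dot x x ℚ.* dot y y
cauchy-schwarz []      []      = ℚ.≤-refl
cauchy-schwarz (a ∷ x) (b ∷ y) = ≤-by
  (0≤+ (0≤gap (cauchy-schwarz x y)) (0≤dot (b ⊡ x ⊞ (ℚ.- a) ⊡ y)))
  (≡.trans
    (solve 5 (λ a b p q r →
       (a :* a :+ p) :* (b :* b :+ q) :- (a :* b :+ r) :* (a :* b :+ r) :=
       (p :* q :- r :* r) :+ (b :* (b :* p :+ (:- a) :* r) :+ (:- a) :* (b :* r :+ (:- a) :* q))) refl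
       a b (dot x x) (dot y y) (dot x y))
    (cong (dot x x ℚ.* dot y y ℚ.- dot x y ℚ.* dot x y ℚ.+_) (≡.sym expand)))
  where
  expand : dot (b ⊡ x ⊞ (ℚ.- a) ⊡ y) (b ⊡ x ⊞ (ℚ.- a) ⊡ y)
         ≡ b ℚ.* (b ℚ.* dot x x ℚ.+ (ℚ.- a) ℚ.* dot x y) ℚ.+
           (ℚ.- a) ℚ.* (b ℚ.* dot x y ℚ.+ (ℚ.- a) ℚ.* dot y y)
  expand = ≡.trans (lin x y (b ⊡ x ⊞ (ℚ.- a) ⊡ y)) (cong₂ (λ s t → b ℚ.* s ℚ.+ (ℚ.- a) ℚ.* t)
      (≡.trans (dot-comm x _) (≡.trans (lin x y x) (cong (λ s → b ℚ.* dot x x ℚ.+ (ℚ.- a) ℚ.* s) (dot-comm y x))))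
      (≡.trans (dot-comm y _) (lin x y y)))
    where
    lin : ∀ x y z → dot (b ⊡ x ⊞ (ℚ.- a) ⊡ y) z ≡ b ℚ.* dot x z ℚ.+ (ℚ.- a) ℚ.* dot y z
    lin x y z = ≡.trans (dot-⊞ (b ⊡ x) ((ℚ.- a) ⊡ y) z) (cong₂ ℚ._+_ (dot-⊡ b x z) (dot-⊡ (ℚ.- a) y z))

-- Quadratic forms

-- The form  a t² + 2 t ⟨ b , x ⟩ + r(x)  in the variables t ∷ x.
data QuadraticForm : ℕ → Set where
  []       : QuadraticForm 0
  _∷⟨_⟩∷_ : ∀ {n} → ℚ → Vec ℚ n → QuadraticForm n → QuadraticForm (suc n)

eval : ∀ {n} → QuadraticForm n → Vec ℚ n → ℚ
eval []               []      = 0ℚ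
eval (a ∷⟨ b ⟩∷ r) (t ∷ x) = a ℚ.* (t ℚ.* t) ℚ.+ (t ℚ.* dot b x ℚ.+ t ℚ.* dot b x) ℚ.+ eval r x

scaledNorm : ∀ n → ℚ → QuadraticForm n
scaledNorm zero    c = []
scaledNorm (suc n) c = c ∷⟨ replicate n 0ℚ ⟩∷ scaledNorm n c

eval-scaledNorm : ∀ {n} c (x : Vec ℚ n) → eval (scaledNorm n c) x ≡ c ℚ.* dot x x
eval-scaledNorm c []      = ≡.sym (ℚ.*-zeroʳ c)
eval-scaledNorm c (t ∷ x) = ≡.trans
  (cong₂ (λ p q → c ℚ.* (t ℚ.* t) ℚ.+ (t ℚ.* p ℚ.+ t ℚ.* p) ℚ.+ q) (dot-0 x) (eval-scaledNorm c x))
  (solve 3 (λ c t d → c :* (t :* t) :+ (t :* con 0ℚ :+ t :* con 0ℚ) :+ c :* d := c :* (t :* t :+ d)) refl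
    c t (dot x x))

scale : ∀ {n} → ℚ → QuadraticForm n → QuadraticForm n
scale c []               = []
scale c (a ∷⟨ b ⟩∷ r) = (c ℚ.* a) ∷⟨ c ⊡ b ⟩∷ scale c r

eval-scale : ∀ {n} c (q : QuadraticForm n) x → eval (scale c q) x ≡ c ℚ.* eval q x
eval-scale c []               []      = ≡.sym (ℚ.*-zeroʳ c)
eval-scale c (a ∷⟨ b ⟩∷ r) (t ∷ x) = ≡.trans
  (cong₂ (λ p q → c ℚ.* a ℚ.* (t ℚ.* t) ℚ.+ (t ℚ.* p ℚ.+ t ℚ.* p) ℚ.+ q) (dot-⊡ c b x) (eval-scale c r x))
  (solve 5 (λ c a t d e → c :* a :* (t :* t) :+ (t :* (c :* d) :+ t :* (c :* d)) :+ c :* e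
                       := c :* (a :* (t :* t) :+ (t :* d :+ t :* d) :+ e)) refl c a t (dot b x) (eval r x))

-- Subtracts the square of the linear form ⟨ d , x ⟩. This serves the elimination step, through the
-- Schur complement, and later the construction of c‖x‖² - ‖f x‖² row by row.
subSquare : ∀ {n} → Vec ℚ n → QuadraticForm n → QuadraticForm n
subSquare []      []               = []
subSquare (β ∷ d) (a ∷⟨ b ⟩∷ r) = (a ℚ.- β ℚ.* β) ∷⟨ b ⊞ (ℚ.- β) ⊡ d ⟩∷ subSquare d r

eval-subSquare : ∀ {n} (d : Vec ℚ n) q x → eval (subSquare d q) x ≡ eval q x ℚ.- dot d x ℚ.* dot d x
eval-subSquare []      []               []      = refl
eval-subSquare (β ∷ d) (a ∷⟨ b ⟩∷ r) (t ∷ x) = ≡.trans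
  (cong₂ (λ p q → (a ℚ.- β ℚ.* β) ℚ.* (t ℚ.* t) ℚ.+ (t ℚ.* p ℚ.+ t ℚ.* p) ℚ.+ q)
    (≡.trans (dot-⊞ b ((ℚ.- β) ⊡ d) x) (cong (dot b x ℚ.+_) (dot-⊡ (ℚ.- β) d x)))
    (eval-subSquare d r x))
  (solve 6 (λ a β t p q e →
      (a :- β :* β) :* (t :* t) :+ (t :* (p :+ (:- β) :* q) :+ t :* (p :+ (:- β) :* q)) :+ (e :- q :* q)
   := (a :* (t :* t) :+ (t :* p :+ t :* p) :+ e) :- (β :* t :+ q) :* (β :* t :+ q)) refl
    a β t (dot b x) (dot d x) (eval r x))

-- Gaussian elimination; in the case a > 0 the square of a t + ⟨ b , x ⟩ is completed.
nonNegative⊎negative : ∀ {n} (q : QuadraticForm n) →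
  (∀ x → 0ℚ ℚ.≤ eval q x) ⊎ (∃[ x ] eval q x ℚ.< 0ℚ)
nonNegative⊎negative []               = inj₁ λ { [] → ℚ.≤-refl }
nonNegative⊎negative {suc n} (a ∷⟨ b ⟩∷ r) with ℚ.<-cmp a 0ℚ
... | tri< a<0 _ _ = inj₂ (x₀ , ≡.subst (ℚ._< 0ℚ) (≡.sym eval-x₀) a<0)
  where
  x₀ = 1ℚ ∷ replicate n 0ℚ
  eval-0 : ∀ {n} (q : QuadraticForm n) → eval q (replicate n 0ℚ) ≡ 0ℚ
  eval-0 []               = refl
  eval-0 (a ∷⟨ b ⟩∷ r) = ≡.trans
    (cong₂ (λ p q → a ℚ.* (0ℚ ℚ.* 0ℚ) ℚ.+ (0ℚ ℚ.* p ℚ.+ 0ℚ ℚ.* p) ℚ.+ q)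
      (≡.trans (dot-comm b _) (dot-0 b)) (eval-0 r))
    (solve 1 (λ a → a :* (con 0ℚ :* con 0ℚ) :+ (con 0ℚ :* con 0ℚ :+ con 0ℚ :* con 0ℚ) :+ con 0ℚ := con 0ℚ) refl a)
  eval-x₀ : eval (a ∷⟨ b ⟩∷ r) x₀ ≡ a
  eval-x₀ = ≡.trans
    (cong₂ (λ p q → a ℚ.* (1ℚ ℚ.* 1ℚ) ℚ.+ (1ℚ ℚ.* p ℚ.+ 1ℚ ℚ.* p) ℚ.+ q)
      (≡.trans (dot-comm b _) (dot-0 b)) (eval-0 r))
    (solve 1 (λ a → a :* (con 1ℚ :* con 1ℚ) :+ (con 1ℚ :* con 0ℚ :+ con 1ℚ :* con 0ℚ) :+ con 0ℚ := a) refl a)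
-- The recursion runs on a r - b bᵀ, which is a times the Schur complement, so no division by a is
-- needed to state it.
... | tri> _ _ a>0 with nonNegative⊎negative (subSquare b (scale a r))
...   | inj₁ r≥0 = inj₁ λ { (t ∷ x) → cancel-≤ a>0 (≤-by
          (0≤+ (0≤p² (a ℚ.* t ℚ.+ dot b x)) (r≥0 x))
          (≡.trans
            (solve 4 (λ a t d e → a :* (a :* (t :* t) :+ (t :* d :+ t :* d) :+ e) :- a :* con 0ℚ
                := (a :* t :+ d) :* (a :* t :+ d) :+ (a :* e :- d :* d)) refl a t (dot b x) (eval r x))
            (cong ((a ℚ.* t ℚ.+ dot b x) ℚ.* (a ℚ.* t ℚ.+ dot b x) ℚ.+_)
              (≡.sym (≡.trans (eval-subSquare b (scale a r) x)
                (cong (ℚ._- dot b x ℚ.* dot b x) (eval-scale a r x))))))) }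
...   | inj₂ (x , r<0) = inj₂ (t ∷ x , ℚ.*-cancelˡ-<-nonNeg a {{ℚ.nonNegative (ℚ.<⇒≤ a>0)}}
          (≡.subst₂ ℚ._<_ eq (≡.sym (ℚ.*-zeroʳ a)) r<0))
  where
  instance
    a-nz : ℚ.NonZero a
    a-nz = ℚ.pos⇒nonZero a {{ℚ.positive a>0}}
  -- The minimiser in the first variable: it makes the completed square a t + ⟨ b , x ⟩ vanish.
  t = ℚ.1/ a ℚ.* (ℚ.- dot b x)
  at : a ℚ.* t ≡ ℚ.- dot b x
  at = ≡.trans (≡.sym (ℚ.*-assoc a (ℚ.1/ a) (ℚ.- dot b x)))
         (≡.trans (cong (ℚ._* (ℚ.- dot b x)) (ℚ.*-inverseʳ a)) (ℚ.*-identityˡ _))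
  eq : eval (subSquare b (scale a r)) x ≡ a ℚ.* eval (a ∷⟨ b ⟩∷ r) (t ∷ x)
  eq = ≡.trans (≡.trans (eval-subSquare b (scale a r) x)
                 (cong (ℚ._- dot b x ℚ.* dot b x) (eval-scale a r x)))
       (≡.trans (solve 2 (λ d e → e :- d :* d := ((:- d) :* (:- d) :+ ((:- d) :* d :+ (:- d) :* d)) :+ e) refl
                  (dot b x) (a ℚ.* eval r x))
       (≡.trans (cong (λ s → (s ℚ.* s ℚ.+ (s ℚ.* dot b x ℚ.+ s ℚ.* dot b x)) ℚ.+ a ℚ.* eval r x) (≡.sym at))
         (solve 4 (λ a t d e → (a :* t :* (a :* t) :+ (a :* t :* d :+ a :* t :* d)) :+ a :* e
                := a :* (a :* (t :* t) :+ (t :* d :+ t :* d) :+ e)) refl a t (dot b x) (eval r x))))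
nonNegative⊎negative {suc n} (a ∷⟨ b ⟩∷ r) | tri≈ _ refl _ with dot b b ℚ.≟ 0ℚ
... | no b≢0 = inj₂ (t ∷ b , ≡.subst (ℚ._< 0ℚ) (≡.sym eq) (ℚ.negative⁻¹ (ℚ.- 1ℚ)))
  where
  instance
    b-nz : ℚ.NonZero (dot b b)
    b-nz = ℚ.≢-nonZero b≢0
  -- For a = 0 the form is affine in t. With t ⟨ b , b ⟩ = s its value at t ∷ b is 2 s + r(b), and s
  -- is chosen to make this -1.
  s = ½ ℚ.* (ℚ.- (eval r b ℚ.+ 1ℚ))
  t = s ℚ.* ℚ.1/ dot b b
  eq : eval (0ℚ ∷⟨ b ⟩∷ r) (t ∷ b) ≡ ℚ.- 1ℚ
  eq = ≡.trans (cong (λ z → 0ℚ ℚ.* (t ℚ.* t) ℚ.+ (z ℚ.+ z) ℚ.+ eval r b)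
         (≡.trans (ℚ.*-assoc s (ℚ.1/ dot b b) (dot b b))
           (≡.trans (cong (s ℚ.*_) (ℚ.*-inverseˡ (dot b b))) (ℚ.*-identityʳ s))))
       (solve 2 (λ t e → con 0ℚ :* (t :* t) :+ (con ½ :* (:- (e :+ con 1ℚ)) :+ con ½ :* (:- (e :+ con 1ℚ))) :+ e
                := :- con 1ℚ) refl t (eval r b))
... | yes b≡0 with nonNegative⊎negative r
-- By Cauchy-Schwarz, ⟨ b , b ⟩ = 0 kills every ⟨ b , x ⟩, so the form does not depend on t.
...   | inj₁ r≥0 = inj₁ λ { (t ∷ x) → ≡.subst (0ℚ ℚ.≤_) (≡.sym (eq t x)) (r≥0 x) }
  where
  p²≤0⇒p≡0 : ∀ p → p ℚ.* p ℚ.≤ 0ℚ → p ≡ 0ℚ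
  p²≤0⇒p≡0 p p²≤0 with ℚ.<-cmp p 0ℚ
  ... | tri≈ _ eq _ = eq
  ... | tri> _ _ p>0 = contradiction (0<* p>0 p>0) (λ 0<p² → <⇒≱ 0<p² p²≤0)
  ... | tri< p<0 _ _ = contradiction
          (≡.subst (0ℚ ℚ.<_) (solve 1 (λ p → (:- p) :* (:- p) := p :* p) refl p)
            (0<* (ℚ.neg-antimono-< p<0) (ℚ.neg-antimono-< p<0))) (λ 0<p² → <⇒≱ 0<p² p²≤0)
  eq : ∀ t x → eval (0ℚ ∷⟨ b ⟩∷ r) (t ∷ x) ≡ eval r x
  eq t x = ≡.trans (cong (λ z → 0ℚ ℚ.* (t ℚ.* t) ℚ.+ (t ℚ.* z ℚ.+ t ℚ.* z) ℚ.+ eval r x)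
      (p²≤0⇒p≡0 (dot b x) (≡.subst (dot b x ℚ.* dot b x ℚ.≤_)
        (≡.trans (cong (ℚ._* dot x x) b≡0) (ℚ.*-zeroˡ (dot x x))) (cauchy-schwarz b x))))
    (solve 2 (λ t e → con 0ℚ :* (t :* t) :+ (t :* con 0ℚ :+ t :* con 0ℚ) :+ e := e) refl t (eval r x))
...   | inj₂ (x , r<0) = inj₂ (0ℚ ∷ x , ≡.subst (ℚ._< 0ℚ) (≡.sym
          (solve 2 (λ d e → con 0ℚ :* (con 0ℚ :* con 0ℚ) :+ (con 0ℚ :* d :+ con 0ℚ :* d) :+ e := e) refl
            (dot b x) (eval r x))) r<0)

-- The Archimedean property

fromℕ : ℕ → ℚ
fromℕ m = mkℚ (ℤ.+ m) 0 (Coprimality.sym (Coprimality.1-coprimeTo m))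

fromℕ-suc : ∀ m → fromℕ (suc m) ≡ fromℕ m ℚ.+ 1ℚ
fromℕ-suc m = ℚ.toℚᵘ-injective (ℚᵘ.≃-trans
  (ℚᵘ.*≡* (≡.trans (ℤ.*-identityʳ (ℤ.+ suc m)) (≡.sym (≡.trans (ℤ.*-identityʳ _)
     (≡.trans (cong (ℤ._+ ℤ.+ 1) (ℤ.*-identityʳ (ℤ.+ m))) (ℤ.+-comm (ℤ.+ m) (ℤ.+ 1)))))))
  (ℚᵘ.≃-sym (ℚ.toℚᵘ-homo-+ (fromℕ m) 1ℚ)))

-- A fraction n / d is at most ∣ n ∣ because d is at least 1.
archimedean : ∀ p → ∃[ m ] p ℚ.≤ fromℕ m
archimedean p@(mkℚ n d _) = ℤ.∣ n ∣ , ℚ.*≤* (ℤ.≤-trans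
  (≡.subst (ℤ._≤ ℤ.+ ℤ.∣ n ∣) (≡.sym (ℤ.*-identityʳ n)) (n≤∣n∣ n))
  (≡.subst₂ ℤ._≤_ (ℤ.*-identityʳ _) (≡.refl {x = ℤ.+ ℤ.∣ n ∣ ℤ.* ℤ.+ suc d}) (ℤ.*-monoˡ-≤-nonNeg (ℤ.+ ℤ.∣ n ∣) (ℤ.+≤+ (ℕ.s≤s ℕ.z≤n)))))
  where
  n≤∣n∣ : ∀ n → n ℤ.≤ ℤ.+ ℤ.∣ n ∣
  n≤∣n∣ (ℤ.+ n)      = ℤ.≤-refl
  n≤∣n∣ (ℤ.-[1+ n ]) = ℤ.-≤+

-- The number 1/(n+1), the accuracy of the n-th rational approximation of a norm.
δ : ℕ → ℚ
δ n = mkℚ (ℤ.+ 1) n (Coprimality.1-coprimeTo (suc n))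

0<δ : ∀ n → 0ℚ ℚ.< δ n
0<δ n = ℚ.positive⁻¹ (δ n)

δ-mono : ∀ {m n} → m ℕ.≤ n → δ n ℚ.≤ δ m
δ-mono {m} {n} m≤n = ℚ.*≤* (≡.subst₂ ℤ._≤_ (≡.sym (ℤ.*-identityˡ _)) (≡.sym (ℤ.*-identityˡ _)) (ℤ.+≤+ (ℕ.s≤s m≤n)))

δ-small : ∀ ε → 0ℚ ℚ.< ε → ∃[ N ] ∀ n → N ℕ.≤ n → δ n ℚ.≤ ε
δ-small ε 0<ε = d , λ n d≤n → ℚ.≤-trans (δ-mono d≤n) (δ≤ ε 0<ε)
  where
  d = ℚ.denominator-1 ε
  δ≤ : ∀ ε → 0ℚ ℚ.< ε → δ (ℚ.denominator-1 ε) ℚ.≤ ε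
  δ≤ ε@(mkℚ (ℤ.+ suc a) d _) _ = ℚ.*≤* (ℤ.*-monoʳ-≤-nonNeg (ℤ.+ suc d) {ℤ.+ 1} {ℤ.+ suc a} (ℤ.+≤+ (ℕ.s≤s ℕ.z≤n)))
  δ≤ (mkℚ (ℤ.+ 0) d _) (ℚ.*<* (ℤ.+<+ ()))
  δ≤ (mkℚ (ℤ.-[1+ _ ]) d _) (ℚ.*<* ())

-- The multiples of 1/(n+1), starting with the first one and not with 0, because a `Bound` must be
-- positive.
grid : ℕ → ℕ → ℚ
grid n k = fromℕ (suc k) ℚ.* δ n

grid-zero : ∀ n → grid n 0 ≡ δ n
grid-zero n = ℚ.*-identityˡ (δ n)

grid-suc : ∀ n k → grid n (suc k) ≡ grid n k ℚ.+ δ n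
grid-suc n k = ≡.trans (cong (ℚ._* δ n) (fromℕ-suc (suc k)))
  (≡.trans (ℚ.*-distribʳ-+ (δ n) (fromℕ (suc k)) 1ℚ) (cong (grid n k ℚ.+_) (ℚ.*-identityˡ (δ n))))

0<grid : ∀ n k → 0ℚ ℚ.< grid n k
0<grid n k = 0<* (ℚ.positive⁻¹ (fromℕ (suc k))) (0<δ n)

grid-unbounded : ∀ n p → ∃[ k ] p ℚ.≤ grid n k
grid-unbounded n p = let m , le = archimedean (p ℚ.* ℚ.1/ δ n) in m , ≤-by
  (0≤+ (0≤* (0≤gap le) (ℚ.<⇒≤ (0<δ n))) (ℚ.<⇒≤ (0<δ n)))
  (≡.trans (cong₂ (λ s t → s ℚ.* δ n ℚ.- t) (fromℕ-suc m)
       (≡.sym (≡.trans (ℚ.*-assoc p (ℚ.1/ δ n) (δ n))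
         (≡.trans (cong (p ℚ.*_) (ℚ.*-inverseˡ (δ n))) (ℚ.*-identityʳ p)))))
    (solve 3 (λ m q d → (m :+ con 1ℚ) :* d :- q :* d := (m :- q) :* d :+ d) refl
      (fromℕ m) (p ℚ.* ℚ.1/ δ n) (δ n)))

-- Operators

-- An inner product space over ℚ(i), presented by the real part of its inner product together with
-- `J`. No equality of vectors is required: every law is tested on inner products. Finite dimension
-- enters only through `bounded` and `bound?`.
record ComplexSpace : Set₁ where
  infixl 6 _+ᵥ_
  infixr 7 _·ᵥ_
  field
    V      : Set
    _+ᵥ_   : V → V → V
    _·ᵥ_   : ℚ → V → V
    ⟪_,_⟫ : V → V → ℚ
    -- Multiplication by the imaginary unit.
    J      : V → V
    ⟪⟫-comm   : ∀ x y → ⟪ x , y ⟫ ≡ ⟪ y , x ⟫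
    ⟪⟫-+      : ∀ x y z → ⟪ x +ᵥ y , z ⟫ ≡ ⟪ x , z ⟫ ℚ.+ ⟪ y , z ⟫
    ⟪⟫-·      : ∀ c x z → ⟪ c ·ᵥ x , z ⟫ ≡ c ℚ.* ⟪ x , z ⟫
    0≤⟪⟫      : ∀ x → 0ℚ ℚ.≤ ⟪ x , x ⟫
    J-skew     : ∀ x y → ⟪ J x , y ⟫ ≡ ℚ.- ⟪ x , J y ⟫
    J-isometry : ∀ x y → ⟪ J x , J y ⟫ ≡ ⟪ x , y ⟫
    unit       : V
    unit-norm  : ⟪ unit , unit ⟫ ≡ 1ℚ

  Adjoint : (f f* : V → V) → Set
  Adjoint f f* = ∀ x y → ⟪ f x , y ⟫ ≡ ⟪ x , f* y ⟫

  field
    bounded : ∀ f f* → Adjoint f f* → ∃[ c ] ∀ x → ⟪ f x , f x ⟫ ℚ.≤ c ℚ.* ⟪ x , x ⟫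
    bound?  : ∀ f f* → Adjoint f f* → ∀ c → Dec (∀ x → ⟪ f x , f x ⟫ ℚ.≤ c ℚ.* ⟪ x , x ⟫)

module Operators (S : ComplexSpace) where
  open ComplexSpace S

  ⟪⟫-+ʳ : ∀ x y z → ⟪ z , x +ᵥ y ⟫ ≡ ⟪ z , x ⟫ ℚ.+ ⟪ z , y ⟫
  ⟪⟫-+ʳ x y z = ≡.trans (⟪⟫-comm z _) (≡.trans (⟪⟫-+ x y z) (cong₂ ℚ._+_ (⟪⟫-comm x z) (⟪⟫-comm y z)))

  ⟪⟫-·ʳ : ∀ c x z → ⟪ z , c ·ᵥ x ⟫ ≡ c ℚ.* ⟪ z , x ⟫
  ⟪⟫-·ʳ c x z = ≡.trans (⟪⟫-comm z _) (≡.trans (⟪⟫-· c x z) (cong (c ℚ.*_) (⟪⟫-comm x z)))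

  J²≡-1 : ∀ x y → ⟪ J (J x) , y ⟫ ≡ ℚ.- ⟪ x , y ⟫
  J²≡-1 x y = ≡.trans (J-skew (J x) y) (cong ℚ.-_ (J-isometry x y))

  ⟪Jx,x⟫≡0 : ∀ x → ⟪ J x , x ⟫ ≡ 0ℚ
  ⟪Jx,x⟫≡0 x = begin
    j                     ≡⟨ solve 1 (λ j → j := con ½ :* (j :+ j)) refl j ⟩
    ½ ℚ.* (j ℚ.+ j)       ≡⟨ cong (λ s → ½ ℚ.* (j ℚ.+ s)) (≡.trans (J-skew x x) (cong ℚ.-_ (⟪⟫-comm x (J x)))) ⟩
    ½ ℚ.* (j ℚ.+ ℚ.- j)   ≡⟨ solve 1 (λ j → con ½ :* (j :+ :- j) := con 0ℚ) refl j ⟩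
    0ℚ                    ∎
    where
    open ≡.≡-Reasoning
    j = ⟪ J x , x ⟫

  norm-combination : ∀ a b x y → ⟪ a ·ᵥ x +ᵥ b ·ᵥ y , a ·ᵥ x +ᵥ b ·ᵥ y ⟫
    ≡ a ℚ.* a ℚ.* ⟪ x , x ⟫ ℚ.+ (a ℚ.* b ℚ.* ⟪ x , y ⟫ ℚ.+ a ℚ.* b ℚ.* ⟪ x , y ⟫) ℚ.+ b ℚ.* b ℚ.* ⟪ y , y ⟫
  norm-combination a b x y = ≡.trans (lin x y z) (≡.trans
    (cong₂ (λ s t → a ℚ.* s ℚ.+ b ℚ.* t)
      (≡.trans (⟪⟫-comm x z) (≡.trans (lin x y x) (cong (λ s → a ℚ.* ⟪ x , x ⟫ ℚ.+ b ℚ.* s) (⟪⟫-comm y x))))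
      (≡.trans (⟪⟫-comm y z) (lin x y y)))
    (solve 5 (λ a b p q r → a :* (a :* p :+ b :* q) :+ b :* (a :* q :+ b :* r)
      := a :* a :* p :+ (a :* b :* q :+ a :* b :* q) :+ b :* b :* r) refl
      a b ⟪ x , x ⟫ ⟪ x , y ⟫ ⟪ y , y ⟫))
    where
    z = a ·ᵥ x +ᵥ b ·ᵥ y
    lin : ∀ x y z → ⟪ a ·ᵥ x +ᵥ b ·ᵥ y , z ⟫ ≡ a ℚ.* ⟪ x , z ⟫ ℚ.+ b ℚ.* ⟪ y , z ⟫
    lin x y z = ≡.trans (⟪⟫-+ (a ·ᵥ x) (b ·ᵥ y) z) (cong₂ ℚ._+_ (⟪⟫-· a x z) (⟪⟫-· b y z))

  -- A map with an adjoint is linear, as far as inner products can tell.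
  record Operator : Set where
    field
      fun fun*  : V → V
      adjoint   : Adjoint fun fun*
      commutesJ : ∀ x y → ⟪ fun (J x) , y ⟫ ≡ ⟪ J (fun x) , y ⟫

    linear-+ : ∀ x y z → ⟪ fun (x +ᵥ y) , z ⟫ ≡ ⟪ fun x , z ⟫ ℚ.+ ⟪ fun y , z ⟫
    linear-+ x y z = ≡.trans (adjoint (x +ᵥ y) z) (≡.trans (⟪⟫-+ x y (fun* z))
      (≡.sym (cong₂ ℚ._+_ (adjoint x z) (adjoint y z))))

    linear-· : ∀ c x z → ⟪ fun (c ·ᵥ x) , z ⟫ ≡ c ℚ.* ⟪ fun x , z ⟫
    linear-· c x z = ≡.trans (adjoint (c ·ᵥ x) z) (≡.trans (⟪⟫-· c x (fun* z))
      (≡.sym (cong (c ℚ.*_) (adjoint x z))))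

  open Operator

  infix  4 _≐_
  infixl 6 _⊹_ _⊖_
  infixl 7 _⊛_
  infix  9 _†

  -- A record, so that the operators can be inferred from a proof.
  record _≐_ (f g : Operator) : Set where
    constructor ext
    field
      ≐-apply : ∀ x y → ⟪ fun f x , y ⟫ ≡ ⟪ fun g x , y ⟫

  open _≐_

  ≐-refl : ∀ {f} → f ≐ f
  ≐-refl = ext λ _ _ → refl

  ≐-sym : ∀ {f g} → f ≐ g → g ≐ f
  ≐-sym p = ext λ x y → ≡.sym (≐-apply p x y)

  ≐-trans : ∀ {f g h} → f ≐ g → g ≐ h → f ≐ h
  ≐-trans p q = ext λ x y → ≡.trans (≐-apply p x y) (≐-apply q x y)

  Commutes : (V → V) → Set
  Commutes f = ∀ x y → ⟪ f (J x) , y ⟫ ≡ ⟪ J (f x) , y ⟫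

  abstract
    J-+ : ∀ x y z → ⟪ J (x +ᵥ y) , z ⟫ ≡ ⟪ J x , z ⟫ ℚ.+ ⟪ J y , z ⟫
    J-+ x y z = ≡.trans (J-skew (x +ᵥ y) z) (≡.trans (cong ℚ.-_ (⟪⟫-+ x y (J z)))
      (≡.trans (ℚ.neg-distrib-+ ⟪ x , J z ⟫ ⟪ y , J z ⟫)
        (≡.sym (cong₂ ℚ._+_ (J-skew x z) (J-skew y z)))))

    J-· : ∀ c x z → ⟪ J (c ·ᵥ x) , z ⟫ ≡ c ℚ.* ⟪ J x , z ⟫
    J-· c x z = ≡.trans (J-skew (c ·ᵥ x) z) (≡.trans (cong ℚ.-_ (⟪⟫-· c x (J z)))
      (≡.trans (ℚ.neg-distribʳ-* c ⟪ x , J z ⟫) (≡.sym (cong (c ℚ.*_) (J-skew x z)))))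

    ⊹-adjoint : ∀ f g → Adjoint (λ x → fun f x +ᵥ fun g x) (λ x → fun* f x +ᵥ fun* g x)
    ⊹-adjoint f g x y = ≡.trans (⟪⟫-+ (fun f x) (fun g x) y)
      (≡.trans (cong₂ ℚ._+_ (adjoint f x y) (adjoint g x y)) (≡.sym (⟪⟫-+ʳ (fun* f y) (fun* g y) x)))

    ⊹-commutes : ∀ f g → Commutes (λ x → fun f x +ᵥ fun g x)
    ⊹-commutes f g x y = ≡.trans (⟪⟫-+ (fun f (J x)) (fun g (J x)) y)
      (≡.trans (cong₂ ℚ._+_ (commutesJ f x y) (commutesJ g x y)) (≡.sym (J-+ (fun f x) (fun g x) y)))

    scaled-adjoint : ∀ c f → Adjoint (λ x → c ·ᵥ fun f x) (λ x → c ·ᵥ fun* f x)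
    scaled-adjoint c f x y = ≡.trans (⟪⟫-· c (fun f x) y)
      (≡.trans (cong (c ℚ.*_) (adjoint f x y)) (≡.sym (⟪⟫-·ʳ c (fun* f y) x)))

    scaled-commutes : ∀ c f → Commutes (λ x → c ·ᵥ fun f x)
    scaled-commutes c f x y = ≡.trans (⟪⟫-· c (fun f (J x)) y)
      (≡.trans (cong (c ℚ.*_) (commutesJ f x y)) (≡.sym (J-· c (fun f x) y)))

    ⊛-adjoint : ∀ f g → Adjoint (λ x → fun f (fun g x)) (λ x → fun* g (fun* f x))
    ⊛-adjoint f g x y = ≡.trans (adjoint f (fun g x) y) (adjoint g x (fun* f y))

    ⊛-commutes : ∀ f g → Commutes (λ x → fun f (fun g x))
    ⊛-commutes f g x y = ≡.trans (adjoint f (fun g (J x)) y) (≡.trans (commutesJ g x (fun* f y))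
      (≡.trans (≡.sym (adjoint f (J (fun g x)) y)) (commutesJ f (fun g x) y)))

    †-adjoint : ∀ f → Adjoint (fun* f) (fun f)
    †-adjoint f x y = ≡.trans (⟪⟫-comm (fun* f x) y) (≡.trans (≡.sym (adjoint f y x)) (⟪⟫-comm (fun f y) x))

    †-commutes : ∀ f → Commutes (fun* f)
    †-commutes f x y = ≡.trans (†-adjoint f (J x) y) (≡.trans (J-skew x (fun f y))
      (≡.trans (cong ℚ.-_ (≡.trans (⟪⟫-comm x _) (≡.trans (≡.sym (commutesJ f y x))
        (≡.trans (⟪⟫-comm (fun f (J y)) x) (≡.sym (†-adjoint f x (J y)))))))
      (≡.sym (J-skew (fun* f x) y))))

    J-adjoint : Adjoint J (λ x → (ℚ.- 1ℚ) ·ᵥ J x)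
    J-adjoint x y = ≡.trans (J-skew x y) (≡.trans (solve 1 (λ p → :- p := :- con 1ℚ :* p) refl ⟪ x , J y ⟫)
      (≡.sym (⟪⟫-·ʳ (ℚ.- 1ℚ) (J y) x)))

  _⊹_ : Operator → Operator → Operator
  f ⊹ g = record { fun = λ x → fun f x +ᵥ fun g x ; fun* = λ x → fun* f x +ᵥ fun* g x
                 ; adjoint = ⊹-adjoint f g ; commutesJ = ⊹-commutes f g }

  scaled : ℚ → Operator → Operator
  scaled c f = record { fun = λ x → c ·ᵥ fun f x ; fun* = λ x → c ·ᵥ fun* f x
                      ; adjoint = scaled-adjoint c f ; commutesJ = scaled-commutes c f }

  𝟏ᵒ : Operator
  𝟏ᵒ = record { fun = λ x → x ; fun* = λ x → x ; adjoint = λ _ _ → refl ; commutesJ = λ _ _ → refl }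

  𝟎ᵒ : Operator
  𝟎ᵒ = scaled 0ℚ 𝟏ᵒ

  Jᵒ : Operator
  Jᵒ = record { fun = J ; fun* = λ x → (ℚ.- 1ℚ) ·ᵥ J x ; adjoint = J-adjoint ; commutesJ = λ _ _ → refl }

  _⊛_ : Operator → Operator → Operator
  f ⊛ g = record { fun = λ x → fun f (fun g x) ; fun* = λ x → fun* g (fun* f x)
                 ; adjoint = ⊛-adjoint f g ; commutesJ = ⊛-commutes f g }

  _† : Operator → Operator
  f † = record { fun = fun* f ; fun* = fun f ; adjoint = †-adjoint f ; commutesJ = †-commutes f }

  ⊟_ : Operator → Operator
  ⊟ f = scaled (ℚ.- 1ℚ) f

  _⊖_ : Operator → Operator → Operator
  f ⊖ g = f ⊹ ⊟ g

  ⟪⊖⟫ : ∀ f g x y → ⟪ fun (f ⊖ g) x , y ⟫ ≡ ⟪ fun f x , y ⟫ ℚ.- ⟪ fun g x , y ⟫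
  ⟪⊖⟫ f g x y = ≡.trans (⟪⟫-+ (fun f x) _ y) (cong (⟪ fun f x , y ⟫ ℚ.+_)
    (≡.trans (⟪⟫-· (ℚ.- 1ℚ) (fun g x) y) (solve 1 (λ s → :- con 1ℚ :* s := :- s) refl ⟪ fun g x , y ⟫)))

  -- Says that p is an upper bound of the operator norm, in terms of squares because the norm of a
  -- vector would need a root. Strict positivity of p allows the estimates below to cancel it.
  Bound : Operator → ℚ → Set
  Bound f p = 0ℚ ℚ.< p × (∀ x → ⟪ fun f x , fun f x ⟫ ℚ.≤ p ℚ.* p ℚ.* ⟪ x , x ⟫)

  bound-resp : ∀ {f g p} → f ≐ g → Bound f p → Bound g p
  bound-resp {f} {g} {p} f≐g (0<p , b) = 0<p , λ x → ≡.subst (ℚ._≤ p ℚ.* p ℚ.* ⟪ x , x ⟫)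
    (≡.trans (≐-apply f≐g x (fun f x)) (≡.trans (⟪⟫-comm _ _) (≐-apply f≐g x (fun g x)))) (b x)

  square-mono : ∀ {p q} → 0ℚ ℚ.< p → p ℚ.≤ q → p ℚ.* p ℚ.≤ q ℚ.* q
  square-mono {p} {q} 0<p p≤q = ≤-by (0≤* (0≤gap p≤q) (0≤+ (ℚ.<⇒≤ (ℚ.<-≤-trans 0<p p≤q)) (ℚ.<⇒≤ 0<p)))
    (solve 2 (λ p q → q :* q :- p :* p := (q :- p) :* (q :+ p)) refl p q)

  bound-mono² : ∀ {f c p} → 0ℚ ℚ.< p → (∀ x → ⟪ fun f x , fun f x ⟫ ℚ.≤ c ℚ.* ⟪ x , x ⟫) → c ℚ.≤ p ℚ.* p → Bound f p
  bound-mono² 0<p b c≤p² = 0<p , λ x → ℚ.≤-trans (b x)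
    (ℚ.*-monoʳ-≤-nonNeg ⟪ x , x ⟫ {{ℚ.nonNegative (0≤⟪⟫ x)}} c≤p²)

  bound-mono : ∀ {f p q} → p ℚ.≤ q → Bound f p → Bound f q
  bound-mono {f} p≤q (0<p , b) = bound-mono² {f} (ℚ.<-≤-trans 0<p p≤q) b (square-mono 0<p p≤q)

  bound-𝟎 : ∀ {f p} → f ≐ 𝟎ᵒ → 0ℚ ℚ.< p → Bound f p
  bound-𝟎 {f} {p} f≐0 0<p = 0<p , λ x → ≡.subst (ℚ._≤ p ℚ.* p ℚ.* ⟪ x , x ⟫)
    (≡.sym (≡.trans (≐-apply f≐0 x (fun f x)) (≡.trans (⟪⟫-· 0ℚ x (fun f x)) (ℚ.*-zeroˡ ⟪ x , fun f x ⟫))))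
    (0≤* (0≤p² p) (0≤⟪⟫ x))

  -- After multiplication by 2 p q the gap becomes the squared norm of q y - p z, up to
  -- multiples of the gaps in the hypotheses.
  inner-bound : ∀ {p q X} y z → 0ℚ ℚ.< p → 0ℚ ℚ.< q → ⟪ y , y ⟫ ℚ.≤ p ℚ.* p ℚ.* X →
                ⟪ z , z ⟫ ℚ.≤ q ℚ.* q ℚ.* X → ⟪ y , z ⟫ ℚ.≤ p ℚ.* q ℚ.* X
  inner-bound {p} {q} {X} y z 0<p 0<q y≤ z≤ = cancel-≤ pq (cancel-≤ 0<2 (≤-by
    (0≤+ (≡.subst (0ℚ ℚ.≤_) (norm-combination q (ℚ.- p) y z) (0≤⟪⟫ _))
         (0≤+ (0≤* (0≤p² q) (0≤gap y≤)) (0≤* (0≤p² p) (0≤gap z≤))))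
    (solve 6 (λ p q X F G C →
       (con 1ℚ :+ con 1ℚ) :* (p :* q :* (p :* q :* X)) :- (con 1ℚ :+ con 1ℚ) :* (p :* q :* C)
       := (q :* q :* F :+ (q :* (:- p) :* C :+ q :* (:- p) :* C) :+ (:- p) :* (:- p) :* G)
          :+ (q :* q :* (p :* p :* X :- F) :+ p :* p :* (q :* q :* X :- G))) refl
       p q X ⟪ y , y ⟫ ⟪ z , z ⟫ ⟪ y , z ⟫)))
    where
    pq = 0<* 0<p 0<q
    0<2 : 0ℚ ℚ.< 1ℚ ℚ.+ 1ℚ
    0<2 = ℚ.positive⁻¹ (1ℚ ℚ.+ 1ℚ)

  bound-⊹ : ∀ {f g p q} → Bound f p → Bound g q → Bound (f ⊹ g) (p ℚ.+ q)
  bound-⊹ {f} {g} {p} {q} (0<p , bf) (0<q , bg) = 0<+ 0<p (ℚ.<⇒≤ 0<q) , λ x →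
    let y = fun f x ; z = fun g x
        c≥0 = 0≤gap (inner-bound y z 0<p 0<q (bf x) (bg x))
    in ≤-by (0≤+ (0≤+ (0≤gap (bf x)) (0≤gap (bg x))) (0≤+ c≥0 c≥0))
         (≡.trans (cong (λ s → (p ℚ.+ q) ℚ.* (p ℚ.+ q) ℚ.* ⟪ x , x ⟫ ℚ.- s)
                    (≡.trans (⟪⟫-+ y z _) (cong₂ ℚ._+_ (⟪⟫-+ʳ y z y)
                      (≡.trans (⟪⟫-+ʳ y z z) (cong (ℚ._+ ⟪ z , z ⟫) (⟪⟫-comm z y))))))
           (solve 6 (λ p q X F G C → (p :+ q) :* (p :+ q) :* X :- ((F :+ C) :+ (C :+ G))
             := ((p :* p :* X :- F) :+ (q :* q :* X :- G)) :+ ((p :* q :* X :- C) :+ (p :* q :* X :- C))) refl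
             p q ⟪ x , x ⟫ ⟪ y , y ⟫ ⟪ z , z ⟫ ⟪ y , z ⟫))

  bound-⊛ : ∀ {f g p q} → Bound f p → Bound g q → Bound (f ⊛ g) (p ℚ.* q)
  bound-⊛ {f} {g} {p} {q} (0<p , bf) (0<q , bg) = 0<* 0<p 0<q , λ x → ℚ.≤-trans (bf (fun g x))
    (≤-by (0≤* (0≤p² p) (0≤gap (bg x)))
      (solve 4 (λ p q X G → p :* q :* (p :* q) :* X :- p :* p :* G := p :* p :* (q :* q :* X :- G)) refl
        p q ⟪ x , x ⟫ ⟪ fun g x , fun g x ⟫))

  bound-⊟ : ∀ {f p} → Bound f p → Bound (⊟ f) p
  bound-⊟ {f} {p} (0<p , b) = 0<p , λ x → ≡.subst (ℚ._≤ p ℚ.* p ℚ.* ⟪ x , x ⟫)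
    (≡.sym (≡.trans (⟪⟫-· (ℚ.- 1ℚ) (fun f x) _) (≡.trans (cong ((ℚ.- 1ℚ) ℚ.*_) (⟪⟫-·ʳ (ℚ.- 1ℚ) (fun f x) _))
      (solve 1 (λ s → (:- con 1ℚ) :* ((:- con 1ℚ) :* s) := s) refl ⟪ fun f x , fun f x ⟫)))) (b x)

  -- Since ⟪ x , f f* x ⟫ = ‖f* x‖², expanding ‖p² x - f f* x‖² ≥ 0 gives 2 p² ‖f* x‖² ≤ p⁴ ‖x‖² +
  -- ‖f f* x‖². The last term is at most p² ‖f* x‖² by hypothesis, and p² cancels.
  bound-† : ∀ {f p} → Bound f p → Bound (f †) p
  bound-† {f} {p} (0<p , b) = 0<p , λ x →
    let X = ⟪ x , x ⟫ ; y = fun* f x ; Y = ⟪ y , y ⟫ ; z = fun f y ; Z = ⟪ z , z ⟫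
    in cancel-≤ (0<* 0<p 0<p) (≤-by
         (0≤+ (≡.subst (0ℚ ℚ.≤_) (norm-combination (p ℚ.* p) (ℚ.- 1ℚ) x z) (0≤⟪⟫ _)) (0≤gap (b y)))
         (≡.trans (solve 4 (λ p X Y Z →
              p :* p :* (p :* p :* X) :- p :* p :* Y
           := (p :* p :* (p :* p) :* X :+ (p :* p :* (:- con 1ℚ) :* Y :+ p :* p :* (:- con 1ℚ) :* Y)
               :+ (:- con 1ℚ) :* (:- con 1ℚ) :* Z) :+ (p :* p :* Y :- Z)) refl p X Y Z)
           (cong (λ s → (p ℚ.* p ℚ.* (p ℚ.* p) ℚ.* X ℚ.+ (p ℚ.* p ℚ.* (ℚ.- 1ℚ) ℚ.* s ℚ.+ p ℚ.* p ℚ.* (ℚ.- 1ℚ) ℚ.* s)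
               ℚ.+ (ℚ.- 1ℚ) ℚ.* (ℚ.- 1ℚ) ℚ.* Z) ℚ.+ (p ℚ.* p ℚ.* Y ℚ.- Z))
             (≡.trans (≡.sym (adjoint f y x)) (⟪⟫-comm z x)))))

  -- The substantial half of the C*-identity. Expanding ‖r x - f* f x‖² ≥ 0 gives 2 r ‖f x‖² ≤ r²
  -- ‖x‖² + ‖f* f x‖², whose right side is at most 2 r² ‖x‖².
  bound-†⊛ : ∀ {f r} → Bound (f † ⊛ f) r → ∀ x → ⟪ fun f x , fun f x ⟫ ℚ.≤ r ℚ.* ⟪ x , x ⟫
  bound-†⊛ {f} {r} (0<r , b) x =
    let X = ⟪ x , x ⟫ ; y = fun f x ; Y = ⟪ y , y ⟫ ; z = fun* f y ; Z = ⟪ z , z ⟫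
    in cancel-≤ (0<+ 0<r (ℚ.<⇒≤ 0<r)) (≤-by
         (0≤+ (≡.subst (0ℚ ℚ.≤_) (norm-combination r (ℚ.- 1ℚ) x z) (0≤⟪⟫ _)) (0≤gap (b x)))
         (≡.trans (solve 4 (λ r X Y Z →
              (r :+ r) :* (r :* X) :- (r :+ r) :* Y
           := (r :* r :* X :+ (r :* (:- con 1ℚ) :* Y :+ r :* (:- con 1ℚ) :* Y)
               :+ (:- con 1ℚ) :* (:- con 1ℚ) :* Z) :+ (r :* r :* X :- Z)) refl r X Y Z)
           (cong (λ s → (r ℚ.* r ℚ.* X ℚ.+ (r ℚ.* (ℚ.- 1ℚ) ℚ.* s ℚ.+ r ℚ.* (ℚ.- 1ℚ) ℚ.* s)
               ℚ.+ (ℚ.- 1ℚ) ℚ.* (ℚ.- 1ℚ) ℚ.* Z) ℚ.+ (r ℚ.* r ℚ.* X ℚ.- Z))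
             (adjoint f x y))))

  scalar : ℚ → ℚ → Operator
  scalar a b = scaled a 𝟏ᵒ ⊹ scaled b Jᵒ

  norm-scalar : ∀ a b f x → ⟪ fun (scalar a b ⊛ f) x , fun (scalar a b ⊛ f) x ⟫
                          ≡ (a ℚ.* a ℚ.+ b ℚ.* b) ℚ.* ⟪ fun f x , fun f x ⟫
  norm-scalar a b f x = ≡.trans (norm-combination a b y (J y)) (≡.trans
    (cong₂ (λ s t → a ℚ.* a ℚ.* Y ℚ.+ (a ℚ.* b ℚ.* s ℚ.+ a ℚ.* b ℚ.* s) ℚ.+ b ℚ.* b ℚ.* t)
      (≡.trans (⟪⟫-comm y (J y)) (⟪Jx,x⟫≡0 y)) (J-isometry y y))
    (solve 3 (λ a b Y → a :* a :* Y :+ (a :* b :* con 0ℚ :+ a :* b :* con 0ℚ) :+ b :* b :* Y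
       := (a :* a :+ b :* b) :* Y) refl a b Y))
    where
    y = fun f x
    Y = ⟪ y , y ⟫

  bound-scalar : ∀ {a b p} → 0ℚ ℚ.< p → a ℚ.* a ℚ.+ b ℚ.* b ℚ.≤ p ℚ.* p → Bound (scalar a b) p
  bound-scalar {a} {b} 0<p le = bound-mono² {scalar a b} 0<p
    (λ x → ℚ.≤-reflexive (norm-scalar a b 𝟏ᵒ x)) le

  hasBound : ∀ f → ∃[ p ] Bound f p
  -- Here c bounds the square of the norm; its root is avoided because c ≤ (1 + |c|)².
  hasBound f = let c , b = bounded (fun f) (fun* f) (adjoint f) ; d = 1ℚ ℚ.+ ℚ.∣ c ∣ in
    d , bound-mono² {f} (0<+ 0<1 (ℚ.0≤∣p∣ c)) b (ℚ.≤-trans (p≤∣p∣ c) (≤-by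
      (0≤+ (0≤+ (ℚ.<⇒≤ 0<1) (ℚ.0≤∣p∣ c)) (0≤p² ℚ.∣ c ∣))
      (solve 1 (λ c → (con 1ℚ :+ c) :* (con 1ℚ :+ c) :- c := (con 1ℚ :+ c) :+ c :* c) refl ℚ.∣ c ∣)))

  -- A descent from K that stops above the first failure. Being minimal among neighbours suffices,
  -- because `Bound f` is monotone.
  least : ∀ {P : ℕ → Set} → (∀ k → Dec (P k)) → ∀ {K} → P K →
          ∃[ k ] P k × (k ≡ 0 ⊎ ∃[ j ] k ≡ suc j × ¬ P j)
  least P? {zero}  p = 0 , p , inj₁ refl
  least P? {suc K} p with P? K
  ... | yes q = least P? q
  ... | no ¬q = suc K , p , inj₂ (K , refl , ¬q)

  abstract
    bound-grid? : ∀ n f k → Dec (Bound f (grid n k))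
    bound-grid? n f k = map′ (0<grid n k ,_) proj₂
      (bound? (fun f) (fun* f) (adjoint f) (grid n k ℚ.* grid n k))

    -- The least multiple of 1/(n+1) bounding f: an approximation of the operator norm.
    approxNorm : ∀ n f → ∃[ p ] Bound f p × (∀ q → Bound f q → p ℚ.≤ q ℚ.+ δ n)
    approxNorm n f =
      let p , b = hasBound f
          K , p≤ = grid-unbounded n p
          k , bk , minimal = least (bound-grid? n f) {K} (bound-mono {f} p≤ b)
      in grid n k , bk , λ q bq → [ zeroCase q bq , sucCase q bq ]′ minimal
      where
      zeroCase : ∀ {k} q → Bound f q → k ≡ 0 → grid n k ℚ.≤ q ℚ.+ δ n
      zeroCase q (0<q , _) refl = ≡.subst (ℚ._≤ q ℚ.+ δ n)
        (≡.trans (ℚ.+-identityˡ (δ n)) (≡.sym (grid-zero n))) (ℚ.+-monoˡ-≤ (δ n) (ℚ.<⇒≤ 0<q))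
      sucCase : ∀ {k} q → Bound f q → (∃[ j ] k ≡ suc j × ¬ Bound f (grid n j)) → grid n k ℚ.≤ q ℚ.+ δ n
      sucCase q bq (j , refl , ¬bj) = ≡.subst (ℚ._≤ q ℚ.+ δ n) (≡.sym (grid-suc n j))
        (ℚ.+-monoˡ-≤ (δ n) (ℚ.<⇒≤ (ℚ.≰⇒> (λ q≤ → ¬bj (bound-mono {f} q≤ bq)))))

  ν : ℕ → Operator → ℚ
  ν n f = proj₁ (approxNorm n f)

  ν-bound : ∀ n f → Bound f (ν n f)
  ν-bound n f = proj₁ (proj₂ (approxNorm n f))

  0<ν : ∀ n f → 0ℚ ℚ.< ν n f
  0<ν n f = proj₁ (ν-bound n f)

  ν-least : ∀ n f {q} → Bound f q → ν n f ℚ.≤ q ℚ.+ δ n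
  ν-least n f {q} = proj₂ (proj₂ (approxNorm n f)) q

-- Estimates for constructive reals

⊔ˡ : ∀ m n {k} → m ⊔ n ℕ.≤ k → m ℕ.≤ k
⊔ˡ m n = ℕ.≤-trans (ℕ.m≤m⊔n m n)

⊔ʳ : ∀ m n {k} → m ⊔ n ℕ.≤ k → n ℕ.≤ k
⊔ʳ m n = ℕ.≤-trans (ℕ.m≤n⊔m m n)

0<½* : ∀ {ε} → 0ℚ ℚ.< ε → 0ℚ ℚ.< ½ ℚ.* ε
0<½* = 0<* 0<½

½+½ : ∀ ε → ½ ℚ.* ε ℚ.+ ½ ℚ.* ε ≡ ε
½+½ = solve 1 (λ ε → con ½ :* ε :+ con ½ :* ε := ε) refl

∣p∣≤q : ∀ {p q} → p ℚ.≤ q → ℚ.- q ℚ.≤ p → ℚ.∣ p ∣ ℚ.≤ q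
∣p∣≤q {p} {q} p≤q -q≤p with ℚ.∣p∣≡p∨∣p∣≡-p p
... | inj₁ eq = ≡.subst (ℚ._≤ q) (≡.sym eq) p≤q
... | inj₂ eq = ≡.subst (ℚ._≤ q) (≡.sym eq)
  (≡.subst (ℚ.- p ℚ.≤_) (solve 1 (λ q → :- (:- q) := q) refl q) (ℚ.neg-antimono-≤ -q≤p))

∣p-q∣≤ : ∀ {p q ε} → p ℚ.≤ q ℚ.+ ε → q ℚ.≤ p ℚ.+ ε → ℚ.∣ p ℚ.- q ∣ ℚ.≤ ε
∣p-q∣≤ {p} {q} {ε} p≤ q≤ = ∣p∣≤q
  (≤-by (0≤gap p≤) (solve 3 (λ p q e → e :- (p :- q) := q :+ e :- p) refl p q ε))
  (≤-by (0≤gap q≤) (solve 3 (λ p q e → (p :- q) :- :- e := p :+ e :- q) refl p q ε))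

∣p∣²≡p² : ∀ p → ℚ.∣ p ∣ ℚ.* ℚ.∣ p ∣ ≡ p ℚ.* p
∣p∣²≡p² p with ℚ.∣p∣≡p∨∣p∣≡-p p
... | inj₁ eq = cong₂ ℚ._*_ eq eq
... | inj₂ eq = ≡.trans (cong₂ ℚ._*_ eq eq) (solve 1 (λ p → (:- p) :* (:- p) := p :* p) refl p)

quotient : ∀ {B ε} → 0ℚ ℚ.< B → 0ℚ ℚ.< ε → ∃[ η ] 0ℚ ℚ.< η × B ℚ.* η ≡ ε
quotient {B} {ε} 0<B 0<ε = ℚ.1/ B ℚ.* ε , 0<* (ℚ.positive⁻¹ (ℚ.1/ B) {{ℚ.1/pos⇒pos B {{ℚ.positive 0<B}}}}) 0<ε ,
  ≡.trans (≡.sym (ℚ.*-assoc B (ℚ.1/ B) ε)) (≡.trans (cong (ℚ._* ε) (ℚ.*-inverseʳ B)) (ℚ.*-identityˡ ε))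
  where
  instance
    B-nz : ℚ.NonZero B
    B-nz = ℚ.pos⇒nonZero B {{ℚ.positive 0<B}}

seq-bounded : ∀ x → ∃[ B ] 0ℚ ℚ.< B × ∃[ N ] ∀ n → N ℕ.≤ n → seq x n ℚ.≤ B
seq-bounded x with cauchy x 1ℚ 0<1
... | N , close = 1ℚ ℚ.+ ℚ.∣ seq x N ∣ , 0<+ 0<1 (ℚ.0≤∣p∣ (seq x N)) , N , λ n N≤n →
  ≤-by (0≤+ (0≤gap (ℚ.≤-trans (p≤∣p∣ (seq x n ℚ.- seq x N)) (close n N N≤n ℕ.≤-refl))) (0≤gap (p≤∣p∣ (seq x N))))
    (solve 3 (λ a b c → (con 1ℚ :+ c) :- a := (con 1ℚ :- (a :- b)) :+ (c :- b)) refl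
      (seq x n) (seq x N) ℚ.∣ seq x N ∣)

δ*-small : ∀ b ε → 0ℚ ℚ.< ε → ∃[ N ] ∀ n → N ℕ.≤ n → δ n ℚ.* seq b n ℚ.≤ ε
δ*-small b ε 0<ε =
  let B , 0<B , M , b≤B = seq-bounded b
      η , 0<η , Bη = quotient 0<B 0<ε
      N , δ≤η = δ-small η 0<η
  in M ⊔ N , λ n n≥ → ≡.subst (δ n ℚ.* seq b n ℚ.≤_) Bη (≤-by
       (0≤+ (0≤* (ℚ.<⇒≤ (0<δ n)) (0≤gap (b≤B n (⊔ˡ M N n≥))))
            (0≤* (ℚ.<⇒≤ 0<B) (0≤gap (δ≤η n (⊔ʳ M N n≥)))))
       (solve 4 (λ d b B η → B :* η :- d :* b := d :* (B :- b) :+ B :* (η :- d)) refl (δ n) (seq b n) B η))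

-- The approximate norms satisfy their inequalities only up to a multiple of δ n. The multiplier may
-- itself be a real b, since its terms are eventually bounded.
≤ℝ-δ : ∀ {x y} b → (∀ n → seq x n ℚ.≤ seq y n ℚ.+ δ n ℚ.* seq b n) → x ≤ℝ y
≤ℝ-δ {x} {y} b le ε 0<ε = let N , small = δ*-small b ε 0<ε in
  N , λ n n≥ → ℚ.≤-trans (le n) (ℚ.+-monoʳ-≤ (seq y n) (small n n≥))

≃ℝ-δ : ∀ {x y} b c → (∀ n → seq x n ℚ.≤ seq y n ℚ.+ δ n ℚ.* seq b n) →
       (∀ n → seq y n ℚ.≤ seq x n ℚ.+ δ n ℚ.* seq c n) → x ≃ℝ y
≃ℝ-δ {x} {y} b c le ge ε 0<ε =
  let M , x≤ = ≤ℝ-δ {x} {y} b le ε 0<ε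
      N , y≤ = ≤ℝ-δ {y} {x} c ge ε 0<ε
  in M ⊔ N , λ n n≥ → ∣p-q∣≤ (x≤ n (⊔ˡ M N n≥)) (y≤ n (⊔ʳ M N n≥))

-- If every p > 0 with s ≤ c p² satisfies v ≤ p + d, then v is at most √(s/c) + d.  The square
-- root is avoided by testing p = v - 2 d.
sqrt-estimate : ∀ {c s v d} → 0ℚ ℚ.≤ c → 0ℚ ℚ.≤ s → 0ℚ ℚ.≤ v → 0ℚ ℚ.< d →
  (∀ p → 0ℚ ℚ.< p → s ℚ.≤ c ℚ.* (p ℚ.* p) → v ℚ.≤ p ℚ.+ d) →
  c ℚ.* (v ℚ.* v) ℚ.≤ s ℚ.+ d ℚ.* ((1ℚ ℚ.+ 1ℚ ℚ.+ 1ℚ ℚ.+ 1ℚ) ℚ.* (c ℚ.* v))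
sqrt-estimate {c} {s} {v} {d} 0≤c 0≤s 0≤v 0<d h with (v ℚ.- (d ℚ.+ d)) ℚ.≤? 0ℚ
... | yes p≤0 = ≤-by (0≤+ 0≤s (0≤+ (0≤* (0≤* 0≤c 0≤v) (0≤gap p≤0)) (0≤* (0≤+ (ℚ.<⇒≤ 0<d) (ℚ.<⇒≤ 0<d)) (0≤* 0≤c 0≤v))))
  (solve 4 (λ c s v d → s :+ d :* ((con 1ℚ :+ con 1ℚ :+ con 1ℚ :+ con 1ℚ) :* (c :* v)) :- c :* (v :* v)
     := s :+ (c :* v :* (con 0ℚ :- (v :- (d :+ d))) :+ (d :+ d) :* (c :* v))) refl c s v d)
... | no p≰0 with s ℚ.≤? c ℚ.* ((v ℚ.- (d ℚ.+ d)) ℚ.* (v ℚ.- (d ℚ.+ d)))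
...   | yes s≤ = contradiction (h _ (ℚ.≰⇒> p≰0) s≤)
          (<⇒≱ (<-by 0<d (solve 2 (λ v d → v :- (v :- (d :+ d) :+ d) := d) refl v d)))
...   | no s≰ = ≤-by (0≤+ (0≤gap (ℚ.<⇒≤ (ℚ.≰⇒> s≰)))
                  (0≤* 0≤c (0≤p² (d ℚ.+ d))))
  (solve 4 (λ c s v d → s :+ d :* ((con 1ℚ :+ con 1ℚ :+ con 1ℚ :+ con 1ℚ) :* (c :* v)) :- c :* (v :* v)
     := (s :- c :* ((v :- (d :+ d)) :* (v :- (d :+ d)))) :+ c :* ((d :+ d) :* (d :+ d))) refl c s v d)

-- Cauchy sequences of operators

module Completion (S : ComplexSpace) where
  open ComplexSpace S
  open Operators S
  open Operator
  open _≐_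

  ⟪⊹⟫ : ∀ f g x y → ⟪ fun (f ⊹ g) x , y ⟫ ≡ ⟪ fun f x , y ⟫ ℚ.+ ⟪ fun g x , y ⟫
  ⟪⊹⟫ f g x y = ⟪⟫-+ (fun f x) (fun g x) y

  ⟪⊟⟫ : ∀ f x y → ⟪ fun (⊟ f) x , y ⟫ ≡ ℚ.- ⟪ fun f x , y ⟫
  ⟪⊟⟫ f x y = ≡.trans (⟪⟫-· (ℚ.- 1ℚ) (fun f x) y)
    (solve 1 (λ s → :- con 1ℚ :* s := :- s) refl ⟪ fun f x , y ⟫)

  ⟪𝟎⟫ : ∀ x y → ⟪ fun 𝟎ᵒ x , y ⟫ ≡ 0ℚ
  ⟪𝟎⟫ x y = ≡.trans (⟪⟫-· 0ℚ x y) (ℚ.*-zeroˡ ⟪ x , y ⟫)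

  ⟪scalar⟫ : ∀ a b x y → ⟪ fun (scalar a b) x , y ⟫ ≡ a ℚ.* ⟪ x , y ⟫ ℚ.+ b ℚ.* ⟪ J x , y ⟫
  ⟪scalar⟫ a b x y = ≡.trans (⟪⟫-+ (a ·ᵥ x) (b ·ᵥ J x) y) (cong₂ ℚ._+_ (⟪⟫-· a x y) (⟪⟫-· b (J x) y))

  ⊖-triangle : ∀ f g h → (f ⊖ g) ⊹ (g ⊖ h) ≐ f ⊖ h
  ⊖-triangle f g h = ext λ x y → ≡.trans (⟪⊹⟫ (f ⊖ g) (g ⊖ h) x y)
    (≡.trans (cong₂ ℚ._+_ (⟪⊖⟫ f g x y) (⟪⊖⟫ g h x y))
    (≡.trans (solve 3 (λ a b c → (a :- b) :+ (b :- c) := a :- c) refl ⟪ fun f x , y ⟫ ⟪ fun g x , y ⟫ ⟪ fun h x , y ⟫)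
      (≡.sym (⟪⊖⟫ f h x y))))

  ⊖-⊹ : ∀ f g f′ g′ → (f ⊖ f′) ⊹ (g ⊖ g′) ≐ (f ⊹ g) ⊖ (f′ ⊹ g′)
  ⊖-⊹ f g f′ g′ = ext λ x y → ≡.trans (⟪⊹⟫ (f ⊖ f′) (g ⊖ g′) x y)
    (≡.trans (cong₂ ℚ._+_ (⟪⊖⟫ f f′ x y) (⟪⊖⟫ g g′ x y))
    (≡.trans (solve 4 (λ a b c d → (a :- b) :+ (c :- d) := (a :+ c) :- (b :+ d)) refl
               ⟪ fun f x , y ⟫ ⟪ fun f′ x , y ⟫ ⟪ fun g x , y ⟫ ⟪ fun g′ x , y ⟫)
      (≡.sym (≡.trans (⟪⊖⟫ (f ⊹ g) (f′ ⊹ g′) x y) (cong₂ ℚ._-_ (⟪⊹⟫ f g x y) (⟪⊹⟫ f′ g′ x y))))))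

  ⊖-⊟ : ∀ f g → ⊟ (f ⊖ g) ≐ ⊟ f ⊖ ⊟ g
  ⊖-⊟ f g = ext λ x y → ≡.trans (⟪⊟⟫ (f ⊖ g) x y) (≡.trans (cong ℚ.-_ (⟪⊖⟫ f g x y))
    (≡.trans (solve 2 (λ a b → :- (a :- b) := :- a :- :- b) refl ⟪ fun f x , y ⟫ ⟪ fun g x , y ⟫)
      (≡.sym (≡.trans (⟪⊖⟫ (⊟ f) (⊟ g) x y) (cong₂ ℚ._-_ (⟪⊟⟫ f x y) (⟪⊟⟫ g x y))))))

  ⊖-swap : ∀ f g → ⊟ (f ⊖ g) ≐ g ⊖ f
  ⊖-swap f g = ext λ x y → ≡.trans (⟪⊟⟫ (f ⊖ g) x y) (≡.trans (cong ℚ.-_ (⟪⊖⟫ f g x y))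
    (≡.trans (solve 2 (λ a b → :- (a :- b) := b :- a) refl ⟪ fun f x , y ⟫ ⟪ fun g x , y ⟫)
      (≡.sym (⟪⊖⟫ g f x y))))

  ⊖-⊛ : ∀ f g f′ g′ → (f ⊛ (g ⊖ g′)) ⊹ ((f ⊖ f′) ⊛ g′) ≐ (f ⊛ g) ⊖ (f′ ⊛ g′)
  ⊖-⊛ f g f′ g′ = ext λ x y → ≡.trans (⟪⊹⟫ (f ⊛ (g ⊖ g′)) ((f ⊖ f′) ⊛ g′) x y)
    (≡.trans (cong₂ ℚ._+_
      (≡.trans (adjoint f _ y) (≡.trans (⟪⊖⟫ g g′ x (fun* f y))
        (cong₂ ℚ._-_ (≡.sym (adjoint f (fun g x) y)) (≡.sym (adjoint f (fun g′ x) y)))))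
      (⟪⊖⟫ f f′ (fun g′ x) y))
    (≡.trans (solve 3 (λ a b c → (a :- b) :+ (b :- c) := a :- c) refl
       ⟪ fun f (fun g x) , y ⟫ ⟪ fun f (fun g′ x) , y ⟫ ⟪ fun f′ (fun g′ x) , y ⟫)
      (≡.sym (⟪⊖⟫ (f ⊛ g) (f′ ⊛ g′) x y))))

  ⊖-cancel : ∀ f g → (f ⊖ g) ⊹ g ≐ f
  ⊖-cancel f g = ext λ x y → ≡.trans (⟪⊹⟫ (f ⊖ g) g x y) (≡.trans (cong (ℚ._+ ⟪ fun g x , y ⟫) (⟪⊖⟫ f g x y))
    (solve 2 (λ a b → (a :- b) :+ b := a) refl ⟪ fun f x , y ⟫ ⟪ fun g x , y ⟫))

  ⊖-zero : ∀ {f g} → f ≐ g → f ⊖ g ≐ 𝟎ᵒ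
  ⊖-zero {f} {g} f≐g = ext λ x y → ≡.trans (⟪⊖⟫ f g x y) (≡.trans (cong (ℚ._- ⟪ fun g x , y ⟫) (≐-apply f≐g x y))
    (≡.trans (ℚ.+-inverseʳ ⟪ fun g x , y ⟫) (≡.sym (⟪𝟎⟫ x y))))

  ⊖-𝟎 : ∀ f → f ⊖ 𝟎ᵒ ≐ f
  ⊖-𝟎 f = ext λ x y → ≡.trans (⟪⊖⟫ f 𝟎ᵒ x y) (≡.trans (cong (λ s → ⟪ fun f x , y ⟫ ℚ.- s) (⟪𝟎⟫ x y))
    (solve 1 (λ a → a :- con 0ℚ := a) refl ⟪ fun f x , y ⟫))

  ⊖-scalar : ∀ a b c d → scalar (a ℚ.- c) (b ℚ.- d) ≐ scalar a b ⊖ scalar c d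
  ⊖-scalar a b c d = ext λ x y → ≡.trans (⟪scalar⟫ (a ℚ.- c) (b ℚ.- d) x y)
    (≡.trans (solve 6 (λ a b c d p q → (a :- c) :* p :+ (b :- d) :* q := (a :* p :+ b :* q) :- (c :* p :+ d :* q)) refl
       a b c d ⟪ x , y ⟫ ⟪ J x , y ⟫)
      (≡.sym (≡.trans (⟪⊖⟫ (scalar a b) (scalar c d) x y) (cong₂ ℚ._-_ (⟪scalar⟫ a b x y) (⟪scalar⟫ c d x y)))))

  scalar-⊹ : ∀ a b c d → scalar (a ℚ.+ c) (b ℚ.+ d) ≐ scalar a b ⊹ scalar c d
  scalar-⊹ a b c d = ext λ x y → ≡.trans (⟪scalar⟫ (a ℚ.+ c) (b ℚ.+ d) x y)
    (≡.trans (solve 6 (λ a b c d p q → (a :+ c) :* p :+ (b :+ d) :* q := (a :* p :+ b :* q) :+ (c :* p :+ d :* q)) refl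
       a b c d ⟪ x , y ⟫ ⟪ J x , y ⟫)
      (≡.sym (≡.trans (⟪⊹⟫ (scalar a b) (scalar c d) x y) (cong₂ ℚ._+_ (⟪scalar⟫ a b x y) (⟪scalar⟫ c d x y)))))

  scalar-central : ∀ a b f → scalar a b ⊛ f ≐ f ⊛ scalar a b
  scalar-central a b f = ext λ x y → ≡.trans (⟪scalar⟫ a b (fun f x) y)
    (≡.sym (≡.trans (linear-+ f (a ·ᵥ x) (b ·ᵥ J x) y) (cong₂ ℚ._+_ (linear-· f a x y)
      (≡.trans (linear-· f b (J x) y) (cong (b ℚ.*_) (commutesJ f x y))))))

  scalar-⊛ : ∀ a b c d → scalar (a ℚ.* c ℚ.+ ℚ.- (b ℚ.* d)) (a ℚ.* d ℚ.+ b ℚ.* c) ≐ scalar a b ⊛ scalar c d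
  scalar-⊛ a b c d = ext λ x y →
    ≡.trans (⟪scalar⟫ (a ℚ.* c ℚ.+ ℚ.- (b ℚ.* d)) (a ℚ.* d ℚ.+ b ℚ.* c) x y)
    (≡.trans (solve 6 (λ a b c d p q →
        (a :* c :+ :- (b :* d)) :* p :+ (a :* d :+ b :* c) :* q
        := a :* (c :* p :+ d :* q) :+ b :* (c :* q :+ d :* (:- p))) refl a b c d ⟪ x , y ⟫ ⟪ J x , y ⟫)
      (≡.sym (≡.trans (⟪scalar⟫ a b (fun (scalar c d) x) y)
        (cong₂ (λ s t → a ℚ.* s ℚ.+ b ℚ.* t) (⟪scalar⟫ c d x y)
          (≡.trans (≡.sym (commutesJ (scalar c d) x y)) (≡.trans (⟪scalar⟫ c d (J x) y)
            (cong (λ s → c ℚ.* ⟪ J x , y ⟫ ℚ.+ d ℚ.* s) (J²≡-1 x y))))))))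

  scalar-† : ∀ a b → scalar a (ℚ.- b) ≐ scalar a b †
  scalar-† a b = ext λ x y → ≡.trans (⟪scalar⟫ a (ℚ.- b) x y)
    (≡.trans (solve 4 (λ a b p q → a :* p :+ (:- b) :* q := a :* p :+ b :* ((:- con 1ℚ) :* q)) refl
       a b ⟪ x , y ⟫ ⟪ J x , y ⟫)
      (≡.sym (≡.trans (⟪⟫-+ (a ·ᵥ x) (b ·ᵥ fun* Jᵒ x) y) (cong₂ ℚ._+_ (⟪⟫-· a x y)
        (≡.trans (⟪⟫-· b (fun* Jᵒ x) y) (cong (b ℚ.*_) (⟪⟫-· (ℚ.- 1ℚ) (J x) y)))))))

  scalar-0 : scalar 0ℚ 0ℚ ≐ 𝟎ᵒ
  scalar-0 = ext λ x y → ≡.trans (⟪scalar⟫ 0ℚ 0ℚ x y)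
    (≡.trans (solve 2 (λ p q → con 0ℚ :* p :+ con 0ℚ :* q := con 0ℚ) refl ⟪ x , y ⟫ ⟪ J x , y ⟫) (≡.sym (⟪𝟎⟫ x y)))

  scalar-1 : scalar 1ℚ 0ℚ ≐ 𝟏ᵒ
  scalar-1 = ext λ x y → ≡.trans (⟪scalar⟫ 1ℚ 0ℚ x y)
    (solve 2 (λ p q → con 1ℚ :* p :+ con 0ℚ :* q := p) refl ⟪ x , y ⟫ ⟪ J x , y ⟫)

  ⊹-comm : ∀ f g → f ⊹ g ≐ g ⊹ f
  ⊹-comm f g = ext λ x y → ≡.trans (⟪⊹⟫ f g x y) (≡.trans (ℚ.+-comm ⟪ fun f x , y ⟫ ⟪ fun g x , y ⟫) (≡.sym (⟪⊹⟫ g f x y)))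

  ⊹-assoc : ∀ f g h → (f ⊹ g) ⊹ h ≐ f ⊹ (g ⊹ h)
  ⊹-assoc f g h = ext λ x y → ≡.trans (⟪⊹⟫ (f ⊹ g) h x y) (≡.trans (cong (ℚ._+ ⟪ fun h x , y ⟫) (⟪⊹⟫ f g x y))
    (≡.trans (ℚ.+-assoc ⟪ fun f x , y ⟫ ⟪ fun g x , y ⟫ ⟪ fun h x , y ⟫) (≡.sym (≡.trans (⟪⊹⟫ f (g ⊹ h) x y) (cong (⟪ fun f x , y ⟫ ℚ.+_) (⟪⊹⟫ g h x y))))))

  ⊹-identityˡ : ∀ f → 𝟎ᵒ ⊹ f ≐ f
  ⊹-identityˡ f = ext λ x y → ≡.trans (⟪⊹⟫ 𝟎ᵒ f x y)
    (≡.trans (cong (ℚ._+ ⟪ fun f x , y ⟫) (⟪𝟎⟫ x y)) (ℚ.+-identityˡ _))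

  ⊹-inverseʳ : ∀ f → f ⊹ ⊟ f ≐ 𝟎ᵒ
  ⊹-inverseʳ f = ⊖-zero ≐-refl

  ⊛-distribˡ : ∀ f g h → f ⊛ (g ⊹ h) ≐ f ⊛ g ⊹ f ⊛ h
  ⊛-distribˡ f g h = ext λ x y → ≡.trans (linear-+ f (fun g x) (fun h x) y) (≡.sym (⟪⊹⟫ (f ⊛ g) (f ⊛ h) x y))

  bound-close-⊹ : ∀ {f g f′ g′} ε → Bound (f ⊖ f′) (½ ℚ.* ε) → Bound (g ⊖ g′) (½ ℚ.* ε) → Bound ((f ⊹ g) ⊖ (f′ ⊹ g′)) ε
  bound-close-⊹ {f} {g} {f′} {g′} ε bf bg = ≡.subst (Bound ((f ⊹ g) ⊖ (f′ ⊹ g′))) (½+½ ε)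
    (bound-resp (⊖-⊹ f g f′ g′) (bound-⊹ {f ⊖ f′} {g ⊖ g′} bf bg))

  bound-close-trans : ∀ {f g h} ε → Bound (f ⊖ g) (½ ℚ.* ε) → Bound (g ⊖ h) (½ ℚ.* ε) → Bound (f ⊖ h) ε
  bound-close-trans {f} {g} {h} ε bf bg = ≡.subst (Bound (f ⊖ h)) (½+½ ε)
    (bound-resp (⊖-triangle f g h) (bound-⊹ {f ⊖ g} {g ⊖ h} bf bg))

  bound-close-⊛ : ∀ {f g f′ g′ a b η ε} → Bound f a → Bound g′ b → (a ℚ.+ b) ℚ.* η ≡ ε →
    Bound (f ⊖ f′) η → Bound (g ⊖ g′) η → Bound ((f ⊛ g) ⊖ (f′ ⊛ g′)) ε
  bound-close-⊛ {f} {g} {f′} {g′} {a} {b} {η} bf bg eq cf cg = ≡.subst (Bound ((f ⊛ g) ⊖ (f′ ⊛ g′)))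
    (≡.trans (solve 3 (λ a b η → a :* η :+ η :* b := (a :+ b) :* η) refl a b η) eq)
    (bound-resp (⊖-⊛ f g f′ g′)
      (bound-⊹ {f ⊛ (g ⊖ g′)} {(f ⊖ f′) ⊛ g′} (bound-⊛ {f} {g ⊖ g′} bf cg) (bound-⊛ {f ⊖ f′} {g′} cf bg)))

  bound-swap : ∀ {f g p} → Bound (f ⊖ g) p → Bound (g ⊖ f) p
  bound-swap {f} {g} b = bound-resp (⊖-swap f g) (bound-⊟ {f ⊖ g} b)

  bound-⊖-resp : ∀ {f g p q} → Bound g p → Bound (f ⊖ g) q → Bound f (p ℚ.+ q)
  bound-⊖-resp {f} {g} {p} {q} bg bfg = ≡.subst (Bound f) (ℚ.+-comm q p)
    (bound-resp (⊖-cancel f g) (bound-⊹ {f ⊖ g} {g} bfg bg))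

  ν-close : ∀ m n {f g ε} → Bound (f ⊖ g) ε → ν n f ℚ.≤ ν m g ℚ.+ ε ℚ.+ δ n
  ν-close m n {f} {g} b = ν-least n f (bound-⊖-resp {f} {g} (ν-bound m g) b)

  -- Formulated with rational bounds, since the real-valued norm is only obtained later from these
  -- sequences.
  IsCauchyᵒ : (ℕ → Operator) → Set
  IsCauchyᵒ f = ∀ ε → 0ℚ ℚ.< ε → ∃[ N ] ∀ m n → N ℕ.≤ m → N ℕ.≤ n → Bound (f m ⊖ f n) ε

  record Element : Set where
    constructor element
    field
      term    : ℕ → Operator
      cauchyᵒ : IsCauchyᵒ term

  open Element

  infix 4 _≈_

  record _≈_ (a b : Element) : Set where
    constructor close
    field
      eventually : ∀ ε → 0ℚ ℚ.< ε → ∃[ N ] ∀ n → N ℕ.≤ n → Bound (term a n ⊖ term b n) ε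

  open _≈_

  pointwise : ∀ {a b} → (∀ n → term a n ≐ term b n) → a ≈ b
  pointwise p = close λ ε 0<ε → 0 , λ n _ → bound-𝟎 (⊖-zero (p n)) 0<ε

  ≈-sym : ∀ {a b} → a ≈ b → b ≈ a
  ≈-sym {a} {b} p = close λ ε 0<ε → let N , c = eventually p ε 0<ε in
    N , λ n n≥ → bound-swap {term a n} {term b n} (c n n≥)

  ≈-trans : ∀ {a b c} → a ≈ b → b ≈ c → a ≈ c
  ≈-trans {a} {b} {c} p q = close λ ε 0<ε →
    let M , c₁ = eventually p (½ ℚ.* ε) (0<½* 0<ε)
        N , c₂ = eventually q (½ ℚ.* ε) (0<½* 0<ε)
    in M ⊔ N , λ n n≥ → bound-close-trans {term a n} {term b n} {term c n} ε
         (c₁ n (⊔ˡ M N n≥)) (c₂ n (⊔ʳ M N n≥))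

  abstract
    constant-cauchy : ∀ f → IsCauchyᵒ (λ _ → f)
    constant-cauchy f ε 0<ε = 0 , λ _ _ _ _ → bound-𝟎 (⊖-zero (≐-refl {f})) 0<ε

  constant : Operator → Element
  constant f = element (λ _ → f) (constant-cauchy f)

  infixl 6 _+ᶜ_
  infixl 7 _*ᶜ_
  infix  8 -ᶜ_
  infix  9 _⋆ᶜ

  abstract
    +ᶜ-cauchy : ∀ a b → IsCauchyᵒ (λ n → term a n ⊹ term b n)
    +ᶜ-cauchy a b ε 0<ε =
      let M , c₁ = cauchyᵒ a (½ ℚ.* ε) (0<½* 0<ε)
          N , c₂ = cauchyᵒ b (½ ℚ.* ε) (0<½* 0<ε)
      in M ⊔ N , λ m n m≥ n≥ → bound-close-⊹ {term a m} {term b m} {term a n} {term b n} ε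
           (c₁ m n (⊔ˡ M N m≥) (⊔ˡ M N n≥))
           (c₂ m n (⊔ʳ M N m≥) (⊔ʳ M N n≥))

  _+ᶜ_ : Element → Element → Element
  a +ᶜ b = element (λ n → term a n ⊹ term b n) (+ᶜ-cauchy a b)

  +ᶜ-cong : ∀ {a a′ b b′} → a ≈ a′ → b ≈ b′ → a +ᶜ b ≈ a′ +ᶜ b′
  +ᶜ-cong {a} {a′} {b} {b′} p q = close λ ε 0<ε →
    let M , c₁ = eventually p (½ ℚ.* ε) (0<½* 0<ε)
        N , c₂ = eventually q (½ ℚ.* ε) (0<½* 0<ε)
    in M ⊔ N , λ n n≥ → bound-close-⊹ {term a n} {term b n} {term a′ n} {term b′ n} ε
         (c₁ n (⊔ˡ M N n≥)) (c₂ n (⊔ʳ M N n≥))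

  abstract
    -ᶜ-cauchy : ∀ a → IsCauchyᵒ (λ n → ⊟ term a n)
    -ᶜ-cauchy a ε 0<ε = let N , c = cauchyᵒ a ε 0<ε in
      N , λ m n m≥ n≥ → bound-resp (⊖-⊟ (term a m) (term a n)) (bound-⊟ {term a m ⊖ term a n} (c m n m≥ n≥))

  -ᶜ_ : Element → Element
  -ᶜ a = element (λ n → ⊟ term a n) (-ᶜ-cauchy a)

  -ᶜ-cong : ∀ {a b} → a ≈ b → -ᶜ a ≈ -ᶜ b
  -ᶜ-cong {a} {b} p = close λ ε 0<ε → let N , c = eventually p ε 0<ε in
    N , λ n n≥ → bound-resp (⊖-⊟ (term a n) (term b n)) (bound-⊟ {term a n ⊖ term b n} (c n n≥))

  abstract
    ⋆ᶜ-cauchy : ∀ a → IsCauchyᵒ (λ n → term a n †)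
    ⋆ᶜ-cauchy a ε 0<ε = let N , c = cauchyᵒ a ε 0<ε in
      N , λ m n m≥ n≥ → bound-resp {(term a m ⊖ term a n) †} {term a m † ⊖ term a n †} {ε} (ext λ _ _ → refl) (bound-† {term a m ⊖ term a n} (c m n m≥ n≥))

  _⋆ᶜ : Element → Element
  a ⋆ᶜ = element (λ n → term a n †) (⋆ᶜ-cauchy a)

  ⋆ᶜ-cong : ∀ {a b} → a ≈ b → a ⋆ᶜ ≈ b ⋆ᶜ
  ⋆ᶜ-cong {a} {b} p = close λ ε 0<ε → let N , c = eventually p ε 0<ε in
    N , λ n n≥ → bound-resp {(term a n ⊖ term b n) †} {term a n † ⊖ term b n †} {ε} (ext λ _ _ → refl) (bound-† {term a n ⊖ term b n} (c n n≥))

  eventuallyBounded : ∀ a → ∃[ B ] 0ℚ ℚ.< B × ∃[ N ] ∀ n → N ℕ.≤ n → Bound (term a n) B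
  eventuallyBounded a =
    let N , c = cauchyᵒ a 1ℚ 0<1
        p , b = hasBound (term a N)
    in p ℚ.+ 1ℚ , 0<+ (proj₁ b) (ℚ.<⇒≤ 0<1) , N , λ n n≥ →
         bound-⊖-resp {term a n} {term a N} b (c n N n≥ ℕ.≤-refl)

  abstract
    *ᶜ-cauchy : ∀ a b → IsCauchyᵒ (λ n → term a n ⊛ term b n)
    *ᶜ-cauchy a b ε 0<ε =
      let A , 0<A , K , bA = eventuallyBounded a
          B , 0<B , L , bB = eventuallyBounded b
          η , 0<η , eq = quotient (0<+ 0<A (ℚ.<⇒≤ 0<B)) 0<ε
          M , c₁ = cauchyᵒ a η 0<η
          N , c₂ = cauchyᵒ b η 0<η
      in (K ⊔ L) ⊔ (M ⊔ N) , λ m n m≥ n≥ →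
           let m≥KL = ⊔ˡ (K ⊔ L) (M ⊔ N) m≥
               n≥KL = ⊔ˡ (K ⊔ L) (M ⊔ N) n≥
               m≥MN = ⊔ʳ (K ⊔ L) (M ⊔ N) m≥
               n≥MN = ⊔ʳ (K ⊔ L) (M ⊔ N) n≥
           in bound-close-⊛ {term a m} {term b m} {term a n} {term b n}
                (bA m (⊔ˡ K L m≥KL)) (bB n (⊔ʳ K L n≥KL)) eq
                (c₁ m n (⊔ˡ M N m≥MN) (⊔ˡ M N n≥MN))
                (c₂ m n (⊔ʳ M N m≥MN) (⊔ʳ M N n≥MN))

  _*ᶜ_ : Element → Element → Element
  a *ᶜ b = element (λ n → term a n ⊛ term b n) (*ᶜ-cauchy a b)

  *ᶜ-cong : ∀ {a a′ b b′} → a ≈ a′ → b ≈ b′ → a *ᶜ b ≈ a′ *ᶜ b′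
  *ᶜ-cong {a} {a′} {b} {b′} p q = close λ ε 0<ε →
    let A , 0<A , K , bA = eventuallyBounded a
        B , 0<B , L , bB = eventuallyBounded b′
        η , 0<η , eq = quotient (0<+ 0<A (ℚ.<⇒≤ 0<B)) 0<ε
        M , c₁ = eventually p η 0<η
        N , c₂ = eventually q η 0<η
    in (K ⊔ L) ⊔ (M ⊔ N) , λ n n≥ →
         let n≥KL = ⊔ˡ (K ⊔ L) (M ⊔ N) n≥
             n≥MN = ⊔ʳ (K ⊔ L) (M ⊔ N) n≥
         in bound-close-⊛ {term a n} {term b n} {term a′ n} {term b′ n}
              (bA n (⊔ˡ K L n≥KL)) (bB n (⊔ʳ K L n≥KL)) eq
              (c₁ n (⊔ˡ M N n≥MN)) (c₂ n (⊔ʳ M N n≥MN))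

  +ᶜ-comm : ∀ a b → a +ᶜ b ≈ b +ᶜ a
  +ᶜ-comm a b = pointwise λ n → ⊹-comm (term a n) (term b n)

  +ᶜ-assoc : ∀ a b c → (a +ᶜ b) +ᶜ c ≈ a +ᶜ (b +ᶜ c)
  +ᶜ-assoc a b c = pointwise λ n → ⊹-assoc (term a n) (term b n) (term c n)

  +ᶜ-identityˡ : ∀ a → constant 𝟎ᵒ +ᶜ a ≈ a
  +ᶜ-identityˡ a = pointwise λ n → ⊹-identityˡ (term a n)

  +ᶜ-inverseʳ : ∀ a → a +ᶜ -ᶜ a ≈ constant 𝟎ᵒ
  +ᶜ-inverseʳ a = pointwise λ n → ⊹-inverseʳ (term a n)

  *ᶜ-assoc : ∀ a b c → (a *ᶜ b) *ᶜ c ≈ a *ᶜ (b *ᶜ c)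
  *ᶜ-assoc a b c = pointwise λ n → ext λ _ _ → refl

  *ᶜ-identityˡ : ∀ a → constant 𝟏ᵒ *ᶜ a ≈ a
  *ᶜ-identityˡ a = pointwise λ n → ext λ _ _ → refl

  *ᶜ-identityʳ : ∀ a → a *ᶜ constant 𝟏ᵒ ≈ a
  *ᶜ-identityʳ a = pointwise λ n → ext λ _ _ → refl

  *ᶜ-distribˡ : ∀ a b c → a *ᶜ (b +ᶜ c) ≈ a *ᶜ b +ᶜ a *ᶜ c
  *ᶜ-distribˡ a b c = pointwise λ n → ⊛-distribˡ (term a n) (term b n) (term c n)

  *ᶜ-distribʳ : ∀ a b c → (b +ᶜ c) *ᶜ a ≈ b *ᶜ a +ᶜ c *ᶜ a
  *ᶜ-distribʳ a b c = pointwise λ n → ext λ _ _ → refl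

  isRing : IsRing _≈_ _+ᶜ_ _*ᶜ_ -ᶜ_ (constant 𝟎ᵒ) (constant 𝟏ᵒ)
  isRing = record
    { +-isAbelianGroup = record
      { isGroup = record
        { isMonoid = record
          { isSemigroup = record
            { isMagma = record
              { isEquivalence = record { refl = pointwise λ _ → ≐-refl ; sym = λ {a} {b} → ≈-sym {a} {b} ; trans = λ {a} {b} {c} → ≈-trans {a} {b} {c} }
              ; ∙-cong = λ {a} {a′} {b} {b′} → +ᶜ-cong {a} {a′} {b} {b′} }
            ; assoc = +ᶜ-assoc }
          ; identity = +ᶜ-identityˡ , (λ a → ≈-trans (+ᶜ-comm a (constant 𝟎ᵒ)) (+ᶜ-identityˡ a)) }
        ; inverse = (λ a → ≈-trans (+ᶜ-comm (-ᶜ a) a) (+ᶜ-inverseʳ a)) , +ᶜ-inverseʳ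
        ; ⁻¹-cong = λ {a} {b} → -ᶜ-cong {a} {b} }
      ; comm = +ᶜ-comm }
    ; *-cong = λ {a} {a′} {b} {b′} → *ᶜ-cong {a} {a′} {b} {b′}
    ; *-assoc = *ᶜ-assoc
    ; *-identity = *ᶜ-identityˡ , *ᶜ-identityʳ
    ; distrib = *ᶜ-distribˡ , *ᶜ-distribʳ }

  bound-small-scalar : ∀ {a b} ε → 0ℚ ℚ.< ε → ℚ.∣ a ∣ ℚ.≤ ½ ℚ.* ε → ℚ.∣ b ∣ ℚ.≤ ½ ℚ.* ε → Bound (scalar a b) ε
  bound-small-scalar {a} {b} ε 0<ε a≤ b≤ = bound-scalar {a} {b} 0<ε (≤-by
    (0≤+ (0≤+ (0≤gap (square a a≤)) (0≤gap (square b b≤))) (0≤* (ℚ.<⇒≤ 0<½) (0≤p² ε)))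
    (solve 3 (λ e a b → e :* e :- (a :+ b)
      := ((con ½ :* e) :* (con ½ :* e) :- a) :+ ((con ½ :* e) :* (con ½ :* e) :- b) :+ con ½ :* (e :* e)) refl
      ε (a ℚ.* a) (b ℚ.* b)))
    where
    square : ∀ p {q} → ℚ.∣ p ∣ ℚ.≤ q → p ℚ.* p ℚ.≤ q ℚ.* q
    square p {q} le = ≤-by (0≤* (0≤gap le) (0≤+ (ℚ.≤-trans (ℚ.0≤∣p∣ p) le) (ℚ.0≤∣p∣ p)))
      (≡.trans (cong (λ s → q ℚ.* q ℚ.- s) (≡.sym (∣p∣²≡p² p)))
        (solve 2 (λ p q → q :* q :- p :* p := (q :- p) :* (q :+ p)) refl ℚ.∣ p ∣ q))

  abstract
    fromℂ-cauchy : ∀ z → IsCauchyᵒ (λ n → scalar (seq (re z) n) (seq (im z) n))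
    fromℂ-cauchy z ε 0<ε =
      let M , c₁ = cauchy (re z) (½ ℚ.* ε) (0<½* 0<ε)
          N , c₂ = cauchy (im z) (½ ℚ.* ε) (0<½* 0<ε)
      in M ⊔ N , λ m n m≥ n≥ → bound-resp
           (⊖-scalar (seq (re z) m) (seq (im z) m) (seq (re z) n) (seq (im z) n))
           (bound-small-scalar ε 0<ε
             (c₁ m n (⊔ˡ M N m≥) (⊔ˡ M N n≥))
             (c₂ m n (⊔ʳ M N m≥) (⊔ʳ M N n≥)))

  fromℂ : ℂ → Element
  fromℂ z = element (λ n → scalar (seq (re z) n) (seq (im z) n)) (fromℂ-cauchy z)

  fromℂ-cong : ∀ {z w} → z ≃ℂ w → fromℂ z ≈ fromℂ w
  fromℂ-cong {z} {w} (p , q) = close λ ε 0<ε →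
    let M , c₁ = p (½ ℚ.* ε) (0<½* 0<ε)
        N , c₂ = q (½ ℚ.* ε) (0<½* 0<ε)
    in M ⊔ N , λ n n≥ → bound-resp
         (⊖-scalar (seq (re z) n) (seq (im z) n) (seq (re w) n) (seq (im w) n))
         (bound-small-scalar ε 0<ε (c₁ n (⊔ˡ M N n≥)) (c₂ n (⊔ʳ M N n≥)))

  infixr 7 _•ᶜ_

  -- Scalars act as multiplication by the elements `fromℂ z`, so that most of the module laws are
  -- laws of the ring.
  _•ᶜ_ : ℂ → Element → Element
  z •ᶜ a = fromℂ z *ᶜ a

  ≈-refl : ∀ {a} → a ≈ a
  ≈-refl {a} = pointwise {a} {a} λ _ → ≐-refl

  private module ᶜ = IsRing isRing

  •ᶜ-via : ∀ z {b c} a → fromℂ z ≈ b → b *ᶜ a ≈ c → z •ᶜ a ≈ c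
  •ᶜ-via z {b} {c} a p q = ≈-trans {z •ᶜ a} {b *ᶜ a} {c}
    (*ᶜ-cong {fromℂ z} {b} {a} {a} p (≈-refl {a})) q

  •ᶜ-cong : ∀ {z w a b} → z ≃ℂ w → a ≈ b → z •ᶜ a ≈ w •ᶜ b
  •ᶜ-cong {z} {w} {a} {b} z≃w = *ᶜ-cong {fromℂ z} {fromℂ w} {a} {b} (fromℂ-cong {z} {w} z≃w)

  •ᶜ-zeroˡ : ∀ a → 0ℂ •ᶜ a ≈ constant 𝟎ᵒ
  •ᶜ-zeroˡ a = •ᶜ-via 0ℂ {constant 𝟎ᵒ} {constant 𝟎ᵒ} a
    (pointwise {fromℂ 0ℂ} {constant 𝟎ᵒ} λ _ → scalar-0) (ᶜ.zeroˡ a)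

  •ᶜ-identityˡ : ∀ a → 1ℂ •ᶜ a ≈ a
  •ᶜ-identityˡ a = •ᶜ-via 1ℂ {constant 𝟏ᵒ} {a} a
    (pointwise {fromℂ 1ℂ} {constant 𝟏ᵒ} λ _ → scalar-1) (*ᶜ-identityˡ a)

  •ᶜ-distribʳ : ∀ a z w → (z +ℂ w) •ᶜ a ≈ z •ᶜ a +ᶜ w •ᶜ a
  •ᶜ-distribʳ a z w = •ᶜ-via (z +ℂ w) {fromℂ z +ᶜ fromℂ w} {z •ᶜ a +ᶜ w •ᶜ a} a
    (pointwise {fromℂ (z +ℂ w)} {fromℂ z +ᶜ fromℂ w}
      λ n → scalar-⊹ (seq (re z) n) (seq (im z) n) (seq (re w) n) (seq (im w) n))
    (*ᶜ-distribʳ a (fromℂ z) (fromℂ w))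

  •ᶜ-assoc : ∀ z w a → (z *ℂ w) •ᶜ a ≈ z •ᶜ (w •ᶜ a)
  •ᶜ-assoc z w a = •ᶜ-via (z *ℂ w) {fromℂ z *ᶜ fromℂ w} {z •ᶜ (w •ᶜ a)} a
    (pointwise {fromℂ (z *ℂ w)} {fromℂ z *ᶜ fromℂ w}
      λ n → scalar-⊛ (seq (re z) n) (seq (im z) n) (seq (re w) n) (seq (im w) n))
    (*ᶜ-assoc (fromℂ z) (fromℂ w) a)

  isLeftModule : IsLeftModule (CommutativeRing.ring ℂ-commutativeRing) _≈_ _+ᶜ_ (constant 𝟎ᵒ) -ᶜ_ _•ᶜ_
  isLeftModule = record
    { isLeftSemimodule = record
      { +ᴹ-isCommutativeMonoid = ᶜ.+-isCommutativeMonoid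
      ; isPreleftSemimodule = record
        { *ₗ-cong = λ {z} {w} {a} {b} → •ᶜ-cong {z} {w} {a} {b}
        ; *ₗ-zeroˡ = •ᶜ-zeroˡ
        ; *ₗ-distribʳ = •ᶜ-distribʳ
        ; *ₗ-identityˡ = •ᶜ-identityˡ
        ; *ₗ-assoc = •ᶜ-assoc
        ; *ₗ-zeroʳ = λ z → ᶜ.zeroʳ (fromℂ z)
        ; *ₗ-distribˡ = λ z → *ᶜ-distribˡ (fromℂ z) } }
    ; -ᴹ‿cong = λ {a} {b} → -ᶜ-cong {a} {b}
    ; -ᴹ‿inverse = ᶜ.-‿inverse }

  •-*-assocˡ : ∀ z a b → (z •ᶜ a) *ᶜ b ≈ z •ᶜ (a *ᶜ b)
  •-*-assocˡ z = *ᶜ-assoc (fromℂ z)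

  •-*-assocʳ : ∀ z a b → a *ᶜ (z •ᶜ b) ≈ z •ᶜ (a *ᶜ b)
  •-*-assocʳ z a b = pointwise {a *ᶜ (z •ᶜ b)} {z •ᶜ (a *ᶜ b)} λ n → ext λ x y →
    ≡.sym (≐-apply (scalar-central (seq (re z) n) (seq (im z) n) (term a n)) (fun (term b n) x) y)

  ⋆-• : ∀ z a → (z •ᶜ a) ⋆ᶜ ≈ conj z •ᶜ a ⋆ᶜ
  ⋆-• z a = pointwise {(z •ᶜ a) ⋆ᶜ} {conj z •ᶜ a ⋆ᶜ} λ n →
    let x = seq (re z) n ; y = seq (im z) n ; f = term a n † in
    ≐-trans {(scalar x y ⊛ term a n) †} {f ⊛ scalar x (ℚ.- y)} {scalar x (ℚ.- y) ⊛ f}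
      (ext λ s t → ≡.trans (adjoint f (fun (scalar x y †) s) t)
        (≡.trans (≡.sym (≐-apply (scalar-† x y) s (fun* f t))) (≡.sym (adjoint f (fun (scalar x (ℚ.- y)) s) t))))
      (≐-sym (scalar-central x (ℚ.- y) f))

  1≤p² : ∀ {p} → Bound (𝟏ᵒ ⊖ 𝟎ᵒ) p → 1ℚ ℚ.≤ p ℚ.* p
  1≤p² {p} b = ≡.subst₂ ℚ._≤_ unit-norm (≡.trans (cong (p ℚ.* p ℚ.*_) unit-norm) (ℚ.*-identityʳ (p ℚ.* p)))
    (proj₂ (bound-resp {𝟏ᵒ ⊖ 𝟎ᵒ} {𝟏ᵒ} {p} (⊖-𝟎 𝟏ᵒ) b) unit)

  1≉0 : ¬ (constant 𝟏ᵒ ≈ constant 𝟎ᵒ)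
  1≉0 eq = let N , b = eventually eq ½ 0<½ in
    from-no (1ℚ ℚ.≤? ½ ℚ.* ½) (1≤p² {½} (b N ℕ.≤-refl))

  abstract
    ν-cauchy : ∀ a → IsCauchySeq (λ n → ν n (term a n))
    ν-cauchy a ε 0<ε =
      let M , c = cauchyᵒ a (½ ℚ.* ε) (0<½* 0<ε)
          N , d = δ-small (½ ℚ.* ε) (0<½* 0<ε)
          le : ∀ m n → M ⊔ N ℕ.≤ m → M ⊔ N ℕ.≤ n → ν m (term a m) ℚ.≤ ν n (term a n) ℚ.+ ε
          le m n m≥ n≥ = ℚ.≤-trans
            (ν-close n m {term a m} {term a n} (c m n (⊔ˡ M N m≥) (⊔ˡ M N n≥)))
            (≤-by (0≤gap (d m (⊔ʳ M N m≥)))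
              (solve 3 (λ v e d → (v :+ e) :- (v :+ con ½ :* e :+ d) := con ½ :* e :- d) refl (ν n (term a n)) ε (δ m)))
      in M ⊔ N , λ m n m≥ n≥ → ∣p-q∣≤ (le m n m≥ n≥) (le n m n≥ m≥)

  -- The operator and the accuracy 1/(n+1) improve together along the sequence. All its terms are
  -- strictly positive, even for the zero element.
  ‖_‖ᶜ : Element → ℝ
  ‖ a ‖ᶜ = mkℝ (λ n → ν n (term a n)) (ν-cauchy a)

  ‖‖-cong : ∀ {a b} → a ≈ b → ‖ a ‖ᶜ ≃ℝ ‖ b ‖ᶜ
  ‖‖-cong {a} {b} p ε 0<ε =
    let M , c = eventually p (½ ℚ.* ε) (0<½* 0<ε)
        N , d = δ-small (½ ℚ.* ε) (0<½* 0<ε)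
        le : ∀ {f g} n → M ⊔ N ℕ.≤ n → Bound (f ⊖ g) (½ ℚ.* ε) → ν n f ℚ.≤ ν n g ℚ.+ ε
        le {f} {g} n n≥ bd = ℚ.≤-trans (ν-close n n {f} {g} bd)
          (≤-by (0≤gap (d n (⊔ʳ M N n≥)))
            (solve 3 (λ v e d → (v :+ e) :- (v :+ con ½ :* e :+ d) := con ½ :* e :- d) refl (ν n g) ε (δ n)))
    in M ⊔ N , λ n n≥ → let bd = c n (⊔ˡ M N n≥) in
         ∣p-q∣≤ (le {term a n} {term b n} n n≥ bd) (le {term b n} {term a n} n n≥ (bound-swap {term a n} {term b n} bd))

  ‖‖-definite : ∀ a → ‖ a ‖ᶜ ≃ℝ 0ℝ → a ≈ constant 𝟎ᵒ
  ‖‖-definite a p = close λ ε 0<ε → let N , c = p ε 0<ε in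
    N , λ n n≥ → bound-resp (≐-sym (⊖-𝟎 (term a n))) (bound-mono {term a n}
      (ℚ.≤-trans (p≤∣p∣ (ν n (term a n))) (≡.subst (λ s → ℚ.∣ s ∣ ℚ.≤ ε)
        (solve 1 (λ a → a :- con 0ℚ := a) refl (ν n (term a n))) (c n n≥)))
      (ν-bound n (term a n)))

  ‖‖-triangle : ∀ a b → ‖ a +ᶜ b ‖ᶜ ≤ℝ ‖ a ‖ᶜ +ℝ ‖ b ‖ᶜ
  ‖‖-triangle a b = ≤ℝ-δ {‖ a +ᶜ b ‖ᶜ} {‖ a ‖ᶜ +ℝ ‖ b ‖ᶜ} 1ℝ λ n →
    ≡.subst (λ s → ν n (term a n ⊹ term b n) ℚ.≤ ν n (term a n) ℚ.+ ν n (term b n) ℚ.+ s) (≡.sym (ℚ.*-identityʳ (δ n)))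
      (ν-least n (term a n ⊹ term b n) (bound-⊹ {term a n} {term b n} (ν-bound n (term a n)) (ν-bound n (term b n))))

  ‖‖-submult : ∀ a b → ‖ a *ᶜ b ‖ᶜ ≤ℝ ‖ a ‖ᶜ *ℝ ‖ b ‖ᶜ
  ‖‖-submult a b = ≤ℝ-δ {‖ a *ᶜ b ‖ᶜ} {‖ a ‖ᶜ *ℝ ‖ b ‖ᶜ} 1ℝ λ n →
    ≡.subst (λ s → ν n (term a n ⊛ term b n) ℚ.≤ ν n (term a n) ℚ.* ν n (term b n) ℚ.+ s) (≡.sym (ℚ.*-identityʳ (δ n)))
      (ν-least n (term a n ⊛ term b n) (bound-⊛ {term a n} {term b n} (ν-bound n (term a n)) (ν-bound n (term b n))))

  4ℝ : ℝ
  4ℝ = fromℚ (1ℚ ℚ.+ 1ℚ ℚ.+ 1ℚ ℚ.+ 1ℚ)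

  -- Both inequalities come from `sqrt-estimate`: with c = 1 and s = |z|² ‖a‖² the bounds of z a are
  -- estimated from those of a, and with c = |z|² and s = ‖z a‖² those of a from those of z a.
  ‖‖-homogen : ∀ z a → ‖ z •ᶜ a ‖ᶜ *ℝ ‖ z •ᶜ a ‖ᶜ ≃ℝ ∣ z ∣² *ℝ (‖ a ‖ᶜ *ℝ ‖ a ‖ᶜ)
  ‖‖-homogen z a = ≃ℝ-δ {‖ z •ᶜ a ‖ᶜ *ℝ ‖ z •ᶜ a ‖ᶜ} {∣ z ∣² *ℝ (‖ a ‖ᶜ *ℝ ‖ a ‖ᶜ)}
    (4ℝ *ℝ (1ℝ *ℝ ‖ z •ᶜ a ‖ᶜ)) (4ℝ *ℝ (∣ z ∣² *ℝ ‖ a ‖ᶜ))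
    (λ n → let x = seq (re z) n ; y = seq (im z) n ; f = term a n ; zf = scalar x y ⊛ f ; c = x ℚ.* x ℚ.+ y ℚ.* y ; v = ν n f in
      ≡.subst (ℚ._≤ c ℚ.* (v ℚ.* v) ℚ.+ δ n ℚ.* ((1ℚ ℚ.+ 1ℚ ℚ.+ 1ℚ ℚ.+ 1ℚ) ℚ.* (1ℚ ℚ.* ν n zf))) (ℚ.*-identityˡ (ν n zf ℚ.* ν n zf))
       (sqrt-estimate (ℚ.<⇒≤ 0<1) (0≤* (0≤+ (0≤p² x) (0≤p² y)) (0≤p² v)) (ℚ.<⇒≤ (0<ν n zf)) (0<δ n)
        λ p 0<p le → ν-least n zf (bound-mono² {zf} 0<p
          (λ w → ℚ.≤-trans (ℚ.≤-reflexive (norm-scalar x y f w))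
            (≤-by (0≤* (0≤+ (0≤p² x) (0≤p² y)) (0≤gap (proj₂ (ν-bound n f) w)))
              (solve 4 (λ c v X F → c :* (v :* v) :* X :- c :* F := c :* (v :* v :* X :- F)) refl c v ⟪ w , w ⟫ ⟪ fun f w , fun f w ⟫)))
          (≡.subst (c ℚ.* (v ℚ.* v) ℚ.≤_) (ℚ.*-identityˡ (p ℚ.* p)) le))))
    (λ n → let x = seq (re z) n ; y = seq (im z) n ; f = term a n ; zf = scalar x y ⊛ f ; c = x ℚ.* x ℚ.+ y ℚ.* y ; w = ν n zf in
      sqrt-estimate (0≤+ (0≤p² x) (0≤p² y)) (0≤p² w) (ℚ.<⇒≤ (0<ν n f)) (0<δ n)
        λ p 0<p le → ν-least n f (0<p , λ t → cancel-≤ (positive n c p (0<* (0<ν n zf) (0<ν n zf)) le)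
          (ℚ.≤-trans (ℚ.≤-reflexive (≡.sym (norm-scalar x y f t)))
            (ℚ.≤-trans (proj₂ (ν-bound n zf) t)
              (≤-by (0≤* (0≤gap le) (0≤⟪⟫ t))
                (solve 4 (λ c p w X → c :* (p :* p :* X) :- w :* X := (c :* (p :* p) :- w) :* X) refl c p (w ℚ.* w) ⟪ t , t ⟫))))))
    where
    -- Division by |z|² needs no separate treatment of z = 0: the approximation of ‖z a‖ is
    -- positive, so it can lie below |z|² p² only if |z|² is positive.
    positive : ∀ (n : ℕ) c p {s} → 0ℚ ℚ.< s → s ℚ.≤ c ℚ.* (p ℚ.* p) → 0ℚ ℚ.< c
    positive n c p {s} 0<s le with c ℚ.≤? 0ℚ
    ... | no c≰0 = ℚ.≰⇒> c≰0
    ... | yes c≤0 = contradiction (ℚ.≤-trans le (≤-by (0≤* (0≤gap c≤0) (0≤p² p))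
            (solve 2 (λ c q → con 0ℚ :- c :* q := (con 0ℚ :- c) :* q) refl c (p ℚ.* p)))) (<⇒≱ 0<s)

  -- One inequality is submultiplicativity with `bound-†`. In the other, `bound-†⊛` turns a bound of
  -- f* f into one of the square of the norm of f, and `sqrt-estimate` replaces the missing root.
  C*-identity : ∀ a → ‖ a ⋆ᶜ *ᶜ a ‖ᶜ ≃ℝ ‖ a ‖ᶜ *ℝ ‖ a ‖ᶜ
  C*-identity a = ≃ℝ-δ {‖ a ⋆ᶜ *ᶜ a ‖ᶜ} {‖ a ‖ᶜ *ℝ ‖ a ‖ᶜ} 1ℝ (4ℝ *ℝ (1ℝ *ℝ ‖ a ‖ᶜ))
    (λ n → let f = term a n in ≡.subst (λ s → ν n (f † ⊛ f) ℚ.≤ ν n f ℚ.* ν n f ℚ.+ s) (≡.sym (ℚ.*-identityʳ (δ n)))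
      (ν-least n (f † ⊛ f) (bound-⊛ {f †} {f} (bound-† {f} (ν-bound n f)) (ν-bound n f))))
    (λ n → let f = term a n ; r = ν n (f † ⊛ f) in
      ≡.subst (ℚ._≤ r ℚ.+ δ n ℚ.* ((1ℚ ℚ.+ 1ℚ ℚ.+ 1ℚ ℚ.+ 1ℚ) ℚ.* (1ℚ ℚ.* ν n f))) (ℚ.*-identityˡ (ν n f ℚ.* ν n f))
       (sqrt-estimate (ℚ.<⇒≤ 0<1) (ℚ.<⇒≤ (0<ν n (f † ⊛ f))) (ℚ.<⇒≤ (0<ν n f)) (0<δ n)
        λ p 0<p le → ν-least n f (bound-mono² {f} 0<p (bound-†⊛ {f} (ν-bound n (f † ⊛ f)))
          (≡.subst (r ℚ.≤_) (ℚ.*-identityˡ (p ℚ.* p)) le))))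

-- Completeness of the algebra

module C*Completion (S : ComplexSpace) where
  open ComplexSpace S
  open Operators S
  open Completion S
  open Operator
  open Element
  open _≈_

  IsCauchyᶜ : (ℕ → Element) → Set
  IsCauchyᶜ a = ∀ ε → 0ℚ ℚ.< ε →
    ∃[ N ] ∀ m n → N ℕ.≤ m → N ℕ.≤ n → ‖ a m +ᶜ -ᶜ a n ‖ᶜ ≤ℝ fromℚ ε

  -- The limit is the diagonal sequence b n = a n (L n), where L n is a modulus of a n for 1/(n+1).
  module Limit (a : ℕ → Element) (a-cauchy : IsCauchyᶜ a) where

    b : ℕ → Operator
    b n = term (a n) (proj₁ (cauchyᵒ (a n) (δ n) (0<δ n)))

    term-close : ∀ ε → 0ℚ ℚ.< ε → ∃[ N ] ∀ m n → N ℕ.≤ m → N ℕ.≤ n →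
      ∃[ K ] ∀ i → K ℕ.≤ i → Bound (term (a m) i ⊖ term (a n) i) ε
    term-close ε 0<ε = let N , c = a-cauchy (½ ℚ.* ε) (0<½* 0<ε) in N , λ m n m≥ n≥ →
      let K , d = c m n m≥ n≥ (½ ℚ.* ε) (0<½* 0<ε) in K , λ i i≥ →
        bound-mono {term (a m) i ⊖ term (a n) i} (≡.subst (ν i (term (a m) i ⊖ term (a n) i) ℚ.≤_) (½+½ ε) (d i i≥))
          (ν-bound i (term (a m) i ⊖ term (a n) i))

    diagonal-close : ∀ ε → 0ℚ ℚ.< ε → ∃[ N ] ∀ m n → N ℕ.≤ m → N ℕ.≤ n →
      ∃[ K ] ∀ i → K ℕ.≤ i → Bound (term (a m) i ⊖ b n) ε
    diagonal-close ε 0<ε =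
      let M , c = term-close (½ ℚ.* ε) (0<½* 0<ε)
          N , d = δ-small (½ ℚ.* ε) (0<½* 0<ε)
      in M ⊔ N , λ m n m≥ n≥ →
        let K , e = c m n (⊔ˡ M N m≥) (⊔ˡ M N n≥)
            L , l = cauchyᵒ (a n) (δ n) (0<δ n)
        in K ⊔ L , λ i i≥ → bound-close-trans {term (a m) i} {term (a n) i} {b n} ε
             (e i (⊔ˡ K L i≥))
             (bound-mono {term (a n) i ⊖ b n} (d n (⊔ʳ M N n≥))
               (l i L (⊔ʳ K L i≥) ℕ.≤-refl))

    limit : Element
    -- The diagonal operators b m and b n are compared through a term of a m, taken far enough out
    -- to be close to both.
    limit = element b λ ε 0<ε → let N , c = diagonal-close (½ ℚ.* ε) (0<½* 0<ε) in N , λ m n m≥ n≥ →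
      let K , d = c m m m≥ m≥
          L , e = c m n m≥ n≥
          i = K ⊔ L
      in bound-close-trans {b m} {term (a m) i} {b n} ε
           (bound-swap {term (a m) i} {b m} (d i (ℕ.m≤m⊔n K L))) (e i (ℕ.m≤n⊔m K L))

    converges : ∀ ε → 0ℚ ℚ.< ε → ∃[ N ] ∀ n → N ℕ.≤ n → ‖ a n +ᶜ -ᶜ limit ‖ᶜ ≤ℝ fromℚ ε
    converges ε 0<ε = let N , c = diagonal-close (½ ℚ.* ε) (0<½* 0<ε) in N , λ n n≥ ε′ 0<ε′ →
      let M , d = cauchyᵒ (a n) (½ ℚ.* ε) (0<½* 0<ε)
          P , small = δ-small ε′ 0<ε′
      in (M ⊔ N) ⊔ P , λ k k≥ →
        let k≥MN = ⊔ˡ (M ⊔ N) P k≥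
            k≥M = ⊔ˡ M N k≥MN
            K , e = c n k n≥ (⊔ʳ M N k≥MN)
            i = M ⊔ K
        in ℚ.≤-trans
             (ν-least k (term (a n) k ⊖ b k) (bound-close-trans {term (a n) k} {term (a n) i} {b k} ε
               (d k i k≥M (ℕ.m≤m⊔n M K)) (e i (ℕ.m≤n⊔m M K))))
             (ℚ.+-monoʳ-≤ ε (small k (⊔ʳ (M ⊔ N) P k≥)))

  algebra : UnitalC*Algebra
  algebra = record
    { Carrier = Element ; _≈_ = _≈_ ; _+_ = _+ᶜ_ ; _*_ = _*ᶜ_ ; -_ = -ᶜ_
    ; 0# = constant 𝟎ᵒ ; 1# = constant 𝟏ᵒ
    ; isRing = isRing
    ; 1≉0 = 1≉0
    ; _•_ = _•ᶜ_
    ; isLeftModule = isLeftModule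
    ; •-*-assocˡ = •-*-assocˡ
    ; •-*-assocʳ = •-*-assocʳ
    ; _⋆ = _⋆ᶜ
    ; ⋆-cong = λ {a} {b} → ⋆ᶜ-cong {a} {b}
    ; ⋆-involutive = λ a → pointwise {(a ⋆ᶜ) ⋆ᶜ} {a} λ n → ext λ _ _ → refl
    ; ⋆-+ = λ a b → pointwise {(a +ᶜ b) ⋆ᶜ} {a ⋆ᶜ +ᶜ b ⋆ᶜ} λ n → ext λ _ _ → refl
    ; ⋆-* = λ a b → pointwise {(a *ᶜ b) ⋆ᶜ} {b ⋆ᶜ *ᶜ a ⋆ᶜ} λ n → ext λ _ _ → refl
    ; ⋆-• = ⋆-•
    ; ‖_‖ = ‖_‖ᶜ
    ; ‖‖-cong = λ {a} {b} → ‖‖-cong {a} {b}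
    ; ‖‖-nonNeg = λ a ε 0<ε → 0 , λ n _ → ℚ.<⇒≤ (0<+ (0<ν n (term a n)) (ℚ.<⇒≤ 0<ε))
    ; ‖‖-definite = ‖‖-definite
    ; ‖‖-triangle = ‖‖-triangle
    ; ‖‖-homogen = ‖‖-homogen
    ; ‖‖-submult = ‖‖-submult
    ; C*-identity = C*-identity
    ; complete = λ a a-cauchy → Limit.limit a a-cauchy , Limit.converges a a-cauchy }

-- Operators on finite-dimensional complex vectors

sumSquares : ∀ {N} → (Fin N → ℚ) → ℚ
sumSquares {zero}  f = 0ℚ
sumSquares {suc N} f = f zero ℚ.* f zero ℚ.+ sumSquares (f ∘ suc)

sumSquares-cong : ∀ {N} {f g : Fin N → ℚ} → (∀ i → f i ≡ g i) → sumSquares f ≡ sumSquares g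
sumSquares-cong {zero}  eq = refl
sumSquares-cong {suc N} eq = cong₂ ℚ._+_ (cong₂ ℚ._*_ (eq zero) (eq zero)) (sumSquares-cong (eq ∘ suc))

dot-sumSquares : ∀ {n} (x : Vec ℚ n) → dot x x ≡ sumSquares (lookup x)
dot-sumSquares []      = refl
dot-sumSquares (a ∷ x) = cong (a ℚ.* a ℚ.+_) (dot-sumSquares x)

subSquares : ∀ {N n} → (Fin N → Vec ℚ n) → QuadraticForm n → QuadraticForm n
subSquares {zero}  g q = q
subSquares {suc N} g q = subSquare (g zero) (subSquares (g ∘ suc) q)

eval-subSquares : ∀ {N n} (g : Fin N → Vec ℚ n) q x →
  eval (subSquares g q) x ≡ eval q x ℚ.- sumSquares (λ i → dot (g i) x)
eval-subSquares {zero}  g q x = solve 1 (λ e → e := e :- con 0ℚ) refl (eval q x)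
eval-subSquares {suc N} g q x = ≡.trans (eval-subSquare (g zero) (subSquares (g ∘ suc) q) x)
  (≡.trans (cong (ℚ._- dot (g zero) x ℚ.* dot (g zero) x) (eval-subSquares (g ∘ suc) q x))
    (solve 3 (λ e s d → e :- s :- d := e :- (d :+ s)) refl
      (eval q x) (sumSquares (λ i → dot (g (suc i)) x)) (dot (g zero) x ℚ.* dot (g zero) x)))

-- Cauchy-Schwarz in each row; the constant is the squared Frobenius norm of the matrix with rows g
-- i.
sumSquares-bound : ∀ {N n} (g : Fin N → Vec ℚ n) →
  ∃[ c ] ∀ x → sumSquares (λ i → dot (g i) x) ℚ.≤ c ℚ.* dot x x
sumSquares-bound {zero}  g = 0ℚ , λ x → ℚ.≤-reflexive (≡.sym (ℚ.*-zeroˡ (dot x x)))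
sumSquares-bound {suc N} g = let c , le = sumSquares-bound (g ∘ suc) in
  dot (g zero) (g zero) ℚ.+ c , λ x → ≡.subst (sumSquares (λ i → dot (g i) x) ℚ.≤_) (≡.sym (ℚ.*-distribʳ-+ (dot x x) (dot (g zero) (g zero)) c))
    (ℚ.+-mono-≤ (cauchy-schwarz (g zero) x) (le x))

basis : ∀ {n} → Fin n → Vec ℚ n
basis {suc n} zero    = 1ℚ ∷ replicate n 0ℚ
basis {suc n} (suc i) = 0ℚ ∷ basis i

dot-basis : ∀ {n} (x : Vec ℚ n) i → dot x (basis i) ≡ lookup x i
dot-basis (a ∷ x) zero    = ≡.trans (cong (a ℚ.* 1ℚ ℚ.+_) (≡.trans (dot-comm x _) (dot-0 x)))
  (solve 1 (λ a → a :* con 1ℚ :+ con 0ℚ := a) refl a)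
dot-basis (a ∷ x) (suc i) = ≡.trans (cong (a ℚ.* 0ℚ ℚ.+_) (dot-basis x i))
  (solve 2 (λ a b → a :* con 0ℚ :+ b := b) refl a (lookup x i))

dot-++ : ∀ {m n} (x y : Vec ℚ m) (x′ y′ : Vec ℚ n) → dot (x ++ x′) (y ++ y′) ≡ dot x y ℚ.+ dot x′ y′
dot-++ []      []      x′ y′ = ≡.sym (ℚ.+-identityˡ (dot x′ y′))
dot-++ (a ∷ x) (b ∷ y) x′ y′ = ≡.trans (cong (a ℚ.* b ℚ.+_) (dot-++ x y x′ y′))
  (≡.sym (ℚ.+-assoc (a ℚ.* b) (dot x y) (dot x′ y′)))

-- ℂᵐ⁺¹, as pairs of a real and an imaginary part.
module ComplexVectors (m : ℕ) where

  private
    n : ℕ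
    n = suc m
    W : Set
    W = Vec ℚ n × Vec ℚ n

    ip : W → W → ℚ
    ip (x , x′) (y , y′) = dot x y ℚ.+ dot x′ y′

    flat : W → Vec ℚ (n ℕ.+ n)
    flat (x , x′) = x ++ x′

    dot-flat : ∀ x y → dot (flat x) (flat y) ≡ ip x y
    dot-flat (x , x′) (y , y′) = dot-++ x y x′ y′

    unflat : Vec ℚ (n ℕ.+ n) → W
    unflat z = Vec.take n z , Vec.drop n z

    flat-unflat : ∀ z → flat (unflat z) ≡ z
    flat-unflat z = Vec.take++drop≡id n z

    dot-basisʳ : ∀ (x x′ : Vec ℚ n) i → ip (x , x′) (basis i , replicate n 0ℚ) ≡ lookup x i
    dot-basisʳ x x′ i = ≡.trans (cong₂ ℚ._+_ (dot-basis x i) (≡.trans (dot-comm x′ _) (dot-0 x′)))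
      (ℚ.+-identityʳ (lookup x i))

    module _ (f f* : W → W) (adj : ∀ x y → ip (f x) y ≡ ip x (f* y)) where

      -- The rows of the real matrix of f are read off from the adjoint: the coordinate ⟨ f x , e ⟩
      -- equals ⟨ x , f* e ⟩. Thus the matrix is obtained without assuming f linear.
      row₁ row₂ : Fin n → Vec ℚ (n ℕ.+ n)
      row₁ i = flat (f* (basis i , replicate n 0ℚ))
      row₂ i = flat (f* (replicate n 0ℚ , basis i))

      norm-f : ∀ x → ip (f x) (f x)
        ≡ sumSquares (λ i → dot (row₁ i) (flat x)) ℚ.+ sumSquares (λ i → dot (row₂ i) (flat x))
      norm-f x = let y , y′ = f x in cong₂ ℚ._+_
        (≡.trans (dot-sumSquares y) (sumSquares-cong λ i → ≡.trans (≡.sym (dot-basisʳ y y′ i)) (row-eq _)))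
        (≡.trans (dot-sumSquares y′) (sumSquares-cong λ i → ≡.trans (≡.sym (≡.trans
          (ℚ.+-comm (dot y (replicate n 0ℚ)) _) (dot-basisʳ y′ y i))) (row-eq _)))
        where
        row-eq : ∀ e → ip (f x) e ≡ dot (flat (f* e)) (flat x)
        row-eq e = ≡.trans (adj x e) (≡.trans (≡.sym (dot-flat x (f* e))) (dot-comm (flat x) (flat (f* e))))

      boundedness : ∃[ c ] ∀ x → ip (f x) (f x) ℚ.≤ c ℚ.* ip x x
      boundedness = let c , le = sumSquares-bound row₁ ; d , le′ = sumSquares-bound row₂ in
        c ℚ.+ d , λ x → ≡.subst₂ ℚ._≤_ (≡.sym (norm-f x))
          (≡.trans (≡.sym (ℚ.*-distribʳ-+ (dot (flat x) (flat x)) c d)) (cong ((c ℚ.+ d) ℚ.*_) (dot-flat x x)))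
          (ℚ.+-mono-≤ (le (flat x)) (le′ (flat x)))

      -- The quadratic form c‖x‖² - ‖f x‖² in the real and imaginary coordinates. A point where it
      -- is negative refutes the bound c.
      form : ℚ → QuadraticForm (n ℕ.+ n)
      form c = subSquares row₁ (subSquares row₂ (scaledNorm (n ℕ.+ n) c))

      eval-form : ∀ c x → eval (form c) (flat x) ≡ c ℚ.* ip x x ℚ.- ip (f x) (f x)
      eval-form c x = ≡.trans (eval-subSquares row₁ _ (flat x)) (≡.trans
        (cong (ℚ._- sumSquares (λ i → dot (row₁ i) (flat x))) (≡.trans (eval-subSquares row₂ _ (flat x))
          (cong (ℚ._- sumSquares (λ i → dot (row₂ i) (flat x)))
            (≡.trans (eval-scaledNorm c (flat x)) (cong (c ℚ.*_) (dot-flat x x))))))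
        (≡.trans (solve 3 (λ a p q → a :- q :- p := a :- (p :+ q)) refl
            (c ℚ.* ip x x) (sumSquares (λ i → dot (row₁ i) (flat x))) (sumSquares (λ i → dot (row₂ i) (flat x))))
          (cong (λ s → c ℚ.* ip x x ℚ.- s) (≡.sym (norm-f x)))))

      decision : ∀ c → Dec (∀ x → ip (f x) (f x) ℚ.≤ c ℚ.* ip x x)
      decision c with nonNegative⊎negative (form c)
      ... | inj₁ nonneg = yes λ x → ≤-by (nonneg (flat x)) (≡.sym (eval-form c x))
      ... | inj₂ (z , neg) = no λ le → <⇒≱ (≡.subst (ℚ._< 0ℚ)
              (≡.trans (cong (eval (form c)) (≡.sym (flat-unflat z))) (eval-form c (unflat z))) neg)
              (0≤gap (le (unflat z)))

  complexVectors : ComplexSpace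
  complexVectors = record
    { V = W
    ; _+ᵥ_ = λ (x , x′) (y , y′) → x ⊞ y , x′ ⊞ y′
    ; _·ᵥ_ = λ c (x , x′) → c ⊡ x , c ⊡ x′
    ; ⟪_,_⟫ = ip
    ; J = λ (x , x′) → (ℚ.- 1ℚ) ⊡ x′ , x
    ; ⟪⟫-comm = λ (x , x′) (y , y′) → cong₂ ℚ._+_ (dot-comm x y) (dot-comm x′ y′)
    ; ⟪⟫-+ = λ (x , x′) (y , y′) (z , z′) → ≡.trans (cong₂ ℚ._+_ (dot-⊞ x y z) (dot-⊞ x′ y′ z′))
        (solve 4 (λ a b c d → (a :+ b) :+ (c :+ d) := (a :+ c) :+ (b :+ d)) refl
          (dot x z) (dot y z) (dot x′ z′) (dot y′ z′))
    ; ⟪⟫-· = λ c (x , x′) (z , z′) → ≡.trans (cong₂ ℚ._+_ (dot-⊡ c x z) (dot-⊡ c x′ z′))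
        (≡.sym (ℚ.*-distribˡ-+ c (dot x z) (dot x′ z′)))
    ; 0≤⟪⟫ = λ (x , x′) → 0≤+ (0≤dot x) (0≤dot x′)
    ; J-skew = λ (x , x′) (y , y′) → ≡.trans (cong (ℚ._+ dot x y′) (dot-⊡ (ℚ.- 1ℚ) x′ y))
        (≡.trans (solve 2 (λ a b → :- con 1ℚ :* a :+ b := :- (:- con 1ℚ :* b :+ a)) refl (dot x′ y) (dot x y′))
          (cong (λ s → ℚ.- (s ℚ.+ dot x′ y)) (≡.trans (cong ((ℚ.- 1ℚ) ℚ.*_) (dot-comm x y′))
            (≡.trans (≡.sym (dot-⊡ (ℚ.- 1ℚ) y′ x)) (dot-comm ((ℚ.- 1ℚ) ⊡ y′) x)))))
    ; J-isometry = λ (x , x′) (y , y′) → ≡.trans (cong (ℚ._+ dot x y)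
        (≡.trans (dot-⊡ (ℚ.- 1ℚ) x′ ((ℚ.- 1ℚ) ⊡ y′)) (cong ((ℚ.- 1ℚ) ℚ.*_)
          (≡.trans (dot-comm x′ _) (dot-⊡ (ℚ.- 1ℚ) y′ x′)))))
        (≡.trans (solve 2 (λ a b → :- con 1ℚ :* (:- con 1ℚ :* a) :+ b := b :+ a) refl (dot y′ x′) (dot x y))
          (cong (dot x y ℚ.+_) (dot-comm y′ x′)))
    ; unit = basis zero , replicate n 0ℚ
    ; unit-norm = dot-basisʳ (basis zero) (replicate n 0ℚ) zero
    ; bounded = boundedness
    ; bound? = decision }

-- Sizes

enumerate : ∀ (S : Setoid 0ℓ 0ℓ) {n} (e : Fin n → Setoid.Carrier S) →
            (∀ {i j} → Setoid._≈_ S (e i) (e j) → i ≡ j) → (∀ x → ∃[ i ] Setoid._≈_ S (e i) x) → HasSize S n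
enumerate S e injective surjective = record
  { to = e
  ; from = λ x → proj₁ (surjective x)
  ; to-cong = λ { refl → S.refl }
  ; from-cong = λ {x} {y} x≈y → injective (S.trans (proj₂ (surjective x)) (S.trans x≈y (S.sym (proj₂ (surjective y)))))
  ; inverse = (λ { {x} refl → proj₂ (surjective x) })
            , (λ {i} {x} x≈ei → injective (S.trans (proj₂ (surjective x)) x≈ei)) }
  where module S = Setoid S

size-unique : ∀ {S : Setoid 0ℓ 0ℓ} {m n} → HasSize S m → HasSize S n → m ≡ n
size-unique p q = ↔⇒≡ (p ⟨∘⟩ inverse-sym q)

size-injective : ∀ {S : Setoid 0ℓ 0ℓ} {n} (v : HasSize S n) {i j} →
                 Setoid._≈_ S (Inverse.to v i) (Inverse.to v j) → i ≡ j
size-injective v eq = ≡.trans (≡.sym (Inverse.strictlyInverseʳ v _))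
  (≡.trans (Inverse.from-cong v eq) (Inverse.strictlyInverseʳ v _))

countTrue : ∀ {n} → Vec Bool n → ℕ
countTrue []          = 0
countTrue (true ∷ b)  = suc (countTrue b)
countTrue (false ∷ b) = countTrue b

nthTrue : ∀ {n} (b : Vec Bool n) → Fin (countTrue b) → Fin n
nthTrue (true ∷ b)  zero    = zero
nthTrue (true ∷ b)  (suc k) = suc (nthTrue b k)
nthTrue (false ∷ b) k       = suc (nthTrue b k)

nthTrue-true : ∀ {n} (b : Vec Bool n) k → T (lookup b (nthTrue b k))
nthTrue-true (true ∷ b)  zero    = _
nthTrue-true (true ∷ b)  (suc k) = nthTrue-true b k
nthTrue-true (false ∷ b) k       = nthTrue-true b k

nthTrue-injective : ∀ {n} (b : Vec Bool n) {k l} → nthTrue b k ≡ nthTrue b l → k ≡ l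
nthTrue-injective (true ∷ b)  {zero}  {zero}  eq = refl
nthTrue-injective (true ∷ b)  {suc k} {suc l} eq = cong suc (nthTrue-injective b (Fin.suc-injective eq))
nthTrue-injective (false ∷ b)                 eq = nthTrue-injective b (Fin.suc-injective eq)

nthTrue-surjective : ∀ {n} (b : Vec Bool n) i → T (lookup b i) → ∃[ k ] nthTrue b k ≡ i
nthTrue-surjective (true ∷ b)  zero    p = zero , refl
nthTrue-surjective (true ∷ b)  (suc i) p = let k , eq = nthTrue-surjective b i p in suc k , cong suc eq
nthTrue-surjective (false ∷ b) (suc i) p = let k , eq = nthTrue-surjective b i p in k , cong suc eq

sub-size : ∀ {S : Setoid 0ℓ 0ℓ} {n} (v : HasSize S n) (P : Setoid.Carrier S → Set) → P Respects (Setoid._≈_ S) →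
           (b : Vec Bool n) → (∀ i → T (lookup b i) ⇔ P (Inverse.to v i)) → HasSize (Sub S P) (countTrue b)
sub-size {S} v P resp b b⇔P = enumerate (Sub S P)
  (λ k → to (nthTrue b k) , Equivalence.to (b⇔P _) (nthTrue-true b k))
  (λ eq → nthTrue-injective b (size-injective v eq))
  (λ (x , p) → let x≈ = strictlyInverseˡ x
                   k , eq = nthTrue-surjective b (from x) (Equivalence.from (b⇔P _) (resp (S.sym x≈) p))
               in k , S.trans (to-cong eq) x≈)
  where
  module S = Setoid S
  open Inverse v

-- The size of an intersection in a single pass, because it is evaluated for all pairs of rows of
-- the tables.
countBoth : ∀ {n} → Vec Bool n → Vec Bool n → ℕ
countBoth []          []          = 0
countBoth (true ∷ b)  (true ∷ c)  = suc (countBoth b c)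
countBoth (true ∷ b)  (false ∷ c) = countBoth b c
countBoth (false ∷ b) (_ ∷ c)     = countBoth b c

countTrue-∧ : ∀ {n} (b c : Vec Bool n) → countTrue (zipWith _∧_ b c) ≡ countBoth b c
countTrue-∧ []          []          = refl
countTrue-∧ (true ∷ b)  (true ∷ c)  = cong suc (countTrue-∧ b c)
countTrue-∧ (true ∷ b)  (false ∷ c) = countTrue-∧ b c
countTrue-∧ (false ∷ b) (_ ∷ c)     = countTrue-∧ b c

countBoth-comm : ∀ {n} (b c : Vec Bool n) → countBoth b c ≡ countBoth c b
countBoth-comm []          []          = refl
countBoth-comm (true ∷ b)  (true ∷ c)  = cong suc (countBoth-comm b c)
countBoth-comm (true ∷ b)  (false ∷ c) = countBoth-comm b c
countBoth-comm (false ∷ b) (true ∷ c)  = countBoth-comm b c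
countBoth-comm (false ∷ b) (false ∷ c) = countBoth-comm b c

countBoth-self : ∀ {n} (b : Vec Bool n) → countBoth b b ≡ countTrue b
countBoth-self []          = refl
countBoth-self (true ∷ b)  = cong suc (countBoth-self b)
countBoth-self (false ∷ b) = countBoth-self b

T-injective : ∀ {x y} → (T x → T y) → (T y → T x) → x ≡ y
T-injective {true}  {true}  _ _ = refl
T-injective {true}  {false} f _ = contradiction (f _) (λ ())
T-injective {false} {true}  _ g = contradiction (g _) (λ ())
T-injective {false} {false} _ _ = refl

lookup-injective : ∀ {A : Set} {n} (b c : Vec A n) → (∀ i → lookup b i ≡ lookup c i) → b ≡ c
lookup-injective b c eq = ≡.trans (≡.sym (Vec.tabulate∘lookup b)) (≡.trans (Vec.tabulate-cong eq) (Vec.tabulate∘lookup c))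

-- Equal rows of size k would meet in k places. Distinctness thus follows from intersection numbers
-- that are computed anyway.
rows-distinct : ∀ {m n k} (rows : Vec (Vec Bool m) n) → (∀ i → countTrue (lookup rows i) ≡ k) →
  (∀ i j → i Fin.< j → countBoth (lookup rows i) (lookup rows j) ≢ k) →
  ∀ i j → (∀ l → lookup (lookup rows i) l ≡ lookup (lookup rows j) l) → i ≡ j
rows-distinct rows size distinct i j eq with Fin.<-cmp i j
... | tri≈ _ i≡j _ = i≡j
... | tri< i<j _ _ = contradiction (≡.trans (cong (λ r → countBoth r (lookup rows j))
        (lookup-injective (lookup rows i) (lookup rows j) eq)) (≡.trans (countBoth-self (lookup rows j)) (size j))) (distinct i j i<j)
... | tri> _ _ j<i = contradiction (≡.trans (cong (countBoth (lookup rows j))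
        (lookup-injective (lookup rows i) (lookup rows j) eq)) (≡.trans (countBoth-self (lookup rows j)) (size j))) (distinct j i j<i)

T-does : ∀ {P : Set} (d : Dec P) → T (does d) ⇔ P
T-does (yes p) = mk⇔ (λ _ → p) (λ _ → _)
T-does (no ¬p) = mk⇔ (λ ()) ¬p

T-∧⁺ : ∀ {x y} → T x × T y → T (x ∧ y)
T-∧⁺ {true} {true} _ = _

T-∧⁻ : ∀ x {y} → T (x ∧ y) → T x × T y
T-∧⁻ true p = _ , p

lookup-∧⇔ : ∀ {n} (b c : Vec Bool n) {P Q : Fin n → Set} →
  (∀ i → T (lookup b i) ⇔ P i) → (∀ i → T (lookup c i) ⇔ Q i) →
  ∀ i → T (lookup (zipWith _∧_ b c) i) ⇔ (P i × Q i)
lookup-∧⇔ b c b⇔ c⇔ i = mk⇔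
  (λ p → let q , r = T-∧⁻ (lookup b i) (≡.subst T (Vec.lookup-zipWith _∧_ i b c) p)
         in Equivalence.to (b⇔ i) q , Equivalence.to (c⇔ i) r)
  (λ (p , q) → ≡.subst T (≡.sym (Vec.lookup-zipWith _∧_ i b c))
         (T-∧⁺ (Equivalence.from (b⇔ i) p , Equivalence.from (c⇔ i) q)))

-- Graphs with an explicit adjacency table

Table : ℕ → Set
Table n = Vec (Vec Bool n) n

entry : ∀ {n} → Table n → Fin n → Fin n → Bool
entry t i j = lookup (lookup t i) j

record Tabulated (G : Graph) (n : ℕ) : Set where
  open Graph G
  field
    numbering : HasSize vertices n
    table     : Table n
    table⇔   : ∀ i j → T (entry table i j) ⇔ (Inverse.to numbering i ~ Inverse.to numbering j)

-- Only pairs i < j are tested; the remaining ones follow from the symmetry of adjacency.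
RegularTable : ∀ {n} → Table n → (k l m : ℕ) → Set
RegularTable t k l m = (∀ i → countTrue (lookup t i) ≡ k)
  × (∀ i j → i Fin.< j → countBoth (lookup t i) (lookup t j) ≡ (if entry t i j then l else m))

regularTable? : ∀ {n} (t : Table n) k l m → Dec (RegularTable t k l m)
regularTable? t k l m = (Fin.all? λ i → countTrue (lookup t i) ℕ.≟ k)
  ×-dec (Fin.all? λ i → Fin.all? λ j → (i Fin.<? j) →-dec
    (countBoth (lookup t i) (lookup t j) ℕ.≟ (if entry t i j then l else m)))

tabulated⇒stronglyRegular : ∀ {G n k l m} (G-tab : Tabulated G n) →
  RegularTable (Tabulated.table G-tab) k l m → IsStronglyRegularWith G n k l m
tabulated⇒stronglyRegular {G} {n} {k} {l} {m} G-tab (degree , common) = record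
  { order = numbering
  ; regular = λ x → ≡.subst (HasSize _) (degree (from x))
      (sub-size numbering (x ~_) (proj₁ ~-resp) (lookup table (from x)) (row⇔ x))
  ; adjacent = λ x y x~y → ≡.subst (HasSize _)
      (≡.trans (common′ (from x) (from y) (λ eq → ~-irrefl (from-injective eq) x~y))
        (cong (if_then l else m) (T⇒true (Equivalence.from (row⇔ x (from y))
          (proj₁ ~-resp (S.sym (strictlyInverseˡ y)) x~y)))))
      (commonSize x y)
  ; nonadjacent = λ x y x≉y x≁y → ≡.subst (HasSize _)
      (≡.trans (common′ (from x) (from y) (λ eq → x≉y (from-injective eq)))
        (cong (if_then l else m) (¬T⇒false λ p → x≁y (proj₁ ~-resp (strictlyInverseˡ y)
          (Equivalence.to (row⇔ x (from y)) p)))))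
      (commonSize x y) }
  where
  open Graph G
  open Tabulated G-tab
  open Inverse numbering
  module S = Setoid vertices
  T⇒true : ∀ {b} → T b → b ≡ true
  T⇒true {true} _ = refl
  ¬T⇒false : ∀ {b} → ¬ T b → b ≡ false
  ¬T⇒false {true}  ¬p = contradiction _ ¬p
  ¬T⇒false {false} _  = refl
  common′ : ∀ i j → i ≢ j → countTrue (zipWith _∧_ (lookup table i) (lookup table j)) ≡ (if entry table i j then l else m)
  common′ i j i≢j with Fin.<-cmp i j
  ... | tri< i<j _ _ = ≡.trans (countTrue-∧ (lookup table i) (lookup table j)) (common i j i<j)
  ... | tri≈ _ i≡j _ = contradiction i≡j i≢j
  ... | tri> _ _ j<i = ≡.trans (countTrue-∧ (lookup table i) (lookup table j))
          (≡.trans (countBoth-comm (lookup table i) (lookup table j))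
          (≡.trans (common j i j<i) (cong (if_then l else m) (T-injective (symmetric j i) (symmetric i j)))))
    where
    symmetric : ∀ i j → T (entry table i j) → T (entry table j i)
    symmetric i j p = Equivalence.from (table⇔ j i) (~-sym (Equivalence.to (table⇔ i j) p))
  row⇔ : ∀ x i → T (entry table (from x) i) ⇔ (x ~ to i)
  row⇔ x i = mk⇔ (λ p → proj₂ ~-resp (strictlyInverseˡ x) (Equivalence.to (table⇔ (from x) i) p))
                 (λ p → Equivalence.from (table⇔ (from x) i) (proj₂ ~-resp (S.sym (strictlyInverseˡ x)) p))
  from-injective : ∀ {x y} → from x ≡ from y → x ≈ y
  from-injective {x} {y} eq = S.trans (S.sym (strictlyInverseˡ x)) (S.trans (to-cong eq) (strictlyInverseˡ y))
  commonSize : ∀ x y → HasSize (Sub vertices (λ z → x ~ z × y ~ z))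
                               (countTrue (zipWith _∧_ (lookup table (from x)) (lookup table (from y))))
  commonSize x y = sub-size numbering (λ z → x ~ z × y ~ z)
    (λ eq (p , q) → proj₁ ~-resp eq p , proj₁ ~-resp eq q)
    (zipWith _∧_ (lookup table (from x)) (lookup table (from y)))
    (lookup-∧⇔ (lookup table (from x)) (lookup table (from y)) (row⇔ x) (row⇔ y))

-- Completions of nonadjacent pairs

-- The isomorphism invariant: z is adjacent to all common neighbours of x and y.  In G-E₈ every
-- nonadjacent pair x, y has such a z, namely the third line spanned by roots in their plane.
Completes : ∀ {n} → Table n → (i j k : Fin n) → Set
Completes t i j k = k ≢ i × k ≢ j × (∀ l → T (entry t i l) → T (entry t j l) → T (entry t k l))

Completable : ∀ {n} → Table n → Set
Completable t = ∀ i j → i ≢ j → ¬ T (entry t i j) → ∃[ k ] Completes t i j k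

completes? : ∀ {n} (t : Table n) i j k → Dec (Completes t i j k)
completes? t i j k = ¬? (k Fin.≟ i) ×-dec ¬? (k Fin.≟ j) ×-dec
  map′ (λ h l p q → h l (T-∧⁺ (p , q))) (λ h l p → let q , r = T-∧⁻ (entry t i l) p in h l q r)
    (Fin.all? λ l → Bool.T? (entry t i l ∧ entry t j l) →-dec Bool.T? (entry t k l))

completion-transport : ∀ {G H n} (G-tab : Tabulated G n) (H-tab : Tabulated H n) → Isomorphic G H →
  Completable (Tabulated.table G-tab) → Completable (Tabulated.table H-tab)
completion-transport {G} {H} G-tab H-tab iso hyp i j i≢j i≁j =
  let k , k≢ , k≢′ , closed = hyp (σ i) (σ j) (i≢j ∘ σ-injective) (i≁j ∘ Equivalence.from (σ⇔ i j))
      k≡ = σρ k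
  in ρ k , (λ eq → k≢ (≡.trans (≡.sym k≡) (cong σ eq)))
         , (λ eq → k≢′ (≡.trans (≡.sym k≡) (cong σ eq)))
         , λ l p q → Equivalence.from (σ⇔ (ρ k) l) (≡.subst (λ a → T (entry G.table a (σ l))) (≡.sym k≡)
             (closed (σ l) (Equivalence.to (σ⇔ i l) p) (Equivalence.to (σ⇔ j l) q)))
  where
  module G = Tabulated G-tab
  module H = Tabulated H-tab
  module GG = Graph G
  module HH = Graph H
  open Isomorphic iso
  module N = Inverse (H.numbering ⟨∘⟩ (inverse-sym bijection ⟨∘⟩ inverse-sym G.numbering))
  σ = N.to
  ρ = N.from
  σρ : ∀ k → σ (ρ k) ≡ k
  σρ = N.strictlyInverseˡ
  σ-injective : ∀ {i j} → σ i ≡ σ j → i ≡ j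
  σ-injective {i} {j} eq = ≡.trans (≡.sym (N.strictlyInverseʳ i)) (≡.trans (cong ρ eq) (N.strictlyInverseʳ j))
  bij = Inverse.to bijection
  G-to = Inverse.to G.numbering
  H-to = Inverse.to H.numbering
  bij-σ : ∀ i → bij (G-to (σ i)) HH.≈ H-to i
  bij-σ i = Setoid.trans HH.vertices
    (Inverse.to-cong bijection (Inverse.strictlyInverseˡ G.numbering (Inverse.from bijection (H-to i))))
    (Inverse.strictlyInverseˡ bijection (H-to i))
  σ⇔ : ∀ i j → T (entry H.table i j) ⇔ T (entry G.table (σ i) (σ j))
  σ⇔ i j = mk⇔
    (λ p → Equivalence.from (G.table⇔ (σ i) (σ j)) (Equivalence.from (preserves _ _)
       (proj₁ HH.~-resp (Setoid.sym HH.vertices (bij-σ j)) (proj₂ HH.~-resp (Setoid.sym HH.vertices (bij-σ i))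
         (Equivalence.to (H.table⇔ i j) p)))))
    (λ p → Equivalence.from (H.table⇔ i j) (proj₁ HH.~-resp (bij-σ j) (proj₂ HH.~-resp (bij-σ i)
         (Equivalence.to (preserves _ _) (Equivalence.to (G.table⇔ (σ i) (σ j)) p)))))

-- The 120 lines of E₈ in 15 frames

-- Multiplication by the v-th octonion unit, up to sign: the Pauli operator whose value at x has
-- coordinates (-1)^(v · i) x (i ⊕ β v), where i, v ∈ 𝔽₂³ and β = 0 1 3 6 7 4 5 2.
octonion : ∀ {A : Set} → (A → A) → Fin 8 → Vec A 8 → Vec A 8
octonion - 0F x = x
octonion - 1F (a ∷ b ∷ c ∷ d ∷ e ∷ f ∷ g ∷ h ∷ []) =
  b ∷ - a ∷ d ∷ - c ∷ f ∷ - e ∷ h ∷ - g ∷ []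
octonion - 2F (a ∷ b ∷ c ∷ d ∷ e ∷ f ∷ g ∷ h ∷ []) =
  d ∷ c ∷ - b ∷ - a ∷ h ∷ g ∷ - f ∷ - e ∷ []
octonion - 3F (a ∷ b ∷ c ∷ d ∷ e ∷ f ∷ g ∷ h ∷ []) =
  g ∷ - h ∷ - e ∷ f ∷ c ∷ - d ∷ - a ∷ b ∷ []
octonion - 4F (a ∷ b ∷ c ∷ d ∷ e ∷ f ∷ g ∷ h ∷ []) =
  h ∷ g ∷ f ∷ e ∷ - d ∷ - c ∷ - b ∷ - a ∷ []
octonion - 5F (a ∷ b ∷ c ∷ d ∷ e ∷ f ∷ g ∷ h ∷ []) =
  e ∷ - f ∷ g ∷ - h ∷ - a ∷ b ∷ - c ∷ d ∷ []
octonion - 6F (a ∷ b ∷ c ∷ d ∷ e ∷ f ∷ g ∷ h ∷ []) =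
  f ∷ e ∷ - h ∷ - g ∷ - b ∷ - a ∷ d ∷ c ∷ []
octonion - 7F (a ∷ b ∷ c ∷ d ∷ e ∷ f ∷ g ∷ h ∷ []) =
  c ∷ - d ∷ - a ∷ b ∷ - g ∷ h ∷ e ∷ - f ∷ []

-- One root from each frame; the octonion units produce the other seven lines. The order matches
-- `codePermutations`, so that the line of the c-th root has stabiliser H_c.
frameRoots : Vec ℤ⁸ 15
frameRoots
  = (1ℤ ∷ 1ℤ ∷ 1ℤ ∷ 1ℤ ∷ 1ℤ ∷ 1ℤ ∷ 1ℤ ∷ 1ℤ ∷ [])
  ∷ (1ℤ ∷ 0ℤ ∷ 0ℤ ∷ 0ℤ ∷ 1ℤ ∷ 0ℤ ∷ 0ℤ ∷ 0ℤ ∷ [])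
  ∷ (1ℤ ∷ 1ℤ ∷ 1ℤ ∷ -1ℤ ∷ 1ℤ ∷ 1ℤ ∷ 1ℤ ∷ -1ℤ ∷ [])
  ∷ (1ℤ ∷ 1ℤ ∷ 1ℤ ∷ -1ℤ ∷ 1ℤ ∷ -1ℤ ∷ 1ℤ ∷ 1ℤ ∷ [])
  ∷ (1ℤ ∷ 1ℤ ∷ 1ℤ ∷ 1ℤ ∷ 1ℤ ∷ -1ℤ ∷ -1ℤ ∷ 1ℤ ∷ [])
  ∷ (1ℤ ∷ 0ℤ ∷ 0ℤ ∷ 0ℤ ∷ 0ℤ ∷ 1ℤ ∷ 0ℤ ∷ 0ℤ ∷ [])
  ∷ (1ℤ ∷ 0ℤ ∷ 0ℤ ∷ 0ℤ ∷ 0ℤ ∷ 0ℤ ∷ 1ℤ ∷ 0ℤ ∷ [])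
  ∷ (1ℤ ∷ 1ℤ ∷ 0ℤ ∷ 0ℤ ∷ 0ℤ ∷ 0ℤ ∷ 0ℤ ∷ 0ℤ ∷ [])
  ∷ (1ℤ ∷ 0ℤ ∷ 0ℤ ∷ 0ℤ ∷ 0ℤ ∷ 0ℤ ∷ 0ℤ ∷ 1ℤ ∷ [])
  ∷ (1ℤ ∷ 1ℤ ∷ 1ℤ ∷ -1ℤ ∷ 1ℤ ∷ -1ℤ ∷ -1ℤ ∷ -1ℤ ∷ [])
  ∷ (1ℤ ∷ 1ℤ ∷ 1ℤ ∷ -1ℤ ∷ 1ℤ ∷ 1ℤ ∷ -1ℤ ∷ 1ℤ ∷ [])
  ∷ (1ℤ ∷ 0ℤ ∷ 1ℤ ∷ 0ℤ ∷ 0ℤ ∷ 0ℤ ∷ 0ℤ ∷ 0ℤ ∷ [])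
  ∷ (1ℤ ∷ 1ℤ ∷ 1ℤ ∷ 1ℤ ∷ 1ℤ ∷ 1ℤ ∷ -1ℤ ∷ -1ℤ ∷ [])
  ∷ (1ℤ ∷ 0ℤ ∷ 0ℤ ∷ 1ℤ ∷ 0ℤ ∷ 0ℤ ∷ 0ℤ ∷ 0ℤ ∷ [])
  ∷ (1ℤ ∷ 1ℤ ∷ 1ℤ ∷ 1ℤ ∷ 1ℤ ∷ -1ℤ ∷ 1ℤ ∷ -1ℤ ∷ [])
  ∷ []

root : Fin 15 → Fin 8 → ℤ⁸
root c v = octonion (λ z → ℤ.- z) v (lookup frameRoots c)

rootAt : Fin 120 → ℤ⁸
rootAt i = uncurry root (Fin.remQuot {15} 8 i)

infix 4 _≟⁸_ _≈±_ _≈±?_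

_≟⁸_ : (x y : ℤ⁸) → Dec (x ≡ y)
_≟⁸_ = Vec.≡-dec ℤ._≟_

_≈±_ : ℤ⁸ → ℤ⁸ → Set
x ≈± y = x ≡ y ⊎ x ≡ neg y

_≈±?_ : ∀ x y → Dec (x ≈± y)
x ≈±? y = (x ≟⁸ y) ⊎-dec (x ≟⁸ neg y)

pairVector : Fin 8 → Fin 8 → Sign → Sign → ℤ⁸
pairVector i j s t = zipWith ℤ._+_ (±e s i) (±e t j)

anySign? : ∀ {P : Sign → Set} → (∀ s → Dec (P s)) → Dec (∃[ s ] P s)
anySign? P? = map′ [ (Sign.+ ,_) , (Sign.- ,_) ]′ (λ { (Sign.+ , p) → inj₁ p ; (Sign.- , p) → inj₂ p })
  (P? Sign.+ ⊎-dec P? Sign.-)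

allSign? : ∀ {P : Sign → Set} → (∀ s → Dec (P s)) → Dec (∀ s → P s)
allSign? P? = map′ (λ { (p , q) Sign.+ → p ; (p , q) Sign.- → q }) (λ f → f Sign.+ , f Sign.-)
  (P? Sign.+ ×-dec P? Sign.-)

allSigns? : ∀ {n} {P : Vec Sign n → Set} → (∀ s → Dec (P s)) → Dec (∀ s → P s)
allSigns? {zero}  P? = map′ (λ { p [] → p }) (λ f → f []) (P? [])
allSigns? {suc n} P? = map′ (λ { f (s ∷ ss) → f s ss }) (λ f s ss → f (s ∷ ss))
  (allSign? λ s → allSigns? λ ss → P? (s ∷ ss))

isRoot? : ∀ x → Dec (IsRoot x)
isRoot? x = map′
  [ (λ (ps , eq) → full ps eq) , (λ { (i , j , i<j , s , t , refl) → pair i<j s t }) ]′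
  (λ { (full ps eq) → inj₁ (ps , eq) ; (pair {i} {j} i<j s t) → inj₂ (i , j , i<j , s , t , refl) })
  ((All.all? (λ z → (z ℤ.≟ 1ℤ) ⊎-dec (z ℤ.≟ -1ℤ)) x ×-dec (Vec.foldr _ ℤ._*_ 1ℤ x ℤ.≟ 1ℤ))
   ⊎-dec (Fin.any? λ i → Fin.any? λ j → i Fin.<? j ×-dec
           (anySign? λ s → anySign? λ t → x ≟⁸ pairVector i j s t)))

rootAt-isRoot : ∀ i → IsRoot (rootAt i)
rootAt-isRoot = from-yes (Fin.all? λ i → isRoot? (rootAt i))

signVector : Vec Sign 8 → ℤ⁸
signVector = Vec.map (_◃ 1)

Listed : Vec ℤ⁸ 120 → ℤ⁸ → Set
Listed rs x = ∃[ i ] lookup rs i ≈± x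

listed? : ∀ rs x → Dec (Listed rs x)
listed? rs x = Fin.any? λ i → lookup rs i ≈±? x

pairs-listed : ∀ s t i j → i Fin.< j → Listed (tabulate rootAt) (pairVector i j s t)
pairs-listed = from-yes (check (tabulate rootAt))
  where
  check : ∀ rs → Dec (∀ s t i j → i Fin.< j → Listed rs (pairVector i j s t))
  check rs = allSign? λ s → allSign? λ t → Fin.all? λ i → Fin.all? λ j → (i Fin.<? j) →-dec listed? rs _

fulls-listed : ∀ s → Vec.foldr _ ℤ._*_ 1ℤ (signVector s) ≡ 1ℤ → Listed (tabulate rootAt) (signVector s)
fulls-listed = from-yes (check (tabulate rootAt))
  where
  check : ∀ rs → Dec (∀ s → Vec.foldr _ ℤ._*_ 1ℤ (signVector s) ≡ 1ℤ → Listed rs (signVector s))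
  check rs = allSigns? λ s → (Vec.foldr _ ℤ._*_ 1ℤ (signVector s) ℤ.≟ 1ℤ) →-dec listed? rs (signVector s)

all±1⇒signVector : ∀ {n} {x : Vec ℤ n} → All (λ z → z ≡ 1ℤ ⊎ z ≡ -1ℤ) x → ∃[ s ] x ≡ Vec.map (_◃ 1) s
all±1⇒signVector []               = [] , refl
all±1⇒signVector (inj₁ refl ∷ ps) = let s , eq = all±1⇒signVector ps in Sign.+ ∷ s , cong (1ℤ ∷_) eq
all±1⇒signVector (inj₂ refl ∷ ps) = let s , eq = all±1⇒signVector ps in Sign.- ∷ s , cong (-1ℤ ∷_) eq

rootAt-surjective : ∀ {x} → IsRoot x → ∃[ i ] rootAt i ≈± x
rootAt-surjective {x} r = let i , p = listed r in i , ≡.subst (_≈± x) (Vec.lookup∘tabulate rootAt i) p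
  where
  listed : ∀ {x} → IsRoot x → Listed (tabulate rootAt) x
  listed (pair {i} {j} i<j s t) = pairs-listed s t i j i<j
  listed (full ps eq) = let s , x≡ = all±1⇒signVector ps in
    ≡.subst (Listed (tabulate rootAt)) (≡.sym x≡) (fulls-listed s (≡.trans (cong (Vec.foldr _ ℤ._*_ 1ℤ) (≡.sym x≡)) eq))

orthogonal? : ∀ x y → Dec (⟨ x , y ⟩ ≡ 0ℤ)
orthogonal? x y = ⟨ x , y ⟩ ℤ.≟ 0ℤ

gram : ∀ {n} → Vec ℤ⁸ n → Table n
gram rs = Vec.map (λ x → Vec.map (λ y → does (orthogonal? x y)) rs) rs

entry-gram : ∀ {n} (rs : Vec ℤ⁸ n) i j → entry (gram rs) i j ≡ does (orthogonal? (lookup rs i) (lookup rs j))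
entry-gram rs i j = ≡.trans (cong (λ r → lookup r j) (Vec.lookup-map i _ rs)) (Vec.lookup-map j _ rs)

-- The inclusion of the common neighbours in the third row, decided in one pass.
closed : ∀ {n} (r s q : Vec Bool n) → Bool
closed []          []          []          = true
closed (true ∷ r)  (true ∷ s)  (true ∷ q)  = closed r s q
closed (true ∷ r)  (true ∷ s)  (false ∷ q) = false
closed (true ∷ r)  (false ∷ s) (_ ∷ q)     = closed r s q
closed (false ∷ r) (_ ∷ s)     (_ ∷ q)     = closed r s q

closed-sound : ∀ {n} (r s q : Vec Bool n) → T (closed r s q) → ∀ l → T (lookup r l) → T (lookup s l) → T (lookup q l)
closed-sound (true ∷ r)  (true ∷ s)  (true ∷ q)  p zero    _ _ = _
closed-sound (true ∷ r)  (true ∷ s)  (true ∷ q)  p (suc l) = closed-sound r s q p l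
closed-sound (true ∷ r)  (false ∷ s) (_ ∷ q)     p (suc l) = closed-sound r s q p l
closed-sound (false ∷ r) (_ ∷ s)     (_ ∷ q)     p (suc l) = closed-sound r s q p l

Row : Set
Row = Vec Bool 120

Frames : Set
Frames = Vec (Vec Row 8) 15

frames : Table 120 → Frames
frames t = tabulate λ c → tabulate λ v → lookup t (Fin.combine c v)

lookup-frames : ∀ t c v → lookup (lookup (frames t) c) v ≡ lookup t (Fin.combine c v)
lookup-frames t c v = ≡.trans
  (cong (λ F → lookup F v) (Vec.lookup∘tabulate (λ c → tabulate λ v → lookup t (Fin.combine c v)) c))
  (Vec.lookup∘tabulate (λ v → lookup t (Fin.combine c v)) v)

-- The decision procedures take rows as arguments, so that the rows are evaluated only once.
Cliques : Frames → Set
Cliques F = ∀ c v w → v ≢ w → T (lookup (lookup (lookup F c) v) (Fin.combine c w))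

cliques? : ∀ F → Dec (Cliques F)
cliques? F = Fin.all? λ c → Fin.all? λ v → Fin.all? λ w →
  ¬? (v Fin.≟ w) →-dec Bool.T? (lookup (lookup (lookup F c) v) (Fin.combine c w))

-- For nonorthogonal lines of two frames c and d, the third line can be found in a frame e that
-- depends only on c and d. The search for it is thereby confined to eight lines.
ThirdFrame : Frames → (c d e : Fin 15) → Set
ThirdFrame F c d e = ∀ v w → ¬ T (lookup (lookup (lookup F c) v) (Fin.combine d w)) →
  ∃[ x ] T (closed (lookup (lookup F c) v) (lookup (lookup F d) w) (lookup (lookup F e) x))

thirdFrame? : ∀ F c d e → Dec (ThirdFrame F c d e)
thirdFrame? F c d e = Fin.all? λ v → row? (lookup (lookup F c) v) (lookup F d) (lookup F e)
  where
  pair? : ∀ (r s : Row) (Fe : Vec Row 8) → Dec (∃[ x ] T (closed r s (lookup Fe x)))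
  pair? r s Fe = Fin.any? λ x → Bool.T? (closed r s (lookup Fe x))
  row? : ∀ (r : Row) (Fd Fe : Vec Row 8) →
         Dec (∀ w → ¬ T (lookup r (Fin.combine d w)) → ∃[ x ] T (closed r (lookup Fd w) (lookup Fe x)))
  row? r Fd Fe = Fin.all? λ w → ¬? (Bool.T? (lookup r (Fin.combine d w))) →-dec pair? r (lookup Fd w) Fe

Thirds : Frames → Set
Thirds F = ∀ c d → c Fin.< d → ∃[ e ] e ≢ c × e ≢ d × ThirdFrame F c d e

thirds? : ∀ F → Dec (Thirds F)
thirds? F = Fin.all? λ c → Fin.all? λ d → (c Fin.<? d) →-dec
  (Fin.any? λ e → ¬? (e Fin.≟ c) ×-dec ¬? (e Fin.≟ d) ×-dec thirdFrame? F c d e)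

opaque
  E₈-table : Table 120
  E₈-table = gram (tabulate rootAt)

  entry-E₈ : ∀ i j → entry E₈-table i j ≡ does (orthogonal? (rootAt i) (rootAt j))
  entry-E₈ i j = ≡.trans (entry-gram (tabulate rootAt) i j)
    (cong₂ (λ x y → does (orthogonal? x y)) (Vec.lookup∘tabulate rootAt i) (Vec.lookup∘tabulate rootAt j))

  E₈-facts : RegularTable E₈-table 63 30 36 × Cliques (frames E₈-table) × Thirds (frames E₈-table)
  E₈-facts = from-yes (check E₈-table)
    where
    check : ∀ t → Dec (RegularTable t 63 30 36 × Cliques (frames t) × Thirds (frames t))
    check t = regularTable? t 63 30 36 ×-dec (cliques? (frames t) ×-dec thirds? (frames t))

E₈-regular : RegularTable E₈-table 63 30 36
E₈-regular = proj₁ E₈-facts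

E₈-cliques : ∀ c v w → v ≢ w → T (entry E₈-table (Fin.combine c v) (Fin.combine c w))
E₈-cliques c v w v≢w = ≡.subst (λ r → T (lookup r (Fin.combine c w))) (lookup-frames E₈-table c v)
  (proj₁ (proj₂ E₈-facts) c v w v≢w)

E₈-table⇔ : ∀ i j → T (entry E₈-table i j) ⇔ (⟨ rootAt i , rootAt j ⟩ ≡ 0ℤ)
E₈-table⇔ i j = ≡.subst (λ b → T b ⇔ (⟨ rootAt i , rootAt j ⟩ ≡ 0ℤ)) (≡.sym (entry-E₈ i j))
  (T-does (orthogonal? (rootAt i) (rootAt j)))

vertexE₈ : Fin 120 → Root
vertexE₈ i = rootAt i , rootAt-isRoot i

-- Proportional roots have the same 63 orthogonal lines, whereas two different rows of the table
-- share only 30 or 36.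
rootAt-injective : ∀ {i j} → rootAt i ≈± rootAt j → i ≡ j
rootAt-injective {i} {j} eq = rows-distinct E₈-table (proj₁ E₈-regular) distinct i j λ l →
  T-injective (move i j eq l) (move j i (Setoid.sym vertices {vertexE₈ i} {vertexE₈ j} eq) l)
  where
  open Graph G-E₈
  distinct : ∀ i j → i Fin.< j → countBoth (lookup E₈-table i) (lookup E₈-table j) ≢ 63
  distinct i j i<j eq = small (entry E₈-table i j) (≡.trans (≡.sym (proj₂ E₈-regular i j i<j)) eq)
    where
    small : ∀ b → (if b then 30 else 36) ≢ 63
    small true  ()
    small false ()
  move : ∀ i j → rootAt i ≈± rootAt j → ∀ l → T (entry E₈-table i l) → T (entry E₈-table j l)
  move i j eq l p = Equivalence.from (E₈-table⇔ j l)
    (proj₂ ~-resp {vertexE₈ l} {vertexE₈ i} {vertexE₈ j} eq (Equivalence.to (E₈-table⇔ i l) p))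

G-E₈-tabulated : Tabulated G-E₈ 120
G-E₈-tabulated = record
  { numbering = enumerate (Graph.vertices G-E₈) vertexE₈ rootAt-injective (λ (x , r) → rootAt-surjective r)
  ; table = E₈-table
  ; table⇔ = E₈-table⇔ }

-- Two lines of one frame are orthogonal, so a nonorthogonal pair comes from two frames, and a third
-- frame supplies the line. That it differs from both given lines is clear from its frame.
E₈-completable : Completable E₈-table
E₈-completable i j i≢j i≁j = ≡.subst₂ (λ i j → ∃[ k ] Completes E₈-table i j k)
  (Fin.combine-remQuot {15} 8 i) (Fin.combine-remQuot {15} 8 j)
  (complete (Fin.quotient {15} 8 i) (Fin.remainder {15} 8 i) (Fin.quotient {15} 8 j) (Fin.remainder {15} 8 j)
    (λ eq → i≢j (≡.trans (≡.sym (Fin.combine-remQuot {15} 8 i)) (≡.trans eq (Fin.combine-remQuot {15} 8 j))))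
    (i≁j ∘ ≡.subst₂ (λ i j → T (entry E₈-table i j)) (Fin.combine-remQuot {15} 8 i) (Fin.combine-remQuot {15} 8 j)))
  where
  open Graph G-E₈ using (~-sym)
  ordered : ∀ c v d w → c Fin.< d → ¬ T (entry E₈-table (Fin.combine c v) (Fin.combine d w)) →
            ∃[ k ] Completes E₈-table (Fin.combine c v) (Fin.combine d w) k
  ordered c v d w c<d ≁ =
    let e , e≢c , e≢d , third = proj₂ (proj₂ E₈-facts) c d c<d
        x , p = third v w (≁ ∘ ≡.subst (λ r → T (lookup r (Fin.combine d w))) (lookup-frames E₈-table c v))
    in Fin.combine e x , (λ eq → e≢c (Fin.combine-injectiveˡ e x c v eq)) , (λ eq → e≢d (Fin.combine-injectiveˡ e x d w eq)) ,
       closed-sound (row c v) (row d w) (row e x)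
         (≡.subst T (≡.trans (cong₂ (λ r s → closed r s (lookup (lookup (frames E₈-table) e) x))
           (lookup-frames E₈-table c v) (lookup-frames E₈-table d w))
           (cong (closed (row c v) (row d w)) (lookup-frames E₈-table e x))) p)
    where
    row : Fin 15 → Fin 8 → Row
    row c v = lookup E₈-table (Fin.combine c v)
  complete : ∀ c v d w → Fin.combine c v ≢ Fin.combine d w → ¬ T (entry E₈-table (Fin.combine c v) (Fin.combine d w)) →
             ∃[ k ] Completes E₈-table (Fin.combine c v) (Fin.combine d w) k
  complete c v d w ≢ ≁ with Fin.<-cmp c d
  ... | tri< c<d _ _ = ordered c v d w c<d ≁
  ... | tri≈ _ refl _ = contradiction (E₈-cliques c v w (λ { refl → ≢ refl })) ≁
  ... | tri> _ _ d<c = let k , k≢ , k≢′ , closed = ordered d w c v d<c (≁ ∘ symmetric (Fin.combine d w) (Fin.combine c v)) in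
          k , k≢′ , k≢ , λ l p q → closed l q p
    where
    symmetric : ∀ i j → T (entry E₈-table i j) → T (entry E₈-table j i)
    symmetric i j p = Equivalence.from (E₈-table⇔ j i)
      (~-sym {vertexE₈ i} {vertexE₈ j} (Equivalence.to (E₈-table⇔ i j) p))

_≟ʷ_ : (x y : 𝔽₂⁸) → Dec (x ≡ y)
_≟ʷ_ = Vec.≡-dec ℙ._≟_

open DecMembership _≟ʷ_ using (_∈?_)

-- The parity of a permutation

bit : Bool → Parity
bit b = if b then 1ℙ else 0ℙ

_<ᵇ_ : ∀ {n} → Fin n → Fin n → Bool
i <ᵇ j = does (i Fin.<? j)

<ᵇ-irrefl : ∀ {n} (i : Fin n) → (i <ᵇ i) ≡ false
<ᵇ-irrefl i = dec-false (i Fin.<? i) (Fin.<-irrefl refl)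

<ᵇ-flip : ∀ {n} {i j : Fin n} → i ≢ j → (j <ᵇ i) ≡ not (i <ᵇ j)
<ᵇ-flip {i = i} {j} i≢j with Fin.<-cmp i j
... | tri< i<j _ j≮i = ≡.trans (dec-false (j Fin.<? i) j≮i) (cong not (≡.sym (dec-true (i Fin.<? j) i<j)))
... | tri≈ _ i≡j _   = contradiction i≡j i≢j
... | tri> i≮j _ j<i = ≡.trans (dec-true (j Fin.<? i) j<i) (cong not (≡.sym (dec-false (i Fin.<? j) i≮j)))

sum² : ∀ {n} → (Fin n → Fin n → Parity) → Parity
sum² f = sumℙ λ i → sumℙ λ j → f i j

sum²-cong : ∀ {n} {f g : Fin n → Fin n → Parity} → (∀ i j → f i j ≡ g i j) → sum² f ≡ sum² g
sum²-cong eq = sumℙ-cong λ i → sumℙ-cong λ j → eq i j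

sum²-+ : ∀ {n} (f g : Fin n → Fin n → Parity) → sum² (λ i j → f i j ℙ.+ g i j) ≡ sum² f ℙ.+ sum² g
sum²-+ f g = ≡.trans (sumℙ-cong λ i → sumℙ-+ (f i) (g i)) (sumℙ-+ (λ i → sumℙ (f i)) (λ i → sumℙ (g i)))

sum²-permute : ∀ {n} (f : Fin n → Fin n → Parity) (π : Permutation′ n) →
               sum² f ≡ sum² (λ i j → f (π ⟨$⟩ʳ i) (π ⟨$⟩ʳ j))
sum²-permute f π = ≡.trans (sumℙ-permute (λ i → sumℙ (f i)) π) (sumℙ-cong λ i → sumℙ-permute (f (π ⟨$⟩ʳ i)) π)

-- The inversions are summed in 𝔽₂, where only the parity survives and double sums can be split and
-- reindexed freely.
sign : ∀ {n} → Permutation′ n → Parity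
sign π = sum² λ i j → bit ((i <ᵇ j) ∧ ((π ⟨$⟩ʳ j) <ᵇ (π ⟨$⟩ʳ i)))

parity-sum : ∀ {n} (f : Fin n → ℕ) → parity (sumℕ f) ≡ sumℙ (parity ∘ f)
parity-sum {zero}  f = refl
parity-sum {suc n} f = ≡.trans (ℙ.+-homo-+ (f zero) _) (cong (parity (f zero) ℙ.+_) (parity-sum (f ∘ suc)))

parity-inversions : ∀ {n} (π : Permutation′ n) → parity (inversions π) ≡ sign π
parity-inversions {n} π = ≡.trans (parity-sum (λ i → sumℕ (f i))) (sumℙ-cong λ i →
  ≡.trans (parity-sum (f i)) (sumℙ-cong λ j → parity-if ((i <ᵇ j) ∧ ((π ⟨$⟩ʳ j) <ᵇ (π ⟨$⟩ʳ i)))))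
  where
  f : Fin n → Fin n → ℕ
  f i j = if (i <ᵇ j) ∧ ((π ⟨$⟩ʳ j) <ᵇ (π ⟨$⟩ʳ i)) then 1 else 0
  parity-if : ∀ b → parity (if b then 1 else 0) ≡ bit b
  parity-if true  = refl
  parity-if false = refl

even⇒sign : ∀ {n} (π : Permutation′ n) → IsEven π → sign π ≡ 0ℙ
even⇒sign π (divides q eq) = ≡.trans (≡.sym (parity-inversions π)) (≡.trans (cong parity eq)
  (≡.trans (ℙ.*-homo-* q 2) (ℙ.*-comm (parity q) 0ℙ)))

sign-cong : ∀ {n} {π σ : Permutation′ n} → (∀ i → π ⟨$⟩ʳ i ≡ σ ⟨$⟩ʳ i) → sign π ≡ sign σ
sign-cong eq = sum²-cong λ i j → cong₂ (λ p q → bit ((i <ᵇ j) ∧ (q <ᵇ p))) (eq i) (eq j)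

-- An unordered pair {i , j} is inverted by π ∘ₚ σ iff it is inverted by exactly one of π (as
-- {i , j}) and σ (as {π i , π j}).
sign-∘ₚ : ∀ {n} (π σ : Permutation′ n) → sign (π ∘ₚ σ) ≡ sign π ℙ.+ sign σ
sign-∘ₚ {n} π σ = ≡.trans (sum²-cong pointwise) (≡.trans (sum²-+ P (λ i j → bit (i <ᵇ j) ℙ.* (F i j ℙ.+ F j i)))
    (cong (sign π ℙ.+_) (≡.sym signσ)))
  where
  p : Fin n → Fin n
  p i = π ⟨$⟩ʳ i
  s : Fin n → Fin n
  s i = σ ⟨$⟩ʳ (π ⟨$⟩ʳ i)
  P F : Fin n → Fin n → Parity
  P i j = bit ((i <ᵇ j) ∧ (p j <ᵇ p i))
  F i j = bit ((p i <ᵇ p j) ∧ (s j <ᵇ s i))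
  p-injective : ∀ {i j} → p i ≡ p j → i ≡ j
  p-injective eq = ≡.trans (≡.sym (Perm.inverseˡ π)) (≡.trans (cong (π ⟨$⟩ˡ_) eq) (Perm.inverseˡ π))
  s-injective : ∀ {i j} → s i ≡ s j → i ≡ j
  s-injective eq = p-injective (≡.trans (≡.sym (Perm.inverseˡ σ)) (≡.trans (cong (σ ⟨$⟩ˡ_) eq) (Perm.inverseˡ σ)))
  -- Reindexing by π destroys the order i < j. Splitting by the order of i and j and exchanging the
  -- indices in one part restores a sum over i < j.
  split : ∀ i j → F i j ≡ (bit (i <ᵇ j) ℙ.* F i j) ℙ.+ (bit (j <ᵇ i) ℙ.* F i j)
  split i j with i Fin.≟ j
  ... | yes refl rewrite <ᵇ-irrefl i | <ᵇ-irrefl (p i) = refl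
  ... | no i≢j rewrite <ᵇ-flip i≢j = both (i <ᵇ j) (F i j)
    where
    both : ∀ b q → q ≡ (bit b ℙ.* q) ℙ.+ (bit (not b) ℙ.* q)
    both true  0ℙ = refl
    both true  1ℙ = refl
    both false q  = refl
  signσ : sign σ ≡ sum² (λ i j → bit (i <ᵇ j) ℙ.* (F i j ℙ.+ F j i))
  signσ = begin
    sign σ                                                   ≡⟨ sum²-permute _ π ⟩
    sum² F                                                   ≡⟨ sum²-cong split ⟩
    sum² (λ i j → (bit (i <ᵇ j) ℙ.* F i j) ℙ.+ (bit (j <ᵇ i) ℙ.* F i j))
      ≡⟨ sum²-+ (λ i j → bit (i <ᵇ j) ℙ.* F i j) (λ i j → bit (j <ᵇ i) ℙ.* F i j) ⟩
    sum² (λ i j → bit (i <ᵇ j) ℙ.* F i j) ℙ.+ sum² (λ i j → bit (j <ᵇ i) ℙ.* F i j)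
      ≡⟨ cong (sum² (λ i j → bit (i <ᵇ j) ℙ.* F i j) ℙ.+_) (sumℙ-comm (λ i j → bit (j <ᵇ i) ℙ.* F i j)) ⟩
    sum² (λ i j → bit (i <ᵇ j) ℙ.* F i j) ℙ.+ sum² (λ i j → bit (i <ᵇ j) ℙ.* F j i)
      ≡⟨ sum²-+ (λ i j → bit (i <ᵇ j) ℙ.* F i j) (λ i j → bit (i <ᵇ j) ℙ.* F j i) ⟨
    sum² (λ i j → (bit (i <ᵇ j) ℙ.* F i j) ℙ.+ (bit (i <ᵇ j) ℙ.* F j i))
      ≡⟨ sum²-cong (λ i j → ≡.sym (ℙ.*-distribˡ-+ (bit (i <ᵇ j)) (F i j) (F j i))) ⟩
    sum² (λ i j → bit (i <ᵇ j) ℙ.* (F i j ℙ.+ F j i)) ∎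
    where open ≡.≡-Reasoning
  cases : ∀ x y z → bit (x ∧ not z) ≡ bit (x ∧ not y) ℙ.+ (bit x ℙ.* (bit (y ∧ not z) ℙ.+ bit (not y ∧ z)))
  -- Here x, y and z say whether the pair is in increasing order before π, after π and after both
  -- permutations.
  cases true  true  true  = refl
  cases true  true  false = refl
  cases true  false true  = refl
  cases true  false false = refl
  cases false y     z     = refl
  pointwise : ∀ i j → bit ((i <ᵇ j) ∧ (s j <ᵇ s i)) ≡ P i j ℙ.+ (bit (i <ᵇ j) ℙ.* (F i j ℙ.+ F j i))
  pointwise i j with i Fin.≟ j
  ... | yes refl rewrite <ᵇ-irrefl i = refl
  ... | no i≢j rewrite <ᵇ-flip (i≢j ∘ p-injective) | <ᵇ-flip (i≢j ∘ s-injective) =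
    cases (i <ᵇ j) (p i <ᵇ p j) (s i <ᵇ s j)

-- Linear algebra over 𝔽₂

dotℙ : 𝔽₂⁸ → 𝔽₂⁸ → Parity
dotℙ w x = sumℙ λ i → lookup w i ℙ.* lookup x i

dotℙ-⊕ʳ : ∀ w x y → dotℙ w (x ⊕ y) ≡ dotℙ w x ℙ.+ dotℙ w y
dotℙ-⊕ʳ w x y = ≡.trans
  (sumℙ-cong λ i → ≡.trans (cong (lookup w i ℙ.*_) (Vec.lookup-zipWith ℙ._+_ i x y)) (ℙ.*-distribˡ-+ (lookup w i) (lookup x i) (lookup y i)))
  (sumℙ-+ (λ i → lookup w i ℙ.* lookup x i) (λ i → lookup w i ℙ.* lookup y i))

dotℙ-⊕ˡ : ∀ w u x → dotℙ (w ⊕ u) x ≡ dotℙ w x ℙ.+ dotℙ u x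
dotℙ-⊕ˡ w u x = ≡.trans
  (sumℙ-cong λ i → ≡.trans (cong (ℙ._* lookup x i) (Vec.lookup-zipWith ℙ._+_ i w u)) (ℙ.*-distribʳ-+ (lookup x i) (lookup w i) (lookup u i)))
  (sumℙ-+ (λ i → lookup w i ℙ.* lookup x i) (λ i → lookup u i ℙ.* lookup x i))

dotℙ-permute : ∀ π w x → dotℙ (permute π w) x ≡ dotℙ w (permute (flip π) x)
dotℙ-permute π w x = ≡.trans (sumℙ-permute (λ i → lookup (permute π w) i ℙ.* lookup x i) π) (sumℙ-cong λ i → cong₂ ℙ._*_
  (≡.trans (Vec.lookup∘tabulate (λ i → lookup w (π ⟨$⟩ˡ i)) (π ⟨$⟩ʳ i)) (cong (lookup w) (Perm.inverseˡ π)))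
  (≡.sym (Vec.lookup∘tabulate (λ i → lookup x (π ⟨$⟩ʳ i)) i)))

tabulate-⊕ : ∀ {n} (f g : Fin n → Parity) → tabulate (λ i → f i ℙ.+ g i) ≡ zipWith ℙ._+_ (tabulate f) (tabulate g)
tabulate-⊕ {zero}  f g = refl
tabulate-⊕ {suc n} f g = cong (f zero ℙ.+ g zero ∷_) (tabulate-⊕ (f ∘ suc) (g ∘ suc))

permute-⊕ : ∀ π x y → permute π (x ⊕ y) ≡ permute π x ⊕ permute π y
permute-⊕ π x y = ≡.trans (Vec.tabulate-cong λ i → Vec.lookup-zipWith ℙ._+_ (π ⟨$⟩ˡ i) x y)
  (tabulate-⊕ (λ i → lookup x (π ⟨$⟩ˡ i)) (λ i → lookup y (π ⟨$⟩ˡ i)))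

permute-∘ₚ : ∀ π σ x → permute (π ∘ₚ σ) x ≡ permute σ (permute π x)
permute-∘ₚ π σ x = Vec.tabulate-cong λ i → ≡.sym (Vec.lookup∘tabulate (λ j → lookup x (π ⟨$⟩ˡ j)) (σ ⟨$⟩ˡ i))

permute-cong : ∀ {π σ} → (∀ i → π ⟨$⟩ʳ i ≡ σ ⟨$⟩ʳ i) → ∀ x → permute π x ≡ permute σ x
permute-cong {π} {σ} eq x = Vec.tabulate-cong λ i → cong (lookup x) (≡.trans
  (cong (π ⟨$⟩ˡ_) (≡.sym (≡.trans (eq (σ ⟨$⟩ˡ i)) (Perm.inverseʳ σ)))) (Perm.inverseˡ π))

permute-id : ∀ x → permute Perm.id x ≡ x
permute-id = Vec.tabulate∘lookup

permute-flip : ∀ π x → permute (flip π) (permute π x) ≡ x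
permute-flip π x = ≡.trans (Vec.tabulate-cong λ i → ≡.trans
  (Vec.lookup∘tabulate (λ j → lookup x (π ⟨$⟩ˡ j)) (π ⟨$⟩ʳ i)) (cong (lookup x) (Perm.inverseˡ π)))
  (Vec.tabulate∘lookup x)

𝟎 : 𝔽₂⁸
𝟎 = replicate 8 0ℙ

𝟎⊕ : ∀ x → 𝟎 ⊕ x ≡ x
𝟎⊕ = Vec.zipWith-identityˡ ℙ.+-identityˡ

⊕-comm : ∀ x y → x ⊕ y ≡ y ⊕ x
⊕-comm = Vec.zipWith-comm ℙ.+-comm

⊕-assoc : ∀ x y z → x ⊕ y ⊕ z ≡ x ⊕ (y ⊕ z)
⊕-assoc = Vec.zipWith-assoc ℙ.+-assoc

⊕-self : ∀ {n} (x : Vec Parity n) → zipWith ℙ._+_ x x ≡ replicate n 0ℙ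
⊕-self []      = refl
⊕-self (0ℙ ∷ x) = cong (0ℙ ∷_) (⊕-self x)
⊕-self (1ℙ ∷ x) = cong (0ℙ ∷_) (⊕-self x)

⊕-cancel : ∀ x y → x ⊕ (x ⊕ y) ≡ y
⊕-cancel x y = ≡.trans (≡.sym (⊕-assoc x x y)) (≡.trans (cong (_⊕ y) (⊕-self x)) (𝟎⊕ y))

-- Evenness is read off from the proof component of `act` with the zero translation.
sumZero-permute : ∀ π {x} → SumZero x → SumZero (permute π x)
sumZero-permute π {x} x-even = ≡.subst SumZero (𝟎⊕ (permute π x)) (proj₂ (act π (𝟎 , refl) (x , x-even)))

sumZero-⊕ : ∀ {x y} → SumZero x → SumZero y → SumZero (x ⊕ y)
sumZero-⊕ {x} {y} x-even y-even = ≡.subst (λ z → SumZero (x ⊕ z)) (permute-id y)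
  (proj₂ (act Perm.id (x , x-even) (y , y-even)))

sumZero-𝟏 : ∀ {x} → SumZero x → dotℙ 𝟏 x ≡ 0ℙ
sumZero-𝟏 {x} x-even = ≡.trans (sumℙ-cong λ i → ≡.trans (cong (ℙ._* lookup x i) (Vec.lookup-replicate i 1ℙ)) refl) x-even

Orthogonal : ∀ {k} → Vec 𝔽₂⁸ k → 𝔽₂⁸ → Set
Orthogonal ws x = All (λ w → dotℙ w x ≡ 0ℙ) ws

span : ∀ {k} → Vec 𝔽₂⁸ k → List 𝔽₂⁸
span []       = 𝟎 ∷ []
span (w ∷ ws) = span ws List.++ List.map (w ⊕_) (span ws)

span-orthogonal : ∀ {k} (ws : Vec 𝔽₂⁸ k) x → Orthogonal ws x → ∀ {u} → u ∈ span ws → dotℙ u x ≡ 0ℙ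
span-orthogonal []       x []       (here refl) = dotℙ-𝟎 x
  where
  dotℙ-𝟎 : ∀ x → dotℙ 𝟎 x ≡ 0ℙ
  dotℙ-𝟎 x = begin
    dotℙ 𝟎 x                  ≡⟨ cong (λ z → dotℙ z x) (≡.sym (⊕-self 𝟎)) ⟩
    dotℙ (𝟎 ⊕ 𝟎) x            ≡⟨ dotℙ-⊕ˡ 𝟎 𝟎 x ⟩
    dotℙ 𝟎 x ℙ.+ dotℙ 𝟎 x     ≡⟨ double (dotℙ 𝟎 x) ⟩
    0ℙ                        ∎
    where
    open ≡.≡-Reasoning
    double : ∀ p → p ℙ.+ p ≡ 0ℙ
    double 0ℙ = refl
    double 1ℙ = refl
span-orthogonal (w ∷ ws) x (p ∷ ps) u∈ with ∈-++⁻ (span ws) u∈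
... | inj₁ u∈ws = span-orthogonal ws x ps u∈ws
... | inj₂ u∈map with ∈-map⁻ (w ⊕_) u∈map
...   | v , v∈ , refl = ≡.trans (dotℙ-⊕ˡ w v x) (cong₂ ℙ._+_ p (span-orthogonal ws x ps v∈))

-- The extended Hamming codes

-- Two systems of parity checks that define the same code among the even words.
infix 4 _≅_

_≅_ : ∀ {k} → Vec 𝔽₂⁸ k → Vec 𝔽₂⁸ k → Set
ws ≅ us = ∀ x → SumZero x → Orthogonal ws x ⇔ Orthogonal us x

≅-trans : ∀ {k} {ws us vs : Vec 𝔽₂⁸ k} → ws ≅ us → us ≅ vs → ws ≅ vs
≅-trans p q x x-even = mk⇔ (Equivalence.to (q x x-even) ∘ Equivalence.to (p x x-even))
                           (Equivalence.from (p x x-even) ∘ Equivalence.from (q x x-even))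

orthogonal-permute : ∀ {k} π (ws : Vec 𝔽₂⁸ k) x →
  Orthogonal (Vec.map (permute π) ws) x ⇔ Orthogonal ws (permute (flip π) x)
orthogonal-permute π ws x = mk⇔
  (λ p → All.map (λ {w} → ≡.trans (≡.sym (dotℙ-permute π w x))) (All.map⁻ p))
  (λ p → All.map⁺ (All.map (λ {w} → ≡.trans (dotℙ-permute π w x)) p))

≅-permute : ∀ {k} π {ws us : Vec 𝔽₂⁸ k} → ws ≅ us → Vec.map (permute π) ws ≅ Vec.map (permute π) us
≅-permute π {ws} {us} p x x-even = mk⇔
  (Equivalence.from (orthogonal-permute π us x) ∘ Equivalence.to (p (permute (flip π) x) x′-even) ∘ Equivalence.to (orthogonal-permute π ws x))
  (Equivalence.from (orthogonal-permute π ws x) ∘ Equivalence.from (p (permute (flip π) x) x′-even) ∘ Equivalence.to (orthogonal-permute π us x))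
  where x′-even = sumZero-permute (flip π) {x} x-even

-- Even words satisfy the check 𝟏 automatically, so systems of checks matter only modulo 𝟏.
spanWith𝟏 : ∀ {k} → Vec 𝔽₂⁸ k → List 𝔽₂⁸
spanWith𝟏 ws = span (𝟏 ∷ ws)

⊆span⇒≅ : ∀ {k} {ws us : Vec 𝔽₂⁸ k} → All (_∈ spanWith𝟏 us) ws → All (_∈ spanWith𝟏 ws) us → ws ≅ us
⊆span⇒≅ {ws = ws} {us} p q x x-even = mk⇔
  (λ o → All.map (span-orthogonal (𝟏 ∷ ws) x (sumZero-𝟏 {x} x-even ∷ o)) q)
  (λ o → All.map (span-orthogonal (𝟏 ∷ us) x (sumZero-𝟏 {x} x-even ∷ o)) p)

hammingChecks : Vec 𝔽₂⁸ 3
hammingChecks = (0ℙ ∷ 0ℙ ∷ 0ℙ ∷ 0ℙ ∷ 1ℙ ∷ 1ℙ ∷ 1ℙ ∷ 1ℙ ∷ [])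
              ∷ (0ℙ ∷ 0ℙ ∷ 1ℙ ∷ 1ℙ ∷ 0ℙ ∷ 0ℙ ∷ 1ℙ ∷ 1ℙ ∷ [])
              ∷ (0ℙ ∷ 1ℙ ∷ 0ℙ ∷ 1ℙ ∷ 0ℙ ∷ 1ℙ ∷ 0ℙ ∷ 1ℙ ∷ [])
              ∷ []

inHammingCode⇔ : ∀ x → T (inHammingCode x) ⇔ Orthogonal hammingChecks x
inHammingCode⇔ x = three (dotℙ (lookup hammingChecks 0F) x ℙ.≟ 0ℙ) (dotℙ (lookup hammingChecks 1F) x ℙ.≟ 0ℙ)
    (dotℙ (lookup hammingChecks 2F) x ℙ.≟ 0ℙ)
  where
  three : (d₁ : Dec (dotℙ (lookup hammingChecks 0F) x ≡ 0ℙ)) (d₂ : Dec (dotℙ (lookup hammingChecks 1F) x ≡ 0ℙ))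
          (d₃ : Dec (dotℙ (lookup hammingChecks 2F) x ≡ 0ℙ)) →
          T (does d₁ ∧ does d₂ ∧ does d₃) ⇔ Orthogonal hammingChecks x
  three (yes p) (yes q) (yes r) = mk⇔ (λ _ → p ∷ q ∷ r ∷ []) (λ _ → _)
  three (yes p) (yes q) (no ¬r) = mk⇔ (λ ()) (λ { (_ ∷ _ ∷ r ∷ []) → ¬r r })
  three (yes p) (no ¬q) _       = mk⇔ (λ ()) (λ { (_ ∷ q ∷ _) → ¬q q })
  three (no ¬p) _       _       = mk⇔ (λ ()) (λ { (p ∷ _) → ¬p p })

-- Representatives of the cosets in A₈ of the stabiliser AGL(3,2) of the Hamming code: 20160 / 1344
-- = 15. They can be chosen to fix 0, 1 and 2, since AGL(3,2) is transitive on ordered triples of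
-- distinct points.
codePermutations : Vec (Vec (Fin 8) 8) 15
codePermutations
  = (0F ∷ 1F ∷ 2F ∷ 3F ∷ 4F ∷ 5F ∷ 6F ∷ 7F ∷ [])
  ∷ (0F ∷ 1F ∷ 2F ∷ 3F ∷ 4F ∷ 7F ∷ 5F ∷ 6F ∷ [])
  ∷ (0F ∷ 1F ∷ 2F ∷ 3F ∷ 4F ∷ 6F ∷ 7F ∷ 5F ∷ [])
  ∷ (0F ∷ 1F ∷ 2F ∷ 4F ∷ 3F ∷ 5F ∷ 7F ∷ 6F ∷ [])
  ∷ (0F ∷ 1F ∷ 2F ∷ 4F ∷ 3F ∷ 6F ∷ 5F ∷ 7F ∷ [])
  ∷ (0F ∷ 1F ∷ 2F ∷ 4F ∷ 3F ∷ 7F ∷ 6F ∷ 5F ∷ [])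
  ∷ (0F ∷ 1F ∷ 2F ∷ 5F ∷ 3F ∷ 4F ∷ 6F ∷ 7F ∷ [])
  ∷ (0F ∷ 1F ∷ 2F ∷ 7F ∷ 3F ∷ 4F ∷ 5F ∷ 6F ∷ [])
  ∷ (0F ∷ 1F ∷ 2F ∷ 6F ∷ 3F ∷ 4F ∷ 7F ∷ 5F ∷ [])
  ∷ (0F ∷ 1F ∷ 2F ∷ 5F ∷ 3F ∷ 7F ∷ 4F ∷ 6F ∷ [])
  ∷ (0F ∷ 1F ∷ 2F ∷ 6F ∷ 3F ∷ 5F ∷ 4F ∷ 7F ∷ [])
  ∷ (0F ∷ 1F ∷ 2F ∷ 7F ∷ 3F ∷ 6F ∷ 4F ∷ 5F ∷ [])
  ∷ (0F ∷ 1F ∷ 2F ∷ 5F ∷ 3F ∷ 6F ∷ 7F ∷ 4F ∷ [])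
  ∷ (0F ∷ 1F ∷ 2F ∷ 7F ∷ 3F ∷ 5F ∷ 6F ∷ 4F ∷ [])
  ∷ (0F ∷ 1F ∷ 2F ∷ 6F ∷ 3F ∷ 7F ∷ 5F ∷ 4F ∷ [])
  ∷ []

-- The last index is returned untested when all others fail. This is harmless, because the
-- properties of the tables built with it are verified by evaluation.
search : ∀ {n} → (Fin (suc n) → Bool) → Fin (suc n)
search {zero}  p = zero
search {suc n} p = if p zero then zero else suc (search (p ∘ suc))

codeMap codeMap⁻¹ : Fin 15 → Fin 8 → Fin 8
codeMap   c i = lookup (lookup codePermutations c) i
codeMap⁻¹ c i = search λ j → does (codeMap c j Fin.≟ i)

π : Fin 15 → Permutation′ 8
π c = permutation (codeMap c) (codeMap⁻¹ c)
  (from-yes (Fin.all? λ c → Fin.all? λ i → codeMap c (codeMap⁻¹ c i) Fin.≟ i) c)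
  (from-yes (Fin.all? λ c → Fin.all? λ i → codeMap⁻¹ c (codeMap c i) Fin.≟ i) c)

π-even : ∀ c → IsEven (π c)
π-even = from-yes (Fin.all? λ c → 2 ∣? inversions (π c))

Family : Set
Family = Vec (Vec 𝔽₂⁸ 3) 15

-- Together these are the 30 extended Hamming codes. The odd ones occur because the generating
-- transpositions exchange the two families.
evenCodes oddCodes : Family
evenCodes = tabulate λ c → Vec.map (permute (π c)) hammingChecks
oddCodes  = Vec.map (Vec.map (permute (transpose 0F 1F))) evenCodes

codes : Parity → Family
codes 0ℙ = evenCodes
codes 1ℙ = oddCodes

MapsTo : Permutation′ 8 → Family → Family → Set
MapsTo τ F F′ = ∀ c → ∃[ d ] Vec.map (permute τ) (lookup F c) ≅ lookup F′ d

Spanned : Permutation′ 8 → (F F′ : Family) → Vec (List 𝔽₂⁸) 15 → Set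
Spanned τ F F′ S = ∀ c → ∃[ d ] All (_∈ lookup S d) (Vec.map (permute τ) (lookup F c))
                              × All (_∈ spanWith𝟏 (Vec.map (permute τ) (lookup F c))) (lookup F′ d)

spanned? : ∀ τ F F′ S → Dec (Spanned τ F F′ S)
spanned? τ F F′ S = Fin.all? λ c → find (Vec.map (permute τ) (lookup F c))
  where
  within? : ∀ (L : List 𝔽₂⁸) (us : Vec 𝔽₂⁸ 3) → Dec (All (_∈ L) us)
  within? L = All.all? (_∈? L)
  find : ∀ ws → Dec (∃[ d ] All (_∈ lookup S d) ws × All (_∈ spanWith𝟏 ws) (lookup F′ d))
  find ws = Fin.any? λ d → within? (lookup S d) ws ×-dec within? (spanWith𝟏 ws) (lookup F′ d)

spanned⇒mapsTo : ∀ τ F F′ → Spanned τ F F′ (Vec.map spanWith𝟏 F′) → MapsTo τ F F′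
spanned⇒mapsTo τ F F′ h c = let d , p , q = h c in
  d , ⊆span⇒≅ (All.map (λ {w} → ≡.subst (w ∈_) (Vec.lookup-map d spanWith𝟏 F′)) p) q

Respects : Permutation′ 8 → Parity → (F₀ F₁ : Family) (S₀ S₁ : Vec (List 𝔽₂⁸) 15) → Set
Respects τ 0ℙ F₀ F₁ S₀ S₁ = Spanned τ F₀ F₀ S₀ × Spanned τ F₁ F₁ S₁
Respects τ 1ℙ F₀ F₁ S₀ S₁ = Spanned τ F₀ F₁ S₁ × Spanned τ F₁ F₀ S₀

respects? : ∀ τ p F₀ F₁ S₀ S₁ → Dec (Respects τ p F₀ F₁ S₀ S₁)
respects? τ 0ℙ F₀ F₁ S₀ S₁ = spanned? τ F₀ F₀ S₀ ×-dec spanned? τ F₁ F₁ S₁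
respects? τ 1ℙ F₀ F₁ S₀ S₁ = spanned? τ F₀ F₁ S₁ ×-dec spanned? τ F₁ F₀ S₀

-- The transpositions (0 j) generate the symmetric group, so these eight evaluations cover all
-- permutations. The value j = 0 gives the identity, the only even one among them.
star-respects : ∀ j → Respects (transpose 0F j) (sign (transpose 0F j)) evenCodes oddCodes
                          (Vec.map spanWith𝟏 evenCodes) (Vec.map spanWith𝟏 oddCodes)
star-respects = from-yes (check evenCodes oddCodes (Vec.map spanWith𝟏 evenCodes) (Vec.map spanWith𝟏 oddCodes))
  where
  check : ∀ F₀ F₁ S₀ S₁ → Dec (∀ j → Respects (transpose 0F j) (sign (transpose 0F j)) F₀ F₁ S₀ S₁)
  check F₀ F₁ S₀ S₁ = Fin.all? λ j → respects? (transpose 0F j) (sign (transpose 0F j)) F₀ F₁ S₀ S₁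

respects⇒mapsTo : ∀ τ p → Respects τ p evenCodes oddCodes (Vec.map spanWith𝟏 evenCodes) (Vec.map spanWith𝟏 oddCodes) →
                  ∀ s → MapsTo τ (codes s) (codes (s ℙ.+ p))
respects⇒mapsTo τ 0ℙ (h , _) 0ℙ = spanned⇒mapsTo τ evenCodes evenCodes h
respects⇒mapsTo τ 0ℙ (_ , h) 1ℙ = spanned⇒mapsTo τ oddCodes oddCodes h
respects⇒mapsTo τ 1ℙ (h , _) 0ℙ = spanned⇒mapsTo τ evenCodes oddCodes h
respects⇒mapsTo τ 1ℙ (_ , h) 1ℙ = spanned⇒mapsTo τ oddCodes evenCodes h

evalStars : List (Fin 8) → Permutation′ 8
evalStars []       = Perm.id
evalStars (j ∷ js) = transpose 0F j ∘ₚ evalStars js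

-- The conjugation (i j) = (0 i)(0 j)(0 i), with the degenerate cases separated.
starWord : Fin 8 → Fin 8 → List (Fin 8)
starWord i j = if does (i Fin.≟ j) then [] else
               if does (i Fin.≟ 0F) then j ∷ [] else
               if does (j Fin.≟ 0F) then i ∷ [] else i ∷ j ∷ i ∷ []

evalStars-starWord : ∀ i j k → evalStars (starWord i j) ⟨$⟩ʳ k ≡ transpose i j ⟨$⟩ʳ k
evalStars-starWord = from-yes (Fin.all? λ i → Fin.all? λ j → Fin.all? λ k →
  (evalStars (starWord i j) ⟨$⟩ʳ k) Fin.≟ (transpose i j ⟨$⟩ʳ k))

evalStars-++ : ∀ is js k → evalStars (is List.++ js) ⟨$⟩ʳ k ≡ evalStars js ⟨$⟩ʳ (evalStars is ⟨$⟩ʳ k)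
evalStars-++ []       js k = refl
evalStars-++ (i ∷ is) js k = evalStars-++ is js (transpose 0F i ⟨$⟩ʳ k)

starDecompose : ∀ σ → ∃[ js ] ∀ k → evalStars js ⟨$⟩ʳ k ≡ σ ⟨$⟩ʳ k
starDecompose σ = let js , eq = stars (decompose σ) in js , λ k → ≡.trans (eq k) (eval-decompose σ k)
  where
  stars : ∀ (ts : TranspositionList 8) → ∃[ js ] ∀ k → evalStars js ⟨$⟩ʳ k ≡ evalₜ ts ⟨$⟩ʳ k
  stars []             = [] , λ _ → refl
  stars ((i , j) ∷ ts) = let js , eq = stars ts in starWord i j List.++ js , λ k →
    ≡.trans (evalStars-++ (starWord i j) js k)
      (≡.trans (cong (evalStars js ⟨$⟩ʳ_) (evalStars-starWord i j k)) (eq (transpose i j ⟨$⟩ʳ k)))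

stars-mapsTo : ∀ js s → MapsTo (evalStars js) (codes s) (codes (s ℙ.+ sign (evalStars js)))
stars-mapsTo [] s c = c , λ x x-even → ≡.subst₂ (λ us p → Orthogonal us x ⇔ Orthogonal (lookup (codes p) c) x)
  (≡.sym (≡.trans (Vec.map-cong permute-id (lookup (codes s) c)) (Vec.map-id _))) (≡.sym (ℙ.+-identityʳ s))
  (mk⇔ (λ o → o) (λ o → o))
stars-mapsTo (j ∷ js) s c =
  let τ = transpose 0F j ; σ = evalStars js
      d , p = respects⇒mapsTo τ (sign τ) (star-respects j) s c
      e , q = stars-mapsTo js (s ℙ.+ sign τ) d
      r = ≅-trans {us = Vec.map (permute σ) (lookup (codes (s ℙ.+ sign τ)) d)} (≅-permute σ {us = lookup (codes (s ℙ.+ sign τ)) d} p) q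
  in e , λ x x-even → ≡.subst₂ (λ us p → Orthogonal us x ⇔ Orthogonal (lookup (codes p) e) x)
       (≡.trans (≡.sym (Vec.map-∘ (permute σ) (permute τ) (lookup (codes s) c)))
         (Vec.map-cong (λ w → ≡.sym (permute-∘ₚ τ σ w)) (lookup (codes s) c)))
       (≡.trans (ℙ.+-assoc s (sign τ) (sign σ)) (cong (s ℙ.+_) (≡.sym (sign-∘ₚ τ σ)))) (r x x-even)

-- Along a word in the transpositions (0 j) the family of the code changes with the parity. For an
-- even σ it is the even family again, whose members are the images under the `π c`.
even-code : ∀ σ → IsEven σ → ∃[ c ] ∀ x → SumZero x →
            T (inHammingCode (permute (flip σ) x)) ⇔ T (inHammingCode (permute (flip (π c)) x))
even-code σ σ-even =
  let js , eq = starDecompose σ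
      -- The permutation `π 0F` is the identity, so the code with number 0 evaluates to
      -- `hammingChecks`.
      c , p = stars-mapsTo js 0ℙ 0F
      sign≡0 = ≡.trans (sign-cong {π = evalStars js} {σ} eq) (even⇒sign σ σ-even)
  in c , λ x x-even →
    let q = ≡.subst₂ (λ us p → Orthogonal us x ⇔ Orthogonal (lookup (codes p) c) x)
              (Vec.map-cong (permute-cong {evalStars js} {σ} eq) hammingChecks) sign≡0 (p x x-even)
    in chain x c q
  where
  in⇔ : ∀ σ x → T (inHammingCode (permute (flip σ) x)) ⇔ Orthogonal (Vec.map (permute σ) hammingChecks) x
  in⇔ σ x = mk⇔ (Equivalence.from (orthogonal-permute σ hammingChecks x) ∘ Equivalence.to (inHammingCode⇔ (permute (flip σ) x)))
                (Equivalence.from (inHammingCode⇔ (permute (flip σ) x)) ∘ Equivalence.to (orthogonal-permute σ hammingChecks x))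
  chain : ∀ x c → Orthogonal (Vec.map (permute σ) hammingChecks) x ⇔ Orthogonal (lookup evenCodes c) x →
          T (inHammingCode (permute (flip σ) x)) ⇔ T (inHammingCode (permute (flip (π c)) x))
  chain x c q = mk⇔
    (Equivalence.from (in⇔ (π c) x) ∘ ≡.subst (λ us → Orthogonal us x) eq ∘ Equivalence.to q ∘ Equivalence.to (in⇔ σ x))
    (Equivalence.from (in⇔ σ x) ∘ Equivalence.from q ∘ ≡.subst (λ us → Orthogonal us x) (≡.sym eq) ∘ Equivalence.to (in⇔ (π c) x))
    where eq = Vec.lookup∘tabulate (λ c → Vec.map (permute (π c)) hammingChecks) c

-- The folded halved 8-cube

allWords? : ∀ {n} {P : Vec Parity n → Set} → (∀ x → Dec (P x)) → Dec (∀ x → P x)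
allWords? {zero}  P? = map′ (λ { p [] → p }) (λ f → f []) (P? [])
allWords? {suc n} P? = map′ (λ { (p , q) (0ℙ ∷ x) → p x ; (p , q) (1ℙ ∷ x) → q x })
  (λ f → (λ x → f (0ℙ ∷ x)) , (λ x → f (1ℙ ∷ x)))
  (allWords? (λ x → P? (0ℙ ∷ x)) ×-dec allWords? (λ x → P? (1ℙ ∷ x)))

sumZero? : ∀ x → Dec (SumZero x)
sumZero? x = sumℙ (lookup x) ℙ.≟ 0ℙ

_≈ᶠ?_ : ∀ x y → Dec (x ≈ᶠ y)
x ≈ᶠ? y = (x ≟ʷ y) ⊎-dec (x ≟ʷ (𝟏 ⊕ y))

words : ∀ n → Vec (Vec Parity n) (2 ℕ.^ n)
words zero    = [] ∷ []
words (suc n) = ≡.subst (Vec _) (cong (2 ℕ.^ n ℕ.+_) (≡.sym (ℕ.+-identityʳ (2 ℕ.^ n))))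
  (Vec.map (0ℙ ∷_) (words n) ++ Vec.map (1ℙ ∷_) (words n))

-- Every point has exactly one representative with first coordinate 0; its second coordinate is
-- determined by the last six.
points : Vec 𝔽₂⁸ 64
points = Vec.map (λ w → 0ℙ ∷ Vec.foldr _ ℙ._+_ 0ℙ w ∷ w) (words 6)

abstract
  points-sumZero : ∀ i → SumZero (lookup points i)
  points-sumZero = from-yes (check points)
    where
    check : ∀ (ps : Vec 𝔽₂⁸ 64) → Dec (∀ i → SumZero (lookup ps i))
    check ps = Fin.all? λ i → sumZero? (lookup ps i)

  points-injective : ∀ i j → lookup points i ≈ᶠ lookup points j → i ≡ j
  points-injective = from-yes (check points)
    where
    check : ∀ (ps : Vec 𝔽₂⁸ 64) → Dec (∀ i j → lookup ps i ≈ᶠ lookup ps j → i ≡ j)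
    check ps = Fin.all? λ i → Fin.all? λ j → (lookup ps i ≈ᶠ? lookup ps j) →-dec (i Fin.≟ j)

  points-surjective : ∀ x → SumZero x → ∃[ i ] lookup points i ≈ᶠ x
  points-surjective = from-yes (check points)
    where
    check : ∀ (ps : Vec 𝔽₂⁸ 64) → Dec (∀ x → SumZero x → ∃[ i ] lookup ps i ≈ᶠ x)
    check ps = allWords? λ x → sumZero? x →-dec Fin.any? λ i → lookup ps i ≈ᶠ? x

pointAt : Fin 64 → Point
pointAt i = lookup points i , points-sumZero i

pointNumbering : HasSize (Graph.vertices foldedHalved8Cube) 64
pointNumbering = enumerate (Graph.vertices foldedHalved8Cube) pointAt
  (λ {i} {j} → points-injective i j) (λ (x , x-even) → points-surjective x x-even)

-- The cosets

-- The words e₀ + eᵥ, with 0 for v = 0. Two of them differ by a word of weight 2, and a Hamming code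
-- has minimum weight 4, so they represent its eight cosets among the even words.
shift : Fin 8 → 𝔽₂⁸
shift v = (𝟎 [ 0F ]≔ 1ℙ) ⊕ (𝟎 [ v ]≔ 1ℙ)

shift-sumZero : ∀ v → SumZero (shift v)
shift-sumZero = from-yes (Fin.all? λ v → sumZero? (shift v))

inCoset : Permutation′ 8 → 𝔽₂⁸ → 𝔽₂⁸ → Bool
inCoset σ t x = inHammingCode (permute (flip σ) (t ⊕ x))

inCoset-resp : ∀ σ {t} → SumZero t → ∀ {x y : Point} → proj₁ x ≈ᶠ proj₁ y → inCoset σ t (proj₁ x) ≡ inCoset σ t (proj₁ y)
inCoset-resp σ t-even {x , x-even} {y , _} (inj₁ refl) = refl
inCoset-resp σ {t} t-even {_ , _} {y , y-even} (inj₂ refl) = ≡.trans (cong inHammingCode eq)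
  (member-resp hammingCoclique {𝟏 ⊕ z , sumZero-⊕ {𝟏} {z} refl z-even} {z , z-even} (inj₂ refl))
  where
  z = permute (flip σ) (t ⊕ y)
  z-even : SumZero z
  z-even = sumZero-permute (flip σ) {t ⊕ y} (sumZero-⊕ {t} {y} t-even y-even)
  permute-𝟏 : ∀ σ → permute σ 𝟏 ≡ 𝟏
  permute-𝟏 σ = ≡.trans (Vec.tabulate-cong λ i → Vec.lookup-replicate (σ ⟨$⟩ˡ i) 1ℙ) refl
  eq : permute (flip σ) (t ⊕ (𝟏 ⊕ y)) ≡ 𝟏 ⊕ z
  eq = ≡.trans (cong (permute (flip σ)) (≡.trans (≡.sym (⊕-assoc t 𝟏 y))
         (≡.trans (cong (_⊕ y) (⊕-comm t 𝟏)) (⊕-assoc 𝟏 t y))))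
       (≡.trans (permute-⊕ (flip σ) 𝟏 (t ⊕ y)) (cong (_⊕ z) (permute-𝟏 (flip σ))))

opaque
  coset : Fin 120 → 𝔽₂⁸ → Bool
  coset i = let c , v = Fin.remQuot {15} 8 i in inCoset (π c) (shift v)

  coset-def : ∀ i x → coset i x ≡ inCoset (π (Fin.quotient {15} 8 i)) (shift (Fin.remainder {15} 8 i)) x
  coset-def i x = refl

coset-resp : ∀ i {x y : Point} → proj₁ x ≈ᶠ proj₁ y → coset i (proj₁ x) ≡ coset i (proj₁ y)
coset-resp i {x} {y} eq = let c = Fin.quotient {15} 8 i ; v = Fin.remainder {15} 8 i in
  ≡.trans (coset-def i (proj₁ x)) (≡.trans
    (inCoset-resp (π c) {shift v} (shift-sumZero v) {x} {y} eq) (≡.sym (coset-def i (proj₁ y))))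

CosetRows : Set
CosetRows = Vec (Vec Bool 64) 120

-- Two different codes of the orbit share 0, 𝟏 and a complementary pair of words of weight 4, which
-- are two points of the folded cube; their cosets share two points or none. Cosets of one code are
-- disjoint.
CosetFacts : CosetRows → Set
CosetFacts rows = (∀ i → countTrue (lookup rows i) ≡ 8)
  × (∀ i j → i Fin.< j → countBoth (lookup rows i) (lookup rows j) ≡ 0 ⊎ countBoth (lookup rows i) (lookup rows j) ≡ 2)

cosetFacts? : ∀ rows → Dec (CosetFacts rows)
cosetFacts? rows = (Fin.all? λ i → countTrue (lookup rows i) ℕ.≟ 8)
  ×-dec (Fin.all? λ i → Fin.all? λ j → (i Fin.<? j) →-dec 0or2? (countBoth (lookup rows i) (lookup rows j)))
  where
  0or2? : ∀ n → Dec (n ≡ 0 ⊎ n ≡ 2)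
  0or2? n = (n ℕ.≟ 0) ⊎-dec (n ℕ.≟ 2)

abstract
  -- Two points of a coset differ by a codeword, and no codeword has weight 2 or 6. This makes the
  -- cosets independent sets.
  code-weight : ∀ c z → T (inHammingCode (permute (flip (π c)) z)) → SumZero z → weight z ≢ 2 × weight (z ⊕ 𝟏) ≢ 2
  code-weight = from-yes (Fin.all? λ c → allWords? λ z → Bool.T? (inHammingCode (permute (flip (π c)) z)) →-dec
    (sumZero? z →-dec (¬? (weight z ℕ.≟ 2) ×-dec ¬? (weight (z ⊕ 𝟏) ℕ.≟ 2))))

orthogonal-⊕ : ∀ {k} (ws : Vec 𝔽₂⁸ k) x y → Orthogonal ws x → Orthogonal ws y → Orthogonal ws (x ⊕ y)
orthogonal-⊕ []       x y []       []       = []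
orthogonal-⊕ (w ∷ ws) x y (p ∷ ps) (q ∷ qs) = ≡.trans (dotℙ-⊕ʳ w x y) (cong₂ ℙ._+_ p q) ∷ orthogonal-⊕ ws x y ps qs

inHammingCode-⊕ : ∀ {x y} → T (inHammingCode x) → T (inHammingCode y) → T (inHammingCode (x ⊕ y))
inHammingCode-⊕ {x} {y} p q = Equivalence.from (inHammingCode⇔ (x ⊕ y))
  (orthogonal-⊕ hammingChecks x y (Equivalence.to (inHammingCode⇔ x) p) (Equivalence.to (inHammingCode⇔ y) q))

⊕-cancel₃ : ∀ t x y → (t ⊕ x) ⊕ (t ⊕ y) ≡ x ⊕ y
⊕-cancel₃ t x y = ≡.trans (cong (_⊕ (t ⊕ y)) (⊕-comm t x)) (≡.trans (⊕-assoc x t (t ⊕ y)) (cong (x ⊕_) (⊕-cancel t y)))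

inCoset-⊕ : ∀ σ t x y → T (inCoset σ t x) → T (inCoset σ t y) → T (inHammingCode (permute (flip σ) (x ⊕ y)))
inCoset-⊕ σ t x y p q = ≡.subst (T ∘ inHammingCode)
  (≡.trans (≡.sym (permute-⊕ (flip σ) (t ⊕ x) (t ⊕ y))) (cong (permute (flip σ)) (⊕-cancel₃ t x y)))
  (inHammingCode-⊕ {permute (flip σ) (t ⊕ x)} {permute (flip σ) (t ⊕ y)} p q)

disjointness : ∀ {m n} → Vec (Vec Bool m) n → Table n
disjointness rows = Vec.map (λ r → Vec.map (λ s → does (countBoth r s ℕ.≟ 0)) rows) rows

entry-disjointness : ∀ {m n} (rows : Vec (Vec Bool m) n) i j →
  entry (disjointness rows) i j ≡ does (countBoth (lookup rows i) (lookup rows j) ℕ.≟ 0)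
entry-disjointness rows i j = ≡.trans
  (cong (λ r → lookup r j) (Vec.lookup-map i (λ r → Vec.map (λ s → does (countBoth r s ℕ.≟ 0)) rows) rows))
  (Vec.lookup-map j (λ s → does (countBoth (lookup rows i) s ℕ.≟ 0)) rows)

-- The vertices 0 and 8 are the first cosets of the first two codes.
Incomplete : Table 120 → Set
Incomplete t = ¬ T (entry t 0F 8F) × ¬ (∃[ k ] Completes t 0F 8F k)

incomplete? : ∀ t → Dec (Incomplete t)
incomplete? t = ¬? (Bool.T? (entry t 0F 8F)) ×-dec ¬? (Fin.any? (completes? t 0F 8F))

opaque
  unfolding coset

  cosetRows : CosetRows
  cosetRows = tabulate λ i → Vec.map (coset i) points

  lookup-cosetRows : ∀ i k → lookup (lookup cosetRows i) k ≡ coset i (lookup points k)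
  lookup-cosetRows i k = ≡.trans (cong (λ r → lookup r k) (Vec.lookup∘tabulate (λ i → Vec.map (coset i) points) i))
    (Vec.lookup-map k (coset i) points)

  Γ-table : Table 120
  Γ-table = disjointness cosetRows

  entry-Γ : ∀ i j → entry Γ-table i j ≡ does (countBoth (lookup cosetRows i) (lookup cosetRows j) ℕ.≟ 0)
  entry-Γ = entry-disjointness cosetRows

  Γ-facts : CosetFacts cosetRows × RegularTable Γ-table 63 30 36 × Incomplete Γ-table
  Γ-facts = from-yes (check cosetRows)
    where
    facts? : ∀ rows t → Dec (CosetFacts rows × RegularTable t 63 30 36 × Incomplete t)
    facts? rows t = cosetFacts? rows ×-dec (regularTable? t 63 30 36 ×-dec incomplete? t)
    check : ∀ rows → Dec (CosetFacts rows × RegularTable (disjointness rows) 63 30 36 × Incomplete (disjointness rows))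
    check rows = facts? rows (disjointness rows)

cosetFacts : CosetFacts cosetRows
cosetFacts = proj₁ Γ-facts

Γ-regular : RegularTable Γ-table 63 30 36
Γ-regular = proj₁ (proj₂ Γ-facts)

Γ-notCompletable : ¬ Completable Γ-table
Γ-notCompletable h = let i≁j , none = proj₂ (proj₂ Γ-facts) in none (h 0F 8F (λ ()) i≁j)

row⇔ : ∀ i k → T (lookup (lookup cosetRows i) k) ⇔ T (coset i (lookup points k))
row⇔ i k = mk⇔ (≡.subst T (lookup-cosetRows i k)) (≡.subst T (≡.sym (lookup-cosetRows i k)))

cosetCoclique : Fin 120 → Coclique₈
cosetCoclique i = record
  { member = λ (x , _) → coset i x
  ; member-resp = λ {x} {y} → coset-resp i {x} {y}
  ; size = ≡.subst (HasSize _) (proj₁ cosetFacts i)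
      (sub-size pointNumbering (λ (x , _) → T (coset i x)) (λ {x} {y} eq → ≡.subst T (coset-resp i {x} {y} eq))
        (lookup cosetRows i) (row⇔ i))
  ; independent = λ (x , x-even) (y , y-even) p q →
      let c = Fin.quotient {15} 8 i ; v = Fin.remainder {15} 8 i
          w≢ , w≢′ = code-weight c (x ⊕ y)
            (inCoset-⊕ (π c) (shift v) x y (≡.subst T (coset-def i x) p) (≡.subst T (coset-def i y) q))
            (sumZero-⊕ {x} {y} x-even y-even)
      in [ w≢ , w≢′ ]′ }

cosetOrbit : ∀ i → InOrbitOf hammingCoclique (cosetCoclique i)
cosetOrbit i = let c = Fin.quotient {15} 8 i ; v = Fin.remainder {15} 8 i in
  π c , π-even c , (shift v , shift-sumZero v) , λ (x , _) → ≡.trans (coset-def i (shift v ⊕ permute (π c) x))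
    (cong inHammingCode (≡.trans (cong (permute (flip (π c))) (⊕-cancel (shift v) (permute (π c) x))) (permute-flip (π c) x)))

vertexΓ : Fin 120 → Graph.Vertex Γ₁
vertexΓ i = cosetCoclique i , cosetOrbit i

commonSize : ∀ i j → HasSize (Common (cosetCoclique i) (cosetCoclique j)) (countBoth (lookup cosetRows i) (lookup cosetRows j))
commonSize i j = ≡.subst (HasSize _) (countTrue-∧ (lookup cosetRows i) (lookup cosetRows j))
  (sub-size pointNumbering (λ (x , _) → T (coset i x) × T (coset j x))
    (λ {x} {y} eq (p , q) → ≡.subst T (coset-resp i {x} {y} eq) p , ≡.subst T (coset-resp j {x} {y} eq) q)
    (zipWith _∧_ (lookup cosetRows i) (lookup cosetRows j))
    (lookup-∧⇔ (lookup cosetRows i) (lookup cosetRows j) (row⇔ i) (row⇔ j)))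

vertexΓ-injective : ∀ {i j} → Graph._≈_ Γ₁ (vertexΓ i) (vertexΓ j) → i ≡ j
vertexΓ-injective {i} {j} eq = rows-distinct cosetRows (proj₁ cosetFacts)
  (λ i j i<j n≡8 → [ (λ n≡0 → case ≡.trans (≡.sym n≡0) n≡8 of λ ()) , (λ n≡2 → case ≡.trans (≡.sym n≡2) n≡8 of λ ()) ]′
    (proj₂ cosetFacts i j i<j))
  i j λ k → ≡.trans (lookup-cosetRows i k) (≡.trans (eq (pointAt k)) (≡.sym (lookup-cosetRows j k)))

abstract
  covering : ∀ c t → SumZero t → ∃[ v ] T (inHammingCode (permute (flip (π c)) (shift v ⊕ t)))
  covering = from-yes (Fin.all? λ c → allWords? λ t → sumZero? t →-dec Fin.any? λ v →
    Bool.T? (inHammingCode (permute (flip (π c)) (shift v ⊕ t))))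

-- A vertex is a coset t + σ(H) with σ even. By `even-code` the code σ(H) is one of the fifteen, and
-- by `covering` a shift replaces t.
vertexΓ-surjective : ∀ S → ∃[ i ] Graph._≈_ Γ₁ (vertexΓ i) S
vertexΓ-surjective (S , σ , σ-even , (t , t-even) , eq) =
  let c , code⇔ = even-code σ σ-even
      v , v∈ = covering c t t-even
  in Fin.combine c v , λ (y , y-even) → ≡.trans (coset-combine c v y)
       (≡.trans (sameCoset c v y y-even (code⇔ (t ⊕ y) (sumZero-⊕ {t} {y} t-even y-even)) v∈) (≡.sym (member-S y y-even)))
  where
  translate : ∀ c s t y → T (inHammingCode (permute (flip (π c)) (s ⊕ t))) →
              T (inCoset (π c) s y) → T (inCoset (π c) t y)
  translate c s t y p q = ≡.subst (T ∘ inHammingCode)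
    (≡.trans (≡.sym (permute-⊕ (flip (π c)) (s ⊕ t) (s ⊕ y))) (cong (permute (flip (π c))) (⊕-cancel₃ s t y)))
    (inHammingCode-⊕ {permute (flip (π c)) (s ⊕ t)} {permute (flip (π c)) (s ⊕ y)} p q)
  coset-combine : ∀ c v y → coset (Fin.combine c v) y ≡ inCoset (π c) (shift v) y
  coset-combine c v y = ≡.trans (coset-def (Fin.combine c v) y)
    (cong (λ p → inCoset (π (proj₁ p)) (shift (proj₂ p)) y) (Fin.remQuot-combine c v))
  sameCoset : ∀ c v y → SumZero y → T (inCoset σ t y) ⇔ T (inCoset (π c) t y) →
              T (inHammingCode (permute (flip (π c)) (shift v ⊕ t))) → inCoset (π c) (shift v) y ≡ inCoset σ t y
  sameCoset c v y y-even code⇔ v∈ = T-injective {inCoset (π c) (shift v) y} {inCoset σ t y}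
    (λ p → Equivalence.from code⇔ (translate c (shift v) t y v∈ p))
    (λ p → translate c t (shift v) y
      (≡.subst (λ z → T (inHammingCode (permute (flip (π c)) z))) (⊕-comm (shift v) t) v∈) (Equivalence.to code⇔ p))
  -- The orbit condition describes membership only for points t + σ x; every point y has this form
  -- with x = σ⁻¹(t + y).
  member-S : ∀ y y-even → member S (y , y-even) ≡ inCoset σ t y
  member-S y y-even = ≡.trans (member-resp S {y , y-even} {act σ (t , t-even) (x , x-even)} (inj₁ y≡)) (eq (x , x-even))
    where
    x = permute (flip σ) (t ⊕ y)
    x-even : SumZero x
    x-even = sumZero-permute (flip σ) {t ⊕ y} (sumZero-⊕ {t} {y} t-even y-even)
    y≡ : y ≡ t ⊕ permute σ x
    y≡ = ≡.sym (≡.trans (cong (t ⊕_) (permute-flip (flip σ) (t ⊕ y))) (⊕-cancel t y))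

complementΓ-tabulated : Tabulated (complement Γ₁) 120
complementΓ-tabulated = record
  { numbering = enumerate (Graph.vertices Γ₁) vertexΓ vertexΓ-injective vertexΓ-surjective
  ; table = Γ-table
  -- Distinct vertices share two points, and are then adjacent in Γ₁, or none. The complement
  -- therefore joins exactly the disjoint cosets.
  ; table⇔ = λ i j → mk⇔ (λ p → disjoint⇒~ i j (Equivalence.to (T-does (meets i j ℕ.≟ 0)) (≡.subst T (entry-Γ i j) p)))
                          (λ p → ≡.subst T (≡.sym (entry-Γ i j)) (Equivalence.from (T-does (meets i j ℕ.≟ 0)) (~⇒disjoint i j p))) }
  where
  open Graph (complement Γ₁)
  meets : Fin 120 → Fin 120 → ℕ
  meets i j = countBoth (lookup cosetRows i) (lookup cosetRows j)
  disjoint⇒~ : ∀ i j → meets i j ≡ 0 → vertexΓ i ~ vertexΓ j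
  disjoint⇒~ i j n≡0 = (λ eq → case ≡.trans (≡.sym n≡0) (≡.trans (cong (λ k → meets k j) (vertexΓ-injective {i} {j} eq))
                                 (≡.trans (countBoth-self (lookup cosetRows j)) (proj₁ cosetFacts j))) of λ ())
                     , (λ two → case ≡.trans (≡.sym n≡0) (size-unique (commonSize i j) two) of λ ())
  ~⇒disjoint : ∀ i j → vertexΓ i ~ vertexΓ j → meets i j ≡ 0
  ~⇒disjoint i j (i≉j , i≁j) with Fin.<-cmp i j
  ... | tri≈ _ refl _ = contradiction (λ _ → refl) i≉j
  ... | tri< i<j _ _ = [ (λ n≡0 → n≡0) , (λ n≡2 → contradiction (≡.subst (HasSize _) n≡2 (commonSize i j)) i≁j) ]′
          (proj₂ cosetFacts i j i<j)
  ... | tri> _ _ j<i = [ (λ n≡0 → ≡.trans comm n≡0)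
          , (λ n≡2 → contradiction (≡.subst (HasSize _) (≡.trans comm n≡2) (commonSize i j)) i≁j) ]′ (proj₂ cosetFacts j i j<i)
    where comm = countBoth-comm (lookup cosetRows i) (lookup cosetRows j)

-- Sums in a ring

module RingSums (R : Ring 0ℓ 0ℓ) where
  open Ring R hiding (zero) renaming (refl to ≈-refl; sym to ≈-sym; trans to ≈-trans)
  open CMSum +-commutativeMonoid
  open SemiringSum semiring using (*-distribˡ-sum; *-distribʳ-sum)

  sum-vanishes : ∀ {n} {f : Fin n → Carrier} → (∀ i → f i ≈ 0#) → sum f ≈ 0#
  sum-vanishes {n} {f} eq = ≈-trans (sum-cong-≋ eq) (zeros n)
    where
    zeros : ∀ n → sum {n} (λ _ → 0#) ≈ 0#
    zeros zero    = ≈-refl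
    zeros (suc n) = ≈-trans (+-identityˡ _) (zeros n)

  sum-single : ∀ {n} (f : Fin n → Carrier) i → (∀ j → j ≢ i → f j ≈ 0#) → sum f ≈ f i
  sum-single f zero    eq = ≈-trans (+-congˡ (sum-vanishes λ j → eq (suc j) λ ())) (+-identityʳ _)
  sum-single f (suc i) eq = ≈-trans (+-cong (eq zero λ ()) (sum-single (f ∘ suc) i λ j j≢i → eq (suc j) (j≢i ∘ Fin.suc-injective)))
    (+-identityˡ _)

  sum-++ : ∀ m {n} (f : Fin (m ℕ.+ n) → Carrier) → sum f ≈ sum (λ i → f (i Fin.↑ˡ n)) + sum (λ i → f (m Fin.↑ʳ i))
  sum-++ zero    f = ≈-sym (+-identityˡ _)
  sum-++ (suc m) f = ≈-trans (+-congˡ (sum-++ m (f ∘ suc))) (≈-sym (+-assoc _ _ _))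

  sum-combine : ∀ m {n} (f : Fin (m ℕ.* n) → Carrier) → sum f ≈ sum {m} (λ i → sum {n} (λ j → f (Fin.combine i j)))
  sum-combine zero        f = ≈-refl
  sum-combine (suc m) {n} f = ≈-trans (sum-++ n f) (+-congˡ (sum-combine m (λ i → f (n Fin.↑ʳ i))))

  indicator : Bool → Carrier
  indicator b = if b then 1# else 0#

  -- Both sides equal the sum of the p i q j with a i = b j = true.
  resolutions-agree : ∀ {m n} (p : Fin m → Carrier) (q : Fin n → Carrier) (a : Fin m → Bool) (b : Fin n → Bool) →
    sum p ≈ 1# → sum q ≈ 1# → (∀ i j → a i ≢ b j → p i * q j ≈ 0#) →
    sum (λ i → indicator (a i) * p i) ≈ sum (λ j → q j * indicator (b j))
  resolutions-agree {m} {n} p q a b Σp Σq orthogonal = begin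
    sum ap                                     ≈⟨ sum-cong-≋ {m} {ap} {λ i → sum (λ j → ap i * q j)} (λ i → expandˡ (ap i)) ⟩
    sum (λ i → sum (λ j → ap i * q j))         ≈⟨ ∑-comm (λ i j → ap i * q j) ⟩
    sum (λ j → sum (λ i → ap i * q j))         ≈⟨ sum-cong-≋ {n} {λ j → sum (λ i → ap i * q j)} {λ j → sum (λ i → p i * qb j)}
                                                    (λ j → sum-cong-≋ {m} {λ i → ap i * q j} {λ i → p i * qb j} (λ i → entrywise i j)) ⟩
    sum (λ j → sum (λ i → p i * qb j))         ≈⟨ sum-cong-≋ {n} {qb} {λ j → sum (λ i → p i * qb j)} (λ j → expandʳ (qb j)) ⟨
    sum qb                                     ∎
    where
    open import Relation.Binary.Reasoning.Setoid setoid
    ap : Fin m → Carrier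
    ap i = indicator (a i) * p i
    qb : Fin n → Carrier
    qb j = q j * indicator (b j)
    expandˡ : ∀ x → x ≈ sum (λ j → x * q j)
    expandˡ x = ≈-trans (≈-sym (*-identityʳ x)) (≈-trans (*-congˡ (≈-sym Σq)) (*-distribˡ-sum x q))
    expandʳ : ∀ x → x ≈ sum (λ i → p i * x)
    expandʳ x = ≈-trans (≈-sym (*-identityˡ x)) (≈-trans (*-congʳ (≈-sym Σp)) (*-distribʳ-sum x p))
    entrywise : ∀ i j → indicator (a i) * p i * q j ≈ p i * (q j * indicator (b j))
    entrywise i j with a i | b j | orthogonal i j
    ... | true  | true  | _ = ≈-trans (*-congʳ (*-identityˡ _)) (*-congˡ (≈-sym (*-identityʳ _)))
    ... | true  | false | h = ≈-trans (*-congʳ (*-identityˡ _)) (≈-trans (h λ ()) (≈-sym (≈-trans (*-congˡ (zeroʳ _)) (zeroʳ _))))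
    ... | false | true  | h = ≈-trans (*-assoc _ _ _) (≈-trans (zeroˡ _) (≈-sym (≈-trans (*-congˡ (*-identityʳ _)) (h λ ()))))
    ... | false | false | _ = ≈-trans (*-assoc _ _ _) (≈-trans (zeroˡ _) (≈-sym (≈-trans (*-congˡ (zeroʳ _)) (zeroʳ _))))

-- Projections onto integer vectors

fromℤ : ℤ → ℚ
fromℤ z = mkℚ z 0 (Coprimality.sym (Coprimality.1-coprimeTo ℤ.∣ z ∣))

fromℤ-+ : ∀ a b → fromℤ (a ℤ.+ b) ≡ fromℤ a ℚ.+ fromℤ b
fromℤ-+ a b = ℚ.toℚᵘ-injective (ℚᵘ.≃-trans
  (ℚᵘ.*≡* (cong (ℤ._* ℤ.+ 1) (≡.sym (cong₂ ℤ._+_ (ℤ.*-identityʳ a) (ℤ.*-identityʳ b)))))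
  (ℚᵘ.≃-sym (ℚ.toℚᵘ-homo-+ (fromℤ a) (fromℤ b))))

fromℤ-* : ∀ a b → fromℤ (a ℤ.* b) ≡ fromℤ a ℚ.* fromℤ b
fromℤ-* a b = ℚ.toℚᵘ-injective (ℚᵘ.≃-trans (ℚᵘ.*≡* refl) (ℚᵘ.≃-sym (ℚ.toℚᵘ-homo-* (fromℤ a) (fromℤ b))))


ℚ-ring : Ring 0ℓ 0ℓ
ℚ-ring = ℚ.+-*-ring


fromℤ-sum : ∀ {n} (f : Fin n → ℤ) → fromℤ (sumℤ f) ≡ sumℚ (fromℤ ∘ f)
fromℤ-sum {zero}  f = refl
fromℤ-sum {suc n} f = ≡.trans (fromℤ-+ (f zero) (sumℤ (f ∘ suc))) (cong (fromℤ (f zero) ℚ.+_) (fromℤ-sum (f ∘ suc)))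

dot-sum : ∀ {n} (x y : Vec ℚ n) → dot x y ≡ sumℚ (λ i → lookup x i ℚ.* lookup y i)
dot-sum []      []      = refl
dot-sum (a ∷ x) (b ∷ y) = cong (a ℚ.* b ℚ.+_) (dot-sum x y)

toℚ : ∀ {n} → Vec ℤ n → Vec ℚ n
toℚ = Vec.map fromℤ

dot-toℚ : ∀ (w u : ℤ⁸) → dot (toℚ w) (toℚ u) ≡ fromℤ ⟨ w , u ⟩
dot-toℚ w u = ≡.trans (dot-sum (toℚ w) (toℚ u)) (≡.trans
  (sumℚ-cong λ i → ≡.trans (cong₂ ℚ._*_ (Vec.lookup-map i fromℤ w) (Vec.lookup-map i fromℤ u)) (≡.sym (fromℤ-* (lookup w i) (lookup u i))))
  (≡.sym (fromℤ-sum (λ i → lookup w i ℤ.* lookup u i))))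

⅛ : ℚ
⅛ = δ 7

8ℚ : ℚ
8ℚ = fromℤ (ℤ.+ 8)

-- Roots are not normalised in G-E₈: the weight μ makes μ ⟨ w , w ⟩ = 8 for every root w.
μ : ℤ⁸ → ℤ
μ w = if does (⟨ w , w ⟩ ℤ.≟ ℤ.+ 2) then ℤ.+ 4 else ℤ.+ 1

-- For a root w this is 1 / ⟨ w , w ⟩, the factor in the orthogonal projection onto its line.
weightℚ : ℤ⁸ → ℚ
weightℚ w = ⅛ ℚ.* fromℤ (μ w)

-- The matrix entries of Σ μ(w k) w k (w k)ᵀ are those of 8 times the unit matrix.
IsFrame : (Fin 8 → ℤ⁸) → Set
IsFrame w = ∀ i j → sumℤ (λ k → μ (w k) ℤ.* (lookup (w k) i ℤ.* lookup (w k) j)) ≡ (if does (i Fin.≟ j) then ℤ.+ 8 else 0ℤ)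

parseval : ∀ {w} → IsFrame w → ∀ x y → sumℚ (λ k → weightℚ (w k) ℚ.* (dot (toℚ (w k)) x ℚ.* dot (toℚ (w k)) y)) ≡ dot x y
parseval {w} frame x y = begin
  sumℚ (λ k → weightℚ (w k) ℚ.* (dot (toℚ (w k)) x ℚ.* dot (toℚ (w k)) y))
    ≡⟨ sumℚ-cong (λ k → expand k) ⟩
  sumℚ (λ k → sumℚ λ i → sumℚ λ j → c k i j)
    ≡⟨ sumℚ-comm (λ k i → sumℚ λ j → c k i j) ⟩
  sumℚ (λ i → sumℚ λ k → sumℚ λ j → c k i j)
    ≡⟨ sumℚ-cong (λ i → sumℚ-comm (λ k j → c k i j)) ⟩
  sumℚ (λ i → sumℚ λ j → sumℚ λ k → c k i j)
    ≡⟨ sumℚ-cong (λ i → sumℚ-cong λ j → collect i j) ⟩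
  sumℚ (λ i → sumℚ λ j → if does (i Fin.≟ j) then X i ℚ.* Y j else 0ℚ)
    ≡⟨ sumℚ-cong (λ i → diagonal i) ⟩
  sumℚ (λ i → X i ℚ.* Y i)
    ≡⟨ dot-sum x y ⟨
  dot x y ∎
  where
  open ≡.≡-Reasoning
  X Y : Fin 8 → ℚ
  X = lookup x
  Y = lookup y
  W : Fin 8 → Fin 8 → ℚ
  W k i = fromℤ (lookup (w k) i)
  c : Fin 8 → Fin 8 → Fin 8 → ℚ
  c k i j = weightℚ (w k) ℚ.* (W k i ℚ.* X i ℚ.* (W k j ℚ.* Y j))
  dot-W : ∀ k x → dot (toℚ (w k)) x ≡ sumℚ (λ i → W k i ℚ.* lookup x i)
  dot-W k x = ≡.trans (dot-sum (toℚ (w k)) x) (sumℚ-cong λ i → cong (ℚ._* lookup x i) (Vec.lookup-map i fromℤ (w k)))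
  expand : ∀ k → weightℚ (w k) ℚ.* (dot (toℚ (w k)) x ℚ.* dot (toℚ (w k)) y) ≡ sumℚ (λ i → sumℚ λ j → c k i j)
  expand k = ≡.trans (cong (weightℚ (w k) ℚ.*_) (≡.trans (cong₂ ℚ._*_ (dot-W k x) (dot-W k y))
      (≡.trans (*-distribʳ-sumℚ (sumℚ (λ j → W k j ℚ.* Y j)) (λ i → W k i ℚ.* X i))
        (sumℚ-cong λ i → *-distribˡ-sumℚ (W k i ℚ.* X i) (λ j → W k j ℚ.* Y j)))))
    (≡.trans (*-distribˡ-sumℚ (weightℚ (w k)) (λ i → sumℚ λ j → W k i ℚ.* X i ℚ.* (W k j ℚ.* Y j)))
      (sumℚ-cong λ i → *-distribˡ-sumℚ (weightℚ (w k)) (λ j → W k i ℚ.* X i ℚ.* (W k j ℚ.* Y j))))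
  m : Fin 8 → Fin 8 → Fin 8 → ℤ
  m i j k = μ (w k) ℤ.* (lookup (w k) i ℤ.* lookup (w k) j)
  rearrange : ∀ i j k → c k i j ≡ fromℤ (m i j k) ℚ.* (⅛ ℚ.* (X i ℚ.* Y j))
  rearrange i j k = ≡.trans
    (solve 6 (λ e n p x q y → (e :* n) :* (p :* x :* (q :* y)) := (n :* (p :* q)) :* (e :* (x :* y))) refl
      ⅛ (fromℤ (μ (w k))) (W k i) (X i) (W k j) (Y j))
    (cong (ℚ._* (⅛ ℚ.* (X i ℚ.* Y j))) (≡.sym (≡.trans (fromℤ-* (μ (w k)) (lookup (w k) i ℤ.* lookup (w k) j))
      (cong (fromℤ (μ (w k)) ℚ.*_) (fromℤ-* (lookup (w k) i) (lookup (w k) j))))))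
  collect : ∀ i j → sumℚ (λ k → c k i j) ≡ (if does (i Fin.≟ j) then X i ℚ.* Y j else 0ℚ)
  collect i j = ≡.trans (sumℚ-cong (rearrange i j))
    (≡.trans (≡.sym (*-distribʳ-sumℚ (⅛ ℚ.* (X i ℚ.* Y j)) (fromℤ ∘ m i j)))
    (≡.trans (cong (ℚ._* (⅛ ℚ.* (X i ℚ.* Y j))) (≡.trans (≡.sym (fromℤ-sum (m i j))) (cong fromℤ (frame i j))))
      (evaluate (does (i Fin.≟ j)))))
    where
    evaluate : ∀ b → fromℤ (if b then ℤ.+ 8 else 0ℤ) ℚ.* (⅛ ℚ.* (X i ℚ.* Y j)) ≡ (if b then X i ℚ.* Y j else 0ℚ)
    evaluate true  = ≡.trans (≡.sym (ℚ.*-assoc 8ℚ ⅛ (X i ℚ.* Y j))) (ℚ.*-identityˡ (X i ℚ.* Y j))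
    evaluate false = ℚ.*-zeroˡ (⅛ ℚ.* (X i ℚ.* Y j))
  diagonal : ∀ i → sumℚ (λ j → if does (i Fin.≟ j) then X i ℚ.* Y j else 0ℚ) ≡ X i ℚ.* Y i
  diagonal i = ≡.trans (RingSums.sum-single ℚ-ring (λ j → if does (i Fin.≟ j) then X i ℚ.* Y j else 0ℚ) i off) on
    where
    off : ∀ j → j ≢ i → (if does (i Fin.≟ j) then X i ℚ.* Y j else 0ℚ) ≡ 0ℚ
    off j j≢i with i Fin.≟ j
    ... | yes i≡j = contradiction (≡.sym i≡j) j≢i
    ... | no _    = refl
    on : (if does (i Fin.≟ i) then X i ℚ.* Y i else 0ℚ) ≡ X i ℚ.* Y i
    on with i Fin.≟ i
    ... | yes _  = refl
    ... | no i≢i = contradiction refl i≢i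

module _ where

  open ComplexVectors 7 using (complexVectors)
  open ComplexSpace complexVectors
  open Operators complexVectors
  open Completion complexVectors
  open C*Completion complexVectors using (algebra)

  project : ℤ⁸ → Vec ℚ 8 → Vec ℚ 8
  project w x = (weightℚ w ℚ.* dot (toℚ w) x) ⊡ toℚ w

  dot-project : ∀ w x y → dot (project w x) y ≡ weightℚ w ℚ.* (dot (toℚ w) x ℚ.* dot (toℚ w) y)
  dot-project w x y = ≡.trans (dot-⊡ (weightℚ w ℚ.* dot (toℚ w) x) (toℚ w) y) (ℚ.*-assoc (weightℚ w) (dot (toℚ w) x) (dot (toℚ w) y))

  project-symmetric : ∀ w x y → dot (project w x) y ≡ dot x (project w y)
  project-symmetric w x y = ≡.trans (dot-project w x y) (≡.trans
    (cong (weightℚ w ℚ.*_) (ℚ.*-comm (dot (toℚ w) x) (dot (toℚ w) y)))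
    (≡.sym (≡.trans (dot-comm x (project w y)) (dot-project w y x))))

  abstract
    projection-adjoint : ∀ w → Adjoint (λ (x , y) → project w x , project w y) (λ (x , y) → project w x , project w y)
    projection-adjoint w (x , x′) (y , y′) = cong₂ ℚ._+_ (project-symmetric w x y) (project-symmetric w x′ y′)

    projection-commutes : ∀ w → Commutes (λ (x , y) → project w x , project w y)
    projection-commutes w (x , x′) (y , y′) = cong (ℚ._+ dot (project w x) y′) (begin
      dot (project w (-1ℚ ⊡ x′)) y                                        ≡⟨ dot-project w (-1ℚ ⊡ x′) y ⟩
      weightℚ w ℚ.* (dot (toℚ w) (-1ℚ ⊡ x′) ℚ.* dot (toℚ w) y)
        ≡⟨ cong (λ s → weightℚ w ℚ.* (s ℚ.* dot (toℚ w) y))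
             (≡.trans (dot-comm (toℚ w) (-1ℚ ⊡ x′)) (≡.trans (dot-⊡ -1ℚ x′ (toℚ w)) (cong (-1ℚ ℚ.*_) (dot-comm x′ (toℚ w))))) ⟩
      weightℚ w ℚ.* (-1ℚ ℚ.* dot (toℚ w) x′ ℚ.* dot (toℚ w) y)
        ≡⟨ solve 4 (λ n l p q → l :* (n :* p :* q) := n :* (l :* (p :* q))) refl -1ℚ (weightℚ w) (dot (toℚ w) x′) (dot (toℚ w) y) ⟩
      -1ℚ ℚ.* (weightℚ w ℚ.* (dot (toℚ w) x′ ℚ.* dot (toℚ w) y))          ≡⟨ cong (-1ℚ ℚ.*_) (dot-project w x′ y) ⟨
      -1ℚ ℚ.* dot (project w x′) y                                         ≡⟨ dot-⊡ -1ℚ (project w x′) y ⟨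
      dot (-1ℚ ⊡ project w x′) y                                           ∎)
      where
      open ≡.≡-Reasoning
      -1ℚ : ℚ
      -1ℚ = ℚ.- 1ℚ

  projection : ℤ⁸ → Operator
  projection w = record
    { fun = λ (x , y) → project w x , project w y
    ; fun* = λ (x , y) → project w x , project w y
    ; adjoint = projection-adjoint w
    ; commutesJ = projection-commutes w }

  project-project : ∀ w u x y → dot (project w (project u x)) y
    ≡ weightℚ w ℚ.* (weightℚ u ℚ.* (dot (toℚ u) x ℚ.* fromℤ ⟨ u , w ⟩) ℚ.* dot (toℚ w) y)
  project-project w u x y = ≡.trans (dot-project w (project u x) y)
    (cong (λ s → weightℚ w ℚ.* (s ℚ.* dot (toℚ w) y)) (≡.trans (dot-comm (toℚ w) (project u x))
      (≡.trans (dot-project u x (toℚ w)) (cong (λ s → weightℚ u ℚ.* (dot (toℚ u) x ℚ.* s)) (dot-toℚ u w)))))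

  projection-idempotent : ∀ w → μ w ℤ.* ⟨ w , w ⟩ ≡ ℤ.+ 8 → projection w ≐ projection w ⊛ projection w
  projection-idempotent w norm = ext λ (x , x′) (y , y′) → ≡.sym (cong₂ ℚ._+_ (same x y) (same x′ y′))
    where
    same : ∀ x y → dot (project w (project w x)) y ≡ dot (project w x) y
    same x y = begin
      dot (project w (project w x)) y
        ≡⟨ project-project w w x y ⟩
      weightℚ w ℚ.* (weightℚ w ℚ.* (dot (toℚ w) x ℚ.* fromℤ ⟨ w , w ⟩) ℚ.* dot (toℚ w) y)
        ≡⟨ solve 6 (λ l e m p n q → l :* ((e :* m) :* (p :* n) :* q) := (e :* (m :* n)) :* (l :* (p :* q))) refl
             (weightℚ w) ⅛ (fromℤ (μ w)) (dot (toℚ w) x) (fromℤ ⟨ w , w ⟩) (dot (toℚ w) y) ⟩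
      ⅛ ℚ.* (fromℤ (μ w) ℚ.* fromℤ ⟨ w , w ⟩) ℚ.* (weightℚ w ℚ.* (dot (toℚ w) x ℚ.* dot (toℚ w) y))
        ≡⟨ cong₂ (λ s t → ⅛ ℚ.* s ℚ.* t) (≡.trans (≡.sym (fromℤ-* (μ w) ⟨ w , w ⟩)) (cong fromℤ norm)) (≡.sym (dot-project w x y)) ⟩
      ⅛ ℚ.* 8ℚ ℚ.* dot (project w x) y
        ≡⟨ ℚ.*-identityˡ (dot (project w x) y) ⟩
      dot (project w x) y ∎
      where open ≡.≡-Reasoning

  projection-orthogonal : ∀ w u → ⟨ u , w ⟩ ≡ 0ℤ → projection w ⊛ projection u ≐ 𝟎ᵒ
  projection-orthogonal w u orth = ext λ (x , x′) (y , y′) → ≡.trans (cong₂ ℚ._+_ (zero′ x y) (zero′ x′ y′)) (≡.sym (⟪𝟎⟫ (x , x′) (y , y′)))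
    where
    zero′ : ∀ x y → dot (project w (project u x)) y ≡ 0ℚ
    zero′ x y = ≡.trans (project-project w u x y) (≡.trans
      (cong (λ n → weightℚ w ℚ.* (weightℚ u ℚ.* (dot (toℚ u) x ℚ.* fromℤ n) ℚ.* dot (toℚ w) y)) orth)
      (solve 4 (λ l k p q → l :* (k :* (p :* con 0ℚ) :* q) := con 0ℚ) refl (weightℚ w) (weightℚ u) (dot (toℚ u) x) (dot (toℚ w) y)))

  open UnitalC*Algebra algebra using (ring; Carrier; sum; _⋆) renaming (_≈_ to _≋_; _*_ to _*ₐ_; 1# to 1ₐ; 0# to 0ₐ)

  proj : ℤ⁸ → Carrier
  proj w = constant (projection w)

  sum-term : ∀ {n} (f : Fin n → Carrier) k x y → ⟪ Operator.fun (Element.term (sum f) k) x , y ⟫ ≡ sumℚ (λ i → ⟪ Operator.fun (Element.term (f i) k) x , y ⟫)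
  sum-term {zero}  f k x y = ⟪𝟎⟫ x y
  sum-term {suc n} f k x y = ≡.trans (⟪⊹⟫ (Element.term (f zero) k) (Element.term (sum (f ∘ suc)) k) x y)
    (cong (⟪ Operator.fun (Element.term (f zero) k) x , y ⟫ ℚ.+_) (sum-term (f ∘ suc) k x y))

  frame-resolution : ∀ {w} → IsFrame w → sum (λ k → proj (w k)) ≋ 1ₐ
  frame-resolution {w} frame = pointwise {sum (λ k → proj (w k))} {constant 𝟏ᵒ} λ n → ext λ (x , x′) (y , y′) →
    ≡.trans (sum-term (λ k → proj (w k)) n (x , x′) (y , y′))
    (≡.trans (sumℚ-+ (λ k → dot (project (w k) x) y) (λ k → dot (project (w k) x′) y′))
      (cong₂ ℚ._+_ (total x y) (total x′ y′)))
    where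
    total : ∀ x y → sumℚ (λ k → dot (project (w k) x) y) ≡ dot x y
    total x y = ≡.trans (sumℚ-cong λ k → dot-project (w k) x y) (parseval {w} frame x y)

-- The action of the octonion units on the frames

Products : Set
Products = Vec (Vec (Vec (Fin 8) 8) 8) 15

at : ∀ {A : Set} {m n} → Vec (Vec A n) m → Fin m → Fin n → A
at b v w = lookup (lookup b v) w

-- Modulo signs and the stabiliser of a frame's lines, the Pauli operators form an elementary
-- abelian group of order 8 acting regularly on the frame. Hence the products are commutative and
-- every unit acts as an involution.
ProductFacts : Products → Set
ProductFacts ps = (∀ c v w → at (lookup ps c) v w ≡ at (lookup ps c) w v)
                × (∀ c v w → at (lookup ps c) (at (lookup ps c) v w) w ≡ v)

productFacts? : ∀ ps → Dec (ProductFacts ps)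
productFacts? ps = (Fin.all? λ c → Fin.all? λ v → Fin.all? λ w → at (lookup ps c) v w Fin.≟ at (lookup ps c) w v)
  ×-dec (Fin.all? λ c → Fin.all? λ v → Fin.all? λ w → at (lookup ps c) (at (lookup ps c) v w) w Fin.≟ v)

block : Table 120 → Fin 15 → Fin 15 → Vec (Vec Bool 8) 8
block t c d = tabulate λ v → tabulate λ w → entry t (Fin.combine c v) (Fin.combine d w)

at-block : ∀ t c d v w → at (block t c d) v w ≡ entry t (Fin.combine c v) (Fin.combine d w)
at-block t c d v w = ≡.trans
  (cong (λ r → lookup r w) (Vec.lookup∘tabulate (λ v → tabulate λ w → entry t (Fin.combine c v) (Fin.combine d w)) v))
  (Vec.lookup∘tabulate (λ w → entry t (Fin.combine c v) (Fin.combine d w)) w)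

-- For frames c ≠ d, orthogonality of the v-th root of c and the w-th root of d is the sum of a bit
-- of v and a bit of w; so is disjointness of cosets, and the octonion units add the second kind of
-- bits to the first.
Twisted : (bE bΓ : Vec (Vec Bool 8) 8) (mc md : Vec (Vec (Fin 8) 8) 8) → Set
Twisted bE bΓ mc md =
    (∀ v t → at bE v t ≡ (at bE v 0F xor at bE 0F 0F) xor at bE 0F t)
  × (∀ t w → at bΓ t w ≡ at bΓ t 0F xor at bΓ 0F w)
  × (∀ v t → at bE (at mc v t) 0F ≡ at bE v 0F xor at bΓ t 0F)
  × (∀ t w → at bE 0F (at md t w) ≡ at bE 0F t xor at bΓ 0F w)

twisted? : ∀ bE bΓ mc md → Dec (Twisted bE bΓ mc md)
twisted? bE bΓ mc md =
        (Fin.all? λ v → Fin.all? λ t → at bE v t Bool.≟ ((at bE v 0F xor at bE 0F 0F) xor at bE 0F t))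
  ×-dec (Fin.all? λ t → Fin.all? λ w → at bΓ t w Bool.≟ (at bΓ t 0F xor at bΓ 0F w))
  ×-dec (Fin.all? λ v → Fin.all? λ t → at bE (at mc v t) 0F Bool.≟ (at bE v 0F xor at bΓ t 0F))
  ×-dec (Fin.all? λ t → Fin.all? λ w → at bE 0F (at md t w) Bool.≟ (at bE 0F t xor at bΓ 0F w))

-- If the two entries on the right differ, the entry on the left is `true`. This is the
-- orthogonality that `resolutions-agree` asks for.
twisted-sum : ∀ {bE bΓ mc md} → Twisted bE bΓ mc md → ∀ v t t′ w →
  at bE (at mc v t′) (at md t w) ≡ at bE v t xor at bΓ t′ w
twisted-sum {bE} {bΓ} {mc} {md} (f₁ , f₂ , f₃ , f₄) v t t′ w = begin
  at bE (at mc v t′) (at md t w)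
    ≡⟨ f₁ (at mc v t′) (at md t w) ⟩
  (at bE (at mc v t′) 0F xor at bE 0F 0F) xor at bE 0F (at md t w)
    ≡⟨ cong₂ (λ p q → (p xor at bE 0F 0F) xor q) (f₃ v t′) (f₄ t w) ⟩
  ((at bE v 0F xor at bΓ t′ 0F) xor at bE 0F 0F) xor (at bE 0F t xor at bΓ 0F w)
    ≡⟨ solveᵇ 5 (λ a b e f g → ((a ⊻ b) ⊻ e) ⊻ (f ⊻ g) ≜ ((a ⊻ e) ⊻ f) ⊻ (b ⊻ g)) refl
         (at bE v 0F) (at bΓ t′ 0F) (at bE 0F 0F) (at bE 0F t) (at bΓ 0F w) ⟩
  ((at bE v 0F xor at bE 0F 0F) xor at bE 0F t) xor (at bΓ t′ 0F xor at bΓ 0F w)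
    ≡⟨ cong₂ _xor_ (f₁ v t) (f₂ t′ w) ⟨
  at bE v t xor at bΓ t′ w ∎
  where
  open ≡.≡-Reasoning
  open xor-∧-Solver using () renaming (solve to solveᵇ; _:+_ to _⊻_; _:=_ to _≜_)

TwistedBlocks : (tE tΓ : Table 120) → Products → Set
TwistedBlocks tE tΓ ps = ∀ c d → c ≢ d → Twisted (block tE c d) (block tΓ c d) (lookup ps c) (lookup ps d)

CliqueBlocks : Table 120 → Set
CliqueBlocks t = ∀ c v w → v ≢ w → T (at (block t c c) v w)

opaque
  unfolding E₈-table Γ-table

  -- The w-th unit moves line v of frame c to the line whose number is recorded here; signs are
  -- ignored.
  products : Products
  products = tabulate λ c → tabulate λ v → tabulate λ w → search λ k →
    does (octonion (λ z → ℤ.- z) w (root c v) ≈±? root c k)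

  productFacts : ProductFacts products
  productFacts = from-yes (productFacts? products)

  blockFacts : TwistedBlocks E₈-table Γ-table products × CliqueBlocks Γ-table
  blockFacts = from-yes (check E₈-table Γ-table products)
    where
    check : ∀ tE tΓ ps → Dec (TwistedBlocks tE tΓ ps × CliqueBlocks tΓ)
    check tE tΓ ps = (Fin.all? λ c → Fin.all? λ d → ¬? (c Fin.≟ d) →-dec
        twisted? (block tE c d) (block tΓ c d) (lookup ps c) (lookup ps d))
      ×-dec (Fin.all? λ c → Fin.all? λ v → Fin.all? λ w → ¬? (v Fin.≟ w) →-dec Bool.T? (at (block tΓ c c) v w))

Γ-cliques : ∀ c v w → v ≢ w → T (entry Γ-table (Fin.combine c v) (Fin.combine c w))
Γ-cliques c v w v≢w = ≡.subst T (at-block Γ-table c c v w) (proj₂ blockFacts c v w v≢w)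

infix 30 _·⟨_⟩_

_·⟨_⟩_ : Fin 8 → Fin 15 → Fin 8 → Fin 8
v ·⟨ c ⟩ w = at (lookup products c) v w

·-comm : ∀ c v w → v ·⟨ c ⟩ w ≡ w ·⟨ c ⟩ v
·-comm = proj₁ productFacts

·-involutive : ∀ c v w → (v ·⟨ c ⟩ w) ·⟨ c ⟩ w ≡ v
·-involutive = proj₂ productFacts

·-permutation : Fin 15 → Fin 8 → Permutation′ 8
·-permutation c v = permutation (λ w → w ·⟨ c ⟩ v) (λ w → w ·⟨ c ⟩ v) (λ w → ·-involutive c w v) (λ w → ·-involutive c w v)

·-cancelʳ : ∀ c {v v′} w → v ·⟨ c ⟩ w ≡ v′ ·⟨ c ⟩ w → v ≡ v′
·-cancelʳ c {v} {v′} w eq = ≡.trans (≡.sym (·-involutive c v w)) (≡.trans (cong (λ x → x ·⟨ c ⟩ w) eq) (·-involutive c v′ w))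

xor-≢ : ∀ {a b} → a ≢ b → T (a xor b)
xor-≢ {true}  {true}  a≢b = contradiction refl a≢b
xor-≢ {true}  {false} _   = _
xor-≢ {false} {true}  _   = _
xor-≢ {false} {false} a≢b = contradiction refl a≢b

vertexIndex : Fin 15 → Fin 8 → Fin 120
vertexIndex = Fin.combine

-- For c ≠ d this is `twisted-sum`. Within one frame both tables are complete graphs, so the entries
-- differ only if exactly one of v = t and t′ = w holds; by cancellation the two products are then
-- different lines of an orthogonal frame.
products-orthogonal : ∀ c v d w t t′ → entry E₈-table (vertexIndex c v) (vertexIndex d t) ≢ entry Γ-table (vertexIndex c t′) (vertexIndex d w) →
  T (entry E₈-table (vertexIndex c (v ·⟨ c ⟩ t′)) (vertexIndex d (t ·⟨ d ⟩ w)))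
products-orthogonal c v d w t t′ differ with c Fin.≟ d
... | no c≢d = ≡.subst T (at-block E₈-table c d (v ·⟨ c ⟩ t′) (t ·⟨ d ⟩ w))
  (≡.subst T (≡.sym (twisted-sum {block E₈-table c d} {block Γ-table c d} {lookup products c} {lookup products d}
      (proj₁ blockFacts c d c≢d) v t t′ w))
    (xor-≢ {at (block E₈-table c d) v t} λ eq → differ (≡.trans (≡.sym (at-block E₈-table c d v t)) (≡.trans eq (at-block Γ-table c d t′ w)))))
... | yes refl = E₈-cliques c (v ·⟨ c ⟩ t′) (t ·⟨ c ⟩ w) distinct
  where
  true≡ : ∀ {a b} → T a → T b → a ≡ b
  true≡ {true} {true} _ _ = refl
  false≡ : ∀ {a b} → ¬ T a → ¬ T b → a ≡ b
  false≡ {false} {false} _  _  = refl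
  false≡ {true}          ¬a _  = contradiction _ ¬a
  false≡ {false} {true}  _  ¬b = contradiction _ ¬b
  irreflexive : ∀ {G} (G-tab : Tabulated G 120) i → ¬ T (entry (Tabulated.table G-tab) i i)
  irreflexive {G} G-tab i p = Graph.~-irrefl G (Graph-refl G) (Equivalence.to (Tabulated.table⇔ G-tab i i) p)
    where
    Graph-refl : ∀ G {x} → Graph._≈_ G x x
    Graph-refl G = Setoid.refl (Graph.vertices G)
  distinct : v ·⟨ c ⟩ t′ ≢ t ·⟨ c ⟩ w
  distinct eq with v Fin.≟ t | t′ Fin.≟ w
  ... | yes refl | yes refl = differ (false≡ (irreflexive G-E₈-tabulated (vertexIndex c v)) (irreflexive complementΓ-tabulated (vertexIndex c w)))
  ... | no v≢t   | no t′≢w  = differ (true≡ (E₈-cliques c v t v≢t) (Γ-cliques c t′ w t′≢w))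
  ... | yes refl | no t′≢w  = t′≢w (·-cancelʳ c v (≡.trans (·-comm c t′ v) (≡.trans eq (·-comm c v w))))
  ... | no v≢t   | yes refl = v≢t (·-cancelʳ c w eq)

-- The quantum permutation matrix

isFrame-cong : ∀ {w w′} → (∀ k → w k ≡ w′ k) → IsFrame w → IsFrame w′
isFrame-cong {w} {w′} eq frame i j = ≡.trans
  (sumℤ-cong λ k → cong (λ x → μ x ℤ.* (lookup x i ℤ.* lookup x j)) (≡.sym (eq k))) (frame i j)

abstract
  frame-isFrame : ∀ c → IsFrame (λ k → rootAt (vertexIndex c k))
  frame-isFrame c = isFrame-cong (Vec.lookup∘tabulate (λ k → rootAt (vertexIndex c k)))
    (from-yes (Fin.all? λ c → isFrame? (tabulate λ k → rootAt (vertexIndex c k))) c)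
    where
    isFrame? : ∀ (ws : Vec ℤ⁸ 8) → Dec (IsFrame (lookup ws))
    isFrame? ws = Fin.all? λ i → Fin.all? λ j →
      sumℤ (λ k → μ (lookup ws k) ℤ.* (lookup (lookup ws k) i ℤ.* lookup (lookup ws k) j))
        ℤ.≟ (if does (i Fin.≟ j) then ℤ.+ 8 else 0ℤ)

  rootAt-norm : ∀ i → μ (rootAt i) ℤ.* ⟨ rootAt i , rootAt i ⟩ ≡ ℤ.+ 8
  rootAt-norm = from-yes (Fin.all? λ i → μ (rootAt i) ℤ.* ⟨ rootAt i , rootAt i ⟩ ℤ.≟ ℤ.+ 8)

-- Within a frame, u is the Latin square of projections given by the products v ·⟨ c ⟩ w.
module LatinBlocks (𝒜 : UnitalC*Algebra) (P : Fin 120 → UnitalC*Algebra.Carrier 𝒜)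
  (P-selfAdjoint : ∀ i → UnitalC*Algebra._≈_ 𝒜 (P i) (UnitalC*Algebra._⋆ 𝒜 (P i)))
  (P-idempotent : ∀ i → UnitalC*Algebra._≈_ 𝒜 (P i) (UnitalC*Algebra._*_ 𝒜 (P i) (P i)))
  (P-orthogonal : ∀ i j → T (entry E₈-table j i) → UnitalC*Algebra._≈_ 𝒜 (UnitalC*Algebra._*_ 𝒜 (P i) (P j)) (UnitalC*Algebra.0# 𝒜))
  (P-frame : ∀ c → UnitalC*Algebra._≈_ 𝒜 (UnitalC*Algebra.sum 𝒜 (λ k → P (vertexIndex c k))) (UnitalC*Algebra.1# 𝒜))
  where

  open UnitalC*Algebra 𝒜 using (ring; Carrier; sum; _⋆; ⋆-cong; ⋆-+; Matrix; _⊗_; IsQuantumPermutationMatrix)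
  open Ring ring using (_≈_; _+_; _*_; 0#; 1#; +-commutativeMonoid; +-identityˡ; +-identityʳ; setoid; *-congˡ; *-congʳ; zeroˡ; zeroʳ)
    renaming (refl to ≈-refl; sym to ≈-sym; trans to ≈-trans; reflexive to ≈-reflexive)
  open RingSums ring
  open CMSum +-commutativeMonoid using (sum-cong-≋; sum-permute)

  0⋆≈0 : 0# ⋆ ≈ 0#
  0⋆≈0 = begin
    0# ⋆                          ≈⟨ +-identityʳ (0# ⋆) ⟨
    0# ⋆ + 0#                     ≈⟨ +-congˡ (-‿inverseʳ (0# ⋆)) ⟨
    0# ⋆ + (0# ⋆ + - (0# ⋆))      ≈⟨ +-assoc (0# ⋆) (0# ⋆) (- (0# ⋆)) ⟨
    0# ⋆ + 0# ⋆ + - (0# ⋆)        ≈⟨ +-congʳ (⋆-+ 0# 0#) ⟨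
    (0# + 0#) ⋆ + - (0# ⋆)        ≈⟨ +-congʳ (⋆-cong (+-identityˡ 0#)) ⟩
    0# ⋆ + - (0# ⋆)               ≈⟨ -‿inverseʳ (0# ⋆) ⟩
    0#                            ∎
    where
    open Ring ring using (-_; +-assoc; +-congˡ; +-congʳ; -‿inverseʳ)
    open import Relation.Binary.Reasoning.Setoid setoid

  P-column : ∀ c w → sum (λ v → P (vertexIndex c (v ·⟨ c ⟩ w))) ≈ 1#
  P-column c w = ≈-trans (≈-sym (sum-permute (λ k → P (vertexIndex c k)) (·-permutation c w))) (P-frame c)

  P-row : ∀ c v → sum (λ w → P (vertexIndex c (v ·⟨ c ⟩ w))) ≈ 1#
  P-row c v = ≈-trans (sum-cong-≋ λ w → ≈-reflexive (cong (λ k → P (vertexIndex c k)) (·-comm c v w))) (P-column c v)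

  uAt : Fin 15 × Fin 8 → Fin 15 × Fin 8 → Carrier
  uAt (c , v) (d , w) = if does (c Fin.≟ d) then P (vertexIndex c (v ·⟨ c ⟩ w)) else 0#

  u : Matrix 120
  u i j = uAt (Fin.remQuot {15} 8 i) (Fin.remQuot {15} 8 j)

  u-combine : ∀ c v d w → u (vertexIndex c v) (vertexIndex d w) ≡ uAt (c , v) (d , w)
  u-combine c v d w = cong₂ uAt (Fin.remQuot-combine c v) (Fin.remQuot-combine d w)

  u-same : ∀ c v w → u (vertexIndex c v) (vertexIndex c w) ≈ P (vertexIndex c (v ·⟨ c ⟩ w))
  u-same c v w = ≈-reflexive (≡.trans (u-combine c v c w) same)
    where
    same : uAt (c , v) (c , w) ≡ P (vertexIndex c (v ·⟨ c ⟩ w))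
    same with c Fin.≟ c
    ... | yes _  = refl
    ... | no c≢c = contradiction refl c≢c

  u-other : ∀ {c d} v w → c ≢ d → u (vertexIndex c v) (vertexIndex d w) ≈ 0#
  u-other {c} {d} v w c≢d = ≈-reflexive (≡.trans (u-combine c v d w) other)
    where
    other : uAt (c , v) (d , w) ≡ 0#
    other with c Fin.≟ d
    ... | yes c≡d = contradiction c≡d c≢d
    ... | no _    = refl

  byFrames : ∀ (Q : Fin 120 → Set) → (∀ c v → Q (vertexIndex c v)) → ∀ i → Q i
  byFrames Q h i = ≡.subst Q (Fin.combine-remQuot {15} 8 i) (h (Fin.quotient {15} 8 i) (Fin.remainder {15} 8 i))

  uAt-projection : ∀ (Q : Carrier → Set) → (∀ i → Q (P i)) → Q 0# → ∀ x y → Q (uAt x y)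
  uAt-projection Q qP q0 (c , v) (d , w) with does (c Fin.≟ d)
  ... | true  = qP _
  ... | false = q0

  sum-frame : ∀ (f : Fin 120 → Carrier) c → (∀ d v → d ≢ c → f (vertexIndex d v) ≈ 0#) →
              sum f ≈ sum (λ v → f (vertexIndex c v))
  sum-frame f c vanishes = ≈-trans (sum-combine 15 {8} f)
    (sum-single (λ d → sum (λ v → f (vertexIndex d v))) c (λ d d≢c → sum-vanishes (λ v → vanishes d v d≢c)))

  u-isQuantumPermutation : IsQuantumPermutationMatrix u
  u-isQuantumPermutation = record
    { selfAdjoint = λ i j → uAt-projection (λ a → a ≈ a ⋆) P-selfAdjoint (≈-sym 0⋆≈0) (Fin.remQuot {15} 8 i) (Fin.remQuot {15} 8 j)
    ; idempotent = λ i j → uAt-projection (λ a → a ≈ a * a) P-idempotent (≈-sym (zeroˡ 0#)) (Fin.remQuot {15} 8 i) (Fin.remQuot {15} 8 j)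
    ; rowSum = byFrames (λ i → sum (λ k → u i k) ≈ 1#) λ c v → ≈-trans
        (sum-frame (λ k → u (vertexIndex c v) k) c (λ d w d≢c → u-other v w (d≢c ∘ ≡.sym)))
        (≈-trans (sum-cong-≋ λ w → u-same c v w) (P-row c v))
    ; colSum = byFrames (λ i → sum (λ k → u k i) ≈ 1#) λ c w → ≈-trans
        (sum-frame (λ k → u k (vertexIndex c w)) c (λ d v d≢c → u-other v w d≢c))
        (≈-trans (sum-cong-≋ λ v → u-same c v w) (P-column c w)) }

  adjacency : Table 120 → Matrix 120
  adjacency t i j = indicator (entry t i j)

  adjacency-correct : ∀ {G} (G-tab : Tabulated G 120) →
    IsAdjacencyMatrix 𝒜 G (Tabulated.numbering G-tab) (adjacency (Tabulated.table G-tab))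
  adjacency-correct G-tab i j = (λ i~j → present (Equivalence.from (table⇔ i j) i~j)) , (λ i≁j → absent (i≁j ∘ Equivalence.to (table⇔ i j)))
    where
    open Tabulated G-tab
    present : ∀ {b} → T b → indicator b ≈ 1#
    present {true} _ = ≈-refl
    absent : ∀ {b} → ¬ T b → indicator b ≈ 0#
    absent {true}  ¬p = contradiction _ ¬p
    absent {false} _  = ≈-refl

  -- As u is block diagonal, the left side involves only a column of the Latin square of frame d and
  -- the right side only a row of that of frame c. Both are resolutions of the identity, and
  -- `products-orthogonal` compares the selected parts.
  u-intertwines : ∀ i j → (adjacency E₈-table ⊗ u) i j ≈ (u ⊗ adjacency Γ-table) i j
  u-intertwines = byFrames _ λ c v → byFrames _ λ d w → begin
    sum (λ k → adjacency E₈-table (vertexIndex c v) k * u k (vertexIndex d w))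
      ≈⟨ sum-frame (λ k → adjacency E₈-table (vertexIndex c v) k * u k (vertexIndex d w)) d (λ e t e≢d →
           ≈-trans (*-congˡ (u-other t w e≢d)) (zeroʳ (adjacency E₈-table (vertexIndex c v) (vertexIndex e t)))) ⟩
    sum (λ t → adjacency E₈-table (vertexIndex c v) (vertexIndex d t) * u (vertexIndex d t) (vertexIndex d w))
      ≈⟨ sum-cong-≋ (λ t → *-congˡ {adjacency E₈-table (vertexIndex c v) (vertexIndex d t)} (u-same d t w)) ⟩
    sum (λ t → indicator (entry E₈-table (vertexIndex c v) (vertexIndex d t)) * P (vertexIndex d (t ·⟨ d ⟩ w)))
      ≈⟨ resolutions-agree (λ t → P (vertexIndex d (t ·⟨ d ⟩ w))) (λ t → P (vertexIndex c (v ·⟨ c ⟩ t)))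
           (λ t → entry E₈-table (vertexIndex c v) (vertexIndex d t)) (λ t → entry Γ-table (vertexIndex c t) (vertexIndex d w))
           (P-column d w) (P-row c v)
           (λ t t′ differ → P-orthogonal (vertexIndex d (t ·⟨ d ⟩ w)) (vertexIndex c (v ·⟨ c ⟩ t′)) (products-orthogonal c v d w t t′ differ)) ⟩
    sum (λ t → P (vertexIndex c (v ·⟨ c ⟩ t)) * indicator (entry Γ-table (vertexIndex c t) (vertexIndex d w)))
      ≈⟨ sum-cong-≋ (λ t → *-congʳ {adjacency Γ-table (vertexIndex c t) (vertexIndex d w)} (u-same c v t)) ⟨
    sum (λ t → u (vertexIndex c v) (vertexIndex c t) * adjacency Γ-table (vertexIndex c t) (vertexIndex d w))
      ≈⟨ sum-frame (λ k → u (vertexIndex c v) k * adjacency Γ-table k (vertexIndex d w)) c (λ e t e≢c →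
           ≈-trans (*-congʳ (u-other v t (e≢c ∘ ≡.sym))) (zeroˡ (adjacency Γ-table (vertexIndex e t) (vertexIndex d w)))) ⟨
    sum (λ k → u (vertexIndex c v) k * adjacency Γ-table k (vertexIndex d w)) ∎
    where
    open import Relation.Binary.Reasoning.Setoid setoid

-- The projections onto the root lines in M₈(ℂ)

open ComplexVectors 7 using (complexVectors)
open Operators complexVectors
open Completion complexVectors using (Element; constant; pointwise)
open C*Completion complexVectors using (algebra)

opaque
  -- Opaque, so that the block computations see only the four properties required by `LatinBlocks`
  -- and never the rational coordinates.
  rootProjection : Fin 120 → Element
  rootProjection i = proj (rootAt i)

  rootProjection-selfAdjoint : ∀ i → UnitalC*Algebra._≈_ algebra (rootProjection i) (UnitalC*Algebra._⋆ algebra (rootProjection i))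
  rootProjection-selfAdjoint i = pointwise λ n → ext λ _ _ → refl

  rootProjection-idempotent : ∀ i → UnitalC*Algebra._≈_ algebra (rootProjection i) (UnitalC*Algebra._*_ algebra (rootProjection i) (rootProjection i))
  rootProjection-idempotent i = pointwise λ n → projection-idempotent (rootAt i) (rootAt-norm i)

  rootProjection-orthogonal : ∀ i j → T (entry E₈-table j i) →
    UnitalC*Algebra._≈_ algebra (UnitalC*Algebra._*_ algebra (rootProjection i) (rootProjection j)) (UnitalC*Algebra.0# algebra)
  rootProjection-orthogonal i j p = pointwise λ n →
    projection-orthogonal (rootAt i) (rootAt j) (Equivalence.to (E₈-table⇔ j i) p)

  rootProjection-def : ∀ i → rootProjection i ≡ proj (rootAt i)
  rootProjection-def i = refl

rootProjection-frame : ∀ c → UnitalC*Algebra._≈_ algebra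
  (UnitalC*Algebra.sum algebra (λ k → rootProjection (vertexIndex c k))) (UnitalC*Algebra.1# algebra)
rootProjection-frame c = Ring.trans (UnitalC*Algebra.ring algebra)
  (Ring.reflexive (UnitalC*Algebra.ring algebra)
    (CMSum.sum-cong-≗ (Ring.+-commutativeMonoid (UnitalC*Algebra.ring algebra))
      {8} {λ k → rootProjection (vertexIndex c k)} {λ k → proj (rootAt (vertexIndex c k))}
      (λ k → rootProjection-def (vertexIndex c k))))
  (frame-resolution {λ k → rootAt (vertexIndex c k)} (frame-isFrame c))

module Blocks = LatinBlocks algebra rootProjection rootProjection-selfAdjoint rootProjection-idempotent rootProjection-orthogonal rootProjection-frame

theorem3p13 : QuantumIsomorphic G-E₈ (complement Γ₁)
            × ¬ Isomorphic G-E₈ (complement Γ₁)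
            × IsStronglyRegular G-E₈
            × IsStronglyRegular (complement Γ₁)
theorem3p13 =
    record
      { numberingG = Tabulated.numbering G-E₈-tabulated
      ; numberingH = Tabulated.numbering complementΓ-tabulated
      ; algebra = algebra
      ; A-G = Blocks.adjacency E₈-table
      ; A-H = Blocks.adjacency Γ-table
      ; A-G-correct = Blocks.adjacency-correct G-E₈-tabulated
      ; A-H-correct = Blocks.adjacency-correct complementΓ-tabulated
      ; u = Blocks.u
      ; u-isQPM = Blocks.u-isQuantumPermutation
      ; intertwines = Blocks.u-intertwines }
  , (λ iso → Γ-notCompletable (completion-transport G-E₈-tabulated complementΓ-tabulated iso E₈-completable))
  , (120 , 63 , 30 , 36 , tabulated⇒stronglyRegular G-E₈-tabulated E₈-regular)
  , (120 , 63 , 30 , 36 , tabulated⇒stronglyRegular complementΓ-tabulated Γ-regular)
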